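{- Let $G$ be a finite simple connected graph. If $\beth^{i}(K^{h(G)})=\beth^{i}(G)$ for some $i\in\{1,2,3\}$, then $G$ belongs to the Hadwiger class $\mathcal{H}$, i.e. $\chi(G)\le h(G)$.
   Context: All graphs are finite and simple. $K^{t}$ is the complete graph on $t$ vertices, $\chi(G)$ is the chromatic number, and the Hadwiger number $h(G)$ is the maximum $t$ such that $K^{t}$ is a minor of $G$. The Hadwiger class $\mathcal{H}$ is the collection of finite connected simple graphs $G$ with $\chi(G)\le h(G)$. $C(G)$ is the set of all induced cycles in $G$ (of length at least 3). Solid graphs are the graphs of the following four kinds. (1) Pyramid: a graph consisting of a cycle $C$ and a vertex $w\notin V(C)$ together with at least three edges between $w$ and $C$. (2) Trihedron: the union of three paths $P_1,P_2,P_3$, each of length at least 2, having the same two (distinct) endpoints, such that no interior vertex of any of the paths is used in another of the paths. (3) Stamp: the union of a triangle $T$ and three paths $P_1,P_2,P_3$ of length $\ge 1$ that start at the three different vertices of $T$ and all end at the same vertex $x\notin V(T)$, such that the $P_i-x$ are pairwise vertex-disjoint and each $P_i$ meets $T$ only in its starting vertex. (4) Prism: $T\cup T'\cup P_1\cup P_2\cup P_3$ where $T,T'$ are vertex-disjoint triangles with vertices $x_1,x_2,x_3$ and $y_1,y_2,y_3$ respectively, and the $P_i$ are pairwise vertex-disjoint paths from $x_i$ to $y_i$ (so $P_i$ meets $T\cup T'$ only in $x_i,y_i$). A solid in $G$ is an induced subgraph of $G$ that is isomorphic to a solid graph; $S(G)$ is the set of all solids in $G$. The three graph characteristics of a connected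 graph $G$ are $\beth^{1}(G)=|E(G)|-|V(G)|$, $\beth^{2}(G)=|C(G)|-|E(G)|+|V(G)|$, and $\beth^{3}(G)=|S(G)|-|C(G)|+|E(G)|-|V(G)|$. -}

module Defs where

open import Data.Fin using (Fin; zero; suc; inject₁; fromℕ; _<?_; _≟_)
open import Data.Fin.Patterns using (0F; 1F; 2F)
open import Data.Fin.Subset using (Subset; _∈_; Empty; _∩_)
open import Data.Integer using (ℤ; +_; _+_; _-_)
open import Data.List using (List; length; filter; allFin; cartesianProduct)
import Data.List.Membership.Propositional as List
open import Data.List.Relation.Unary.Unique.Propositional using (Unique)
open import Data.Nat using (ℕ; suc; _≤_)
open import Data.Product using (Σ; ∃-syntax; _×_; _,_; proj₁)
open import Data.Sum using (_⊎_)
open import Function using (_∘_; _on_)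
open import Function.Bundles using (_⇔_)
open import Function.Definitions using (Injective)
open import Level using (0ℓ)
open import Relation.Binary.Construct.Closure.ReflexiveTransitive using (Star)
open import Relation.Binary.Core using (Rel)
open import Relation.Binary.Definitions using (Symmetric; Irreflexive; Decidable)
open import Relation.Binary.PropositionalEquality using (_≡_; _≢_; refl; sym)
open import Relation.Nullary using (¬_)
open import Relation.Nullary.Decidable using (¬?; _×-dec_)
open import Relation.Unary using (Pred)

private
  variable
    V W : Set
    n : ℕ

-- Finiteness is imposed by the choice of vertex type: Fin n, or the elements
-- of a subset of Fin n.
record Graph (V : Set) : Set₁ where
  infix 4 _~_ _~?_
  field
    _~_      : Rel V 0ℓ
    _~?_     : Decidable _~_
    ~-sym    : Symmetric _~_
    ~-irrefl : Irreflexive _≡_ _~_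

K : (t : ℕ) → Graph (Fin t)
K t = record
  { _~_      = _≢_
  ; _~?_     = λ u v → ¬? (u ≟ v)
  ; ~-sym    = λ u≢v → u≢v ∘ sym
  ; ~-irrefl = λ u≡v u≢v → u≢v u≡v
  }

infix 8 _[_]

_[_] : Graph (Fin n) → (S : Subset n) → Graph (∃[ v ] v ∈ S)
G [ S ] = record
  { _~_      = _~_ on proj₁
  ; _~?_     = λ u v → proj₁ u ~? proj₁ v
  ; ~-sym    = ~-sym
  ; ~-irrefl = λ { refl → ~-irrefl refl }
  }
  where open Graph G

-- The first component excludes the graph without vertices.
Connected : Graph V → Set
Connected {V} G = V × (∀ u v → Star (Graph._~_ G) u v)

-- B assigns to each vertex of H its branch set.
record _≼_ (H : Graph W) (G : Graph (Fin n)) : Set where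
  private
    module H = Graph H
    module G = Graph G
  field
    B         : W → Subset n
    connected : ∀ w → Connected (G [ B w ])
    disjoint  : ∀ {u w} → u ≢ w → Empty (B u ∩ B w)
    joined    : ∀ {u w} → u H.~ w →
                ∃[ x ] ∃[ y ] x ∈ B u × y ∈ B w × x G.~ y

IsHadwigerNumber : Graph (Fin n) → ℕ → Set
IsHadwigerNumber G h = K h ≼ G × (∀ t → K t ≼ G → t ≤ h)

Colourable : Graph V → ℕ → Set
Colourable {V} G k = Σ (V → Fin k) λ c → ∀ {u v} → u ~ v → c u ≢ c v
  where open Graph G

IsChromaticNumber : Graph V → ℕ → Set
IsChromaticNumber G χ = Colourable G χ × (∀ k → Colourable G k → χ ≤ k)

-- The vertex and edge sets of a subgraph.
record Part (V : Set) : Set₁ where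
  constructor ⟨_,_⟩
  field
    vertex : Pred V 0ℓ
    edge   : Rel V 0ℓ

open Part public

infixr 6 _∪_

_∪_ : Part V → Part V → Part V
X ∪ Y = ⟨ (λ v → vertex X v ⊎ vertex Y v) , (λ u v → edge X u v ⊎ edge Y u v) ⟩

⋃ : (Fin n → Part V) → Part V
⋃ X = ⟨ (λ v → ∃[ i ] vertex (X i) v) , (λ u v → ∃[ i ] edge (X i) u v) ⟩

_Equals_ : Graph V → Part V → Set
G Equals X = (∀ v → vertex X v) × (∀ u v → u ~ v ⇔ edge X u v)
  where open Graph G

module _ (G : Graph V) where
  open Graph G

  record Path (x y : V) : Set where
    field
      len       : ℕ
      at        : Fin (suc len) → V
      injective : Injective _≡_ _≡_ at
      step      : ∀ i → at (inject₁ i) ~ at (suc i)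
      start     : at zero ≡ x
      end       : at (fromℕ len) ≡ y

  -- A path with at least three vertices together with an edge joining its ends.
  record Cycle : Set where
    field
      {x y} : V
      path  : Path x y
      2≤len : 2 ≤ Path.len path
      close : y ~ x

  record Triangle : Set where
    field
      corner   : Fin 3 → V
      adjacent : ∀ {i j} → i ≢ j → corner i ~ corner j

open Path public using (len)
open Triangle public using (corner)

module _ {G : Graph V} where
  open Graph G

  ⟦_⟧ᵖ : {x y : V} → Path G x y → Part V
  ⟦ P ⟧ᵖ =
    ⟨ (λ v → ∃[ i ] at i ≡ v)
    , (λ u v → ∃[ i ] ((at (inject₁ i) ≡ u × at (suc i) ≡ v)
                     ⊎ (at (inject₁ i) ≡ v × at (suc i) ≡ u)))
    ⟩
    where open Path P

  ⟦_⟧ᶜ : Cycle G → Part V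
  ⟦ C ⟧ᶜ =
    ⟨ vertex ⟦ path ⟧ᵖ
    , (λ u v → edge ⟦ path ⟧ᵖ u v ⊎ (u ≡ x × v ≡ y) ⊎ (u ≡ y × v ≡ x))
    ⟩
    where open Cycle C

  ⟦_⟧ᵗ : Triangle G → Part V
  ⟦ T ⟧ᵗ =
    ⟨ (λ v → ∃[ i ] corner T i ≡ v)
    , (λ u v → ∃[ i ] ∃[ j ] i ≢ j × corner T i ≡ u × corner T j ≡ v)
    ⟩

  -- The vertex w and all edges between w and C.
  spokes : V → Cycle G → Part V
  spokes w C =
    ⟨ (λ v → v ≡ w)
    , (λ u v → u ~ v × ((u ≡ w × vertex ⟦ C ⟧ᶜ v) ⊎ (v ≡ w × vertex ⟦ C ⟧ᶜ u)))
    ⟩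

module _ (G : Graph V) where
  open Graph G

  IsCycle : Set
  IsCycle = Σ (Cycle G) λ C → G Equals ⟦ C ⟧ᶜ

  record IsPyramid : Set where
    field
      C        : Cycle G
      w        : V
      w∉C      : ¬ vertex ⟦ C ⟧ᶜ w
      foot     : Fin 3 → V
      foot-inj : Injective _≡_ _≡_ foot
      foot∈C   : ∀ i → vertex ⟦ C ⟧ᶜ (foot i)
      w~foot   : ∀ i → w ~ foot i
      union    : G Equals (⟦ C ⟧ᶜ ∪ spokes w C)

  record IsTrihedron : Set where
    field
      {x y}    : V
      x≢y      : x ≢ y
      P        : Fin 3 → Path G x y
      2≤len    : ∀ i → 2 ≤ len (P i)
      interior : ∀ {i j} → i ≢ j → ∀ {v} → vertex ⟦ P i ⟧ᵖ v → v ≢ x → v ≢ y →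
                 ¬ vertex ⟦ P j ⟧ᵖ v
      union    : G Equals ⋃ (λ i → ⟦ P i ⟧ᵖ)

  record IsStamp : Set where
    field
      T        : Triangle G
      x        : V
      x∉T      : ¬ vertex ⟦ T ⟧ᵗ x
      P        : ∀ i → Path G (corner T i) x
      1≤len    : ∀ i → 1 ≤ len (P i)
      disjoint : ∀ {i j} → i ≢ j → ∀ {v} →
                 vertex ⟦ P i ⟧ᵖ v → vertex ⟦ P j ⟧ᵖ v → v ≡ x
      P∩T      : ∀ i {v} → vertex ⟦ P i ⟧ᵖ v → vertex ⟦ T ⟧ᵗ v → v ≡ corner T i
      union    : G Equals (⟦ T ⟧ᵗ ∪ ⋃ (λ i → ⟦ P i ⟧ᵖ))

  record IsPrism : Set where
    field
      T T′     : Triangle G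
      T∩T′     : ∀ {v} → vertex ⟦ T ⟧ᵗ v → ¬ vertex ⟦ T′ ⟧ᵗ v
      P        : ∀ i → Path G (corner T i) (corner T′ i)
      disjoint : ∀ {i j} → i ≢ j → ∀ {v} →
                 vertex ⟦ P i ⟧ᵖ v → ¬ vertex ⟦ P j ⟧ᵖ v
      P∩T∪T′   : ∀ i {v} → vertex ⟦ P i ⟧ᵖ v → vertex (⟦ T ⟧ᵗ ∪ ⟦ T′ ⟧ᵗ) v →
                 v ≡ corner T i ⊎ v ≡ corner T′ i
      union    : G Equals (⟦ T ⟧ᵗ ∪ ⟦ T′ ⟧ᵗ ∪ ⋃ (λ i → ⟦ P i ⟧ᵖ))

  IsSolid : Set
  IsSolid = IsPyramid ⊎ IsTrihedron ⊎ IsStamp ⊎ IsPrism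

-- An induced subgraph is determined by its vertex set, so the sets C(G) and
-- S(G) are sets of subsets of the vertex set.  IsCycle and IsSolid hold for any
-- graph isomorphic to one satisfying them.
InducedCycle : Graph (Fin n) → Pred (Subset n) 0ℓ
InducedCycle G S = IsCycle (G [ S ])

Solid : Graph (Fin n) → Pred (Subset n) 0ℓ
Solid G S = IsSolid (G [ S ])

_HasSize_ : Pred (Subset n) 0ℓ → ℕ → Set
_HasSize_ {n} P k = Σ (List (Subset n)) λ Ss →
  Unique Ss × (∀ S → S List.∈ Ss ⇔ P S) × length Ss ≡ k

∣V∣ : Graph (Fin n) → ℕ
∣V∣ {n} _ = n

∣E∣ : Graph (Fin n) → ℕ
∣E∣ {n} G = length (filter (λ (u , v) → (u <? v) ×-dec (u ~? v))
                           (cartesianProduct (allFin n) (allFin n)))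
  where open Graph G

-- ℶ i G z says that the characteristic of G with index i has value z; the
-- indices 0F, 1F, 2F stand for the superscripts 1, 2, 3.
ℶ : Fin 3 → Graph (Fin n) → ℤ → Set
ℶ 0F G z = z ≡ + ∣E∣ G - + ∣V∣ G
ℶ 1F G z = ∃[ c ] InducedCycle G HasSize c × z ≡ + c - + ∣E∣ G + + ∣V∣ G
ℶ 2F G z = ∃[ c ] ∃[ s ] InducedCycle G HasSize c × Solid G HasSize s ×
           z ≡ + s - + c + + ∣E∣ G - + ∣V∣ G

{-# OPTIONS --safe #-}
-- Call a vertex v of a connected induced subgraph U linked if any two of its
-- neighbours in U are joined by an edge or by a path outside N[v], and any
-- three of them lie with v on a solid.  A linked vertex exists: grow a connected
-- set D until the vertices outside N[D] are adjacent to all of N(D), and recurse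
-- outside.  Deleting a linked vertex of degree d keeps U connected and lowers
-- ℶⁱ by at least C(d-1, i): there is an induced cycle through v for every pair and
-- a solid for every triple of neighbours, and the p induced cycles through
-- v and two given neighbours yield p - 1 further solids, one whenever two cycles
-- branch.  Colouring greedily in the reverse order, G gets k + 1 colours with
-- ℶⁱ(G) ≥ ℶⁱ(Kᵏ⁺¹).  If h ≥ 4, then ℶⁱ(Kᵗ) grows strictly from t = h on, so that
-- ℶⁱ(G) = ℶⁱ(Kʰ) gives k + 1 ≤ h.  If h ≤ 3, the equation is not needed: minimum
-- degree h forces a minor Kʰ⁺¹, hence every induced subgraph of G has a vertex of
-- degree less than h.

module Submission where

open import Defs
import Data.Nat.Properties as ℕ
open import Algebra.Properties.CommutativeSemigroup ℕ.+-commutativeSemigroup using () renaming (interchange to shuffle)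
open import Data.Empty using (⊥-elim)
open import Data.Fin as Fin using (Fin; zero; suc; inject₁; fromℕ; toℕ)
open import Data.Fin.Patterns using (0F; 1F; 2F)
open import Data.Fin.Properties using (any?; suc-injective; toℕ-inject₁; toℕ-injective; inject₁-injective; fromℕ≢inject₁; <-cmp; <-asym)
open import Data.Fin.Subset using (Subset; inside; _⊆_; _⊂_; ∣_∣) renaming (_∈_ to _∈ˢ_; _∉_ to _∉ˢ_; ⊤ to full)
open import Data.Fin.Subset.Properties using (_⊆?_; p⊂q⇒∣p∣<∣q∣; ⊆-antisym; ∈⊤; x∈p∩q⁻) renaming (_∈?_ to _∈ˢ?_)
import Data.Integer as ℤ
open import Data.Integer using (ℤ)
import Data.Integer.Properties as ℤ
import Data.Integer.Solver as ℤSolver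
open import Data.List using (List; []; _∷_; _++_; reverse; tabulate; _∷ʳ_; map; filter; length; allFin; lookup; cartesianProduct)
import Data.List.Membership.DecPropositional as DecMembership
open import Data.List.Membership.Propositional using (_∈_; _∉_; lose; find)
open import Data.List.Membership.Propositional.Properties using (∈-++⁺ˡ; ∈-++⁺ʳ; ∈-++⁻; ∈-map⁺; ∈-map⁻; ∈-tabulate⁺; ∈-tabulate⁻; ∈-filter⁺; ∈-filter⁻; ∈-length; ∈-allFin; ∈-∃++; ∈-lookup; ∈-cartesianProduct⁺)
open import Data.List.Properties using (unfold-reverse; ∷-injective; ++-assoc; filter-all; length-tabulate; length-++; length-map; length-reverse)
open import Data.List.Relation.Unary.All as All using (All; []; _∷_)
open import Data.List.Relation.Unary.All.Properties using (++⁺)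
open import Data.List.Relation.Unary.AllPairs using ([]; _∷_; AllPairs)
open import Data.List.Relation.Unary.Any as Any using (Any; here; there)
import Data.List.Relation.Unary.Any.Properties as Any
open import Data.List.Relation.Unary.Unique.Propositional using (Unique)
open import Data.List.Relation.Unary.Unique.Propositional.Properties using (allFin⁺; cartesianProduct⁺) renaming (filter⁺ to unique-filter⁺; map⁺ to unique-map⁺)
open import Data.Nat using (ℕ; zero; suc; _≤_; z≤n; s≤s; _+_; _<_; _≤?_; _<?_)
open import Data.Nat.Combinatorics as Combinatorics using (nC1≡n; nCk+nC[k+1]≡[n+1]C[k+1]; k>n⇒nCk≡0; nCk≡nC[n∸k]; nCn≡1)
open import Data.Nat.Induction using (<-wellFounded; Acc; acc)
import Data.Nat.Solver as ℕSolver
open import Data.Product using (Σ; ∃-syntax; _×_; _,_; proj₁; proj₂)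
open import Data.Sum using (_⊎_; inj₁; inj₂; [_,_]′)
import Data.Vec as Vec
open import Data.Vec.Properties using (lookup⇒[]=; []=⇒lookup; lookup∘tabulate)
open import Data.Vec.Properties.WithK using ([]=-irrelevant)
open import Function using (_∘_; id)
open import Function.Bundles using (mk⇔; Equivalence; _⇔_)
open import Level using (0ℓ)
open import Relation.Binary.Construct.Closure.ReflexiveTransitive as Star using (Star; ε; _◅_; _◅◅_)
open import Relation.Binary.Definitions using (DecidableEquality; tri<; tri≈; tri>)
open import Relation.Binary.PropositionalEquality using (_≡_; _≢_; refl; sym; trans; cong; subst; subst₂; cong₂)
open import Relation.Nullary using (¬_; yes; no; Dec; does)
open import Relation.Nullary.Decidable using (dec-true; map′; _×-dec_; ¬?; _⊎-dec_; decidable-stable)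
open import Relation.Unary using (Pred; Decidable)

-- The numbers C(d-1, i) are alternating sums: one vertex, d edges, C(d, 2) cycles and C(d, 3)
-- solids through v enter the characteristics with alternating signs. In ℶ³ cycles count negatively,
-- so a vertex with many cycles through it is a threat; estimating cycles and solids separately
-- would fail, and surplus cycles have to be charged to solids of their own. Colour number k + 2 is
-- spent only on a vertex with d - 1 ≥ k, so the gains C(0, i), ..., C(k-1, i) add up to C(k, i+1);
-- and C(k, 2) - 1, C(k, 3) + 1, C(k, 4) - 1 are exactly the characteristics of Kᵏ⁺¹. Since C(t-1,
-- 4) vanishes for t ≤ 4, ℶ³ does not distinguish K¹, ..., K⁴, which is why small Hadwiger numbers
-- are treated by degrees. That method ends there: the octahedron has minimum degree 4 but, being
-- planar, no minor K⁵.

private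
  variable
    n : ℕ
    A : Set

-- Induced paths as lists of vertices

pattern here₁ e = there (here e)
pattern here₂ e = there (here₁ e)
pattern here₃ e = there (here₂ e)

-- Each vertex excludes chords to later vertices only; symmetry of adjacency does the rest. With the
-- vertex list as an index, staying in a region and being disjoint become plain membership
-- conditions.
data Chordless (G : Graph A) : A → A → List A → Set where
  single : ∀ x → Chordless G x x (x ∷ [])
  cons   : ∀ {x y z l} → Graph._~_ G x y → x ∉ l →
         (∀ {w} → w ∈ l → Graph._~_ G x w → w ≡ y) →
         Chordless G y z l → Chordless G x z (x ∷ l)

module _ {G : Graph A} where
  open Graph G

  first∈ : ∀ {x y l} → Chordless G x y l → x ∈ l
  first∈ (single _)          = here refl
  first∈ (cons _ _ _ _) = here refl

  last∈ : ∀ {x y l} → Chordless G x y l → y ∈ l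
  last∈ (single _)          = here refl
  last∈ (cons _ _ _ p) = there (last∈ p)

  ~⇒≢ : ∀ {x y} → x ~ y → x ≢ y
  ~⇒≢ x~y refl = ~-irrefl refl x~y

  snoc : ∀ {x y z l} → Chordless G x y l → y ~ z → z ∉ l →
         (∀ {w} → w ∈ l → w ~ z → w ≡ y) → Chordless G x z (l ∷ʳ z)
  snoc (single x) x~z z∉ only = cons x~z (λ { (here refl) → z∉ (here refl) }) (λ { (here e) _ → e }) (single _)
  snoc {z = z} (cons {x} {y} {l = l} x~y x∉ onlyx p) y~z z∉ only =
    cons x~y x∉′ only′ (snoc p y~z (z∉ ∘ there) (only ∘ there))
    where
    x∉′ : x ∉ l ∷ʳ z
    x∉′ x∈ with ∈-++⁻ l x∈
    ... | inj₁ x∈l         = x∉ x∈l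
    ... | inj₂ (here refl) = z∉ (here refl)
    only′ : ∀ {w} → w ∈ l ∷ʳ z → x ~ w → w ≡ y
    only′ w∈ x~w with ∈-++⁻ l w∈
    ... | inj₁ w∈l         = onlyx w∈l x~w
    ... | inj₂ (here refl) = ⊥-elim (x∉ (subst (_∈ l) (sym (only (here refl) x~w)) (last∈ p)))

  rev : ∀ {x y l} → Chordless G x y l → Chordless G y x (reverse l)
  rev (single x) = (single x)
  rev {y = z} (cons {x} {y} {l = l} x~y x∉ only p) =
    subst (Chordless G z x) (sym (unfold-reverse x l))
      (snoc (rev p) (~-sym x~y) (x∉ ∘ Any.reverse⁻) (λ w∈ w~x → only (Any.reverse⁻ w∈) (~-sym w~x)))

  -- Predecessor and successor on the path; they provide the minimum degree of the solids built from
  -- induced paths.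
  inner-nbrs : ∀ {x y l z} → Chordless G x y l → z ∈ l → z ≢ x → z ≢ y →
               ∃[ p ] ∃[ q ] p ≢ q × p ∈ l × q ∈ l × z ~ p × z ~ q
  inner-nbrs (single _) (here refl) z≢x _ = ⊥-elim (z≢x refl)
  inner-nbrs (cons _ _ _ _) (here refl) z≢x _ = ⊥-elim (z≢x refl)
  inner-nbrs (cons x~y _ _ (single _)) (here₁ refl) _ z≢y = ⊥-elim (z≢y refl)
  inner-nbrs (cons x~y x∉ _ (cons y~y′ _ _ p)) (here₁ refl) _ _ =
    _ , _ , (λ { refl → x∉ (there (first∈ p)) }) , here refl , there (there (first∈ p)) , ~-sym x~y , y~y′
  inner-nbrs (cons x~y x∉ _ p@(cons _ y∉ _ _)) (there z∈@(there z∈′)) _ z≢y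
    with inner-nbrs p z∈ (λ { refl → y∉ z∈′ }) z≢y
  ... | p′ , q , p≢q , p∈ , q∈ , z~p , z~q = p′ , q , p≢q , there p∈ , there q∈ , z~p , z~q

  second : ∀ {x y l} → Chordless G x y l → x ≢ y →
           ∃[ z ] z ∈ l × x ~ z
  second (single _) x≢y = ⊥-elim (x≢y refl)
  second (cons x~y _ _ p) _ = _ , there (first∈ p) , x~y

  nil : ∀ x → Path G x x
  nil x = record
    { len = 0 ; at = λ _ → x ; injective = λ { {zero} {zero} _ → refl }
    ; step = λ () ; start = refl ; end = refl }

  infixr 5 _◂_[_]
  _◂_[_] : ∀ {x y z} → x ~ y → (P : Path G y z) → ¬ vertex ⟦ P ⟧ᵖ x → Path G x z
  _◂_[_] {x} x~y P x∉P = record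
    { len = suc (Path.len P) ; at = at′ ; injective = λ {i} {j} → inj i j
    ; step = step′ ; start = refl ; end = Path.end P }
    where
    at′ : Fin (suc (suc (Path.len P))) → A
    at′ zero    = x
    at′ (suc i) = Path.at P i
    inj : ∀ i j → at′ i ≡ at′ j → i ≡ j
    inj zero zero e = refl
    inj zero (suc j) e = ⊥-elim (x∉P (j , sym e))
    inj (suc i) zero e = ⊥-elim (x∉P (i , e))
    inj (suc i) (suc j) e = cong suc (Path.injective P e)
    step′ : ∀ i → at′ (inject₁ i) ~ at′ (suc i)
    step′ zero = subst (x ~_) (sym (Path.start P)) x~y
    step′ (suc i) = Path.step P i

  path  : ∀ {x y l} → Chordless G x y l → Path G x y
  path⁻ : ∀ {x y l} (p : Chordless G x y l) {v} → vertex ⟦ path p ⟧ᵖ v → v ∈ l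

  path (single x)               = nil x
  path (cons x~y x∉ _ p) = x~y ◂ path p [ x∉ ∘ path⁻ p ]

  path⁻ (single x) (zero , refl) = here refl
  path⁻ (cons _ _ _ p) (zero , refl) = here refl
  path⁻ (cons _ _ _ p) (suc i , e) = there (path⁻ p (i , e))

  path⁺ : ∀ {x y l} (p : Chordless G x y l) {v} → v ∈ l → vertex ⟦ path p ⟧ᵖ v
  path⁺ (single x) (here refl) = zero , refl
  path⁺ (cons _ _ _ p) (here refl) = zero , refl
  path⁺ (cons _ _ _ p) (there v∈) with path⁺ p v∈
  ... | i , e = suc i , e

  path-edge : ∀ {x y l} (p : Chordless G x y l) {u v} → u ∈ l → v ∈ l → u ~ v →
              edge ⟦ path p ⟧ᵖ u v
  path-edge (single x) (here refl) (here refl) u~v = ⊥-elim (~-irrefl refl u~v)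
  path-edge (cons _ _ _ p) (here refl) (here refl) u~v = ⊥-elim (~-irrefl refl u~v)
  path-edge (cons _ _ only p) (here refl) (there v∈) u~v with only v∈ u~v
  ... | refl = zero , inj₁ (refl , Path.start (path p))
  path-edge (cons _ _ only p) (there u∈) (here refl) u~v with only u∈ (~-sym u~v)
  ... | refl = zero , inj₂ (refl , Path.start (path p))
  path-edge (cons _ _ _ p) (there u∈) (there v∈) u~v with path-edge p u∈ v∈ u~v
  ... | i , e = suc i , e

  edge⇒~ : ∀ {x y} (P : Path G x y) {u v} → edge ⟦ P ⟧ᵖ u v → u ~ v
  edge⇒~ P (i , inj₁ (refl , refl)) = Path.step P i
  edge⇒~ P (i , inj₂ (refl , refl)) = ~-sym (Path.step P i)

  1≤len : ∀ {x y} (P : Path G x y) → x ≢ y → 1 ≤ len P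
  1≤len record { len = zero ; start = s ; end = e } x≢y = ⊥-elim (x≢y (trans (sym s) e))
  1≤len record { len = suc _ } _ = s≤s z≤n

  2≤len : ∀ {x y} (P : Path G x y) → x ≢ y → ¬ x ~ y → 2 ≤ len P
  2≤len record { len = zero ; start = s ; end = e } x≢y _ = ⊥-elim (x≢y (trans (sym s) e))
  2≤len record { len = suc zero ; step = st ; start = s ; end = e } _ x≁y =
    ⊥-elim (x≁y (subst₂ _~_ s e (st zero)))
  2≤len record { len = suc (suc _) } _ _ = s≤s (s≤s z≤n)

-- An induced cycle opened at its vertex v: the other vertices are those of an
-- induced path from a to b.
record Hole (G : Graph A) (v a b : A) (l : List A) : Set where
  open Graph G
  field
    rim  : Chordless G a b l
    v∉   : v ∉ l
    v~a  : v ~ a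
    v~b  : v ~ b
    a≢b  : a ≢ b
    only : ∀ {z} → z ∈ l → v ~ z → z ≡ a ⊎ z ≡ b

-- Recognition of cycles and solids

triple : {A : Set} → A → A → A → Fin 3 → A
triple x y z 0F = x
triple x y z 1F = y
triple x y z 2F = z

distinct-pairs : (R : Fin 3 → Fin 3 → Set) → (∀ {i j} → R i j → R j i) →
         R 0F 1F → R 0F 2F → R 1F 2F → ∀ {i j} → i ≢ j → R i j
distinct-pairs R s p q r {0F} {0F} n = ⊥-elim (n refl)
distinct-pairs R s p q r {0F} {1F} n = p
distinct-pairs R s p q r {0F} {2F} n = q
distinct-pairs R s p q r {1F} {0F} n = s p
distinct-pairs R s p q r {1F} {1F} n = ⊥-elim (n refl)
distinct-pairs R s p q r {1F} {2F} n = r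
distinct-pairs R s p q r {2F} {0F} n = s q
distinct-pairs R s p q r {2F} {1F} n = s r
distinct-pairs R s p q r {2F} {2F} n = ⊥-elim (n refl)

≢-triple : {A : Set} {x y z : A} → x ≢ y → x ≢ z → y ≢ z →
           ∀ {i j} → triple x y z i ≡ triple x y z j → i ≡ j
≢-triple p q r {0F} {0F} e = refl
≢-triple p q r {0F} {1F} e = ⊥-elim (p e)
≢-triple p q r {0F} {2F} e = ⊥-elim (q e)
≢-triple p q r {1F} {0F} e = ⊥-elim (p (sym e))
≢-triple p q r {1F} {1F} e = refl
≢-triple p q r {1F} {2F} e = ⊥-elim (r e)
≢-triple p q r {2F} {0F} e = ⊥-elim (q (sym e))
≢-triple p q r {2F} {1F} e = ⊥-elim (r (sym e))
≢-triple p q r {2F} {2F} e = refl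

module _ {G : Graph A} where
  open Graph G

  cycle : ∀ {v a b l} → Hole G v a b l → Cycle G
  cycle {v} {a} {b} h = record
    { path  = v~a ◂ path rim [ v∉ ∘ path⁻ rim ]
    ; 2≤len = s≤s (1≤len (path rim) a≢b)
    ; close = ~-sym v~b }
    where open Hole h

  cycle⁻ : ∀ {v a b l} (h : Hole G v a b l) {z} → vertex ⟦ cycle h ⟧ᶜ z → z ∈ v ∷ l
  cycle⁻ h (zero , refl) = here refl
  cycle⁻ h (suc i , e)   = there (path⁻ (Hole.rim h) (i , e))

  cycle⁺ : ∀ {v a b l} (h : Hole G v a b l) {z} → z ∈ v ∷ l → vertex ⟦ cycle h ⟧ᶜ z
  cycle⁺ h (here refl) = zero , refl
  cycle⁺ h (there z∈) with path⁺ (Hole.rim h) z∈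
  ... | i , e = suc i , e

  cycle-edge : ∀ {v a b l} (h : Hole G v a b l) {s t} → s ∈ v ∷ l → t ∈ v ∷ l → s ~ t →
               edge ⟦ cycle h ⟧ᶜ s t
  cycle-edge h (here refl) (here refl) s~t = ⊥-elim (~-irrefl refl s~t)
  cycle-edge h (here refl) (there t∈) s~t with Hole.only h t∈ s~t
  ... | inj₁ refl = inj₁ (zero , inj₁ (refl , Path.start (path (Hole.rim h))))
  ... | inj₂ refl = inj₂ (inj₁ (refl , refl))
  cycle-edge h (there s∈) (here refl) s~t with Hole.only h s∈ (~-sym s~t)
  ... | inj₁ refl = inj₁ (zero , inj₂ (refl , Path.start (path (Hole.rim h))))
  ... | inj₂ refl = inj₂ (inj₂ (refl , refl))
  cycle-edge h (there s∈) (there t∈) s~t with path-edge (Hole.rim h) s∈ t∈ s~t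
  ... | i , e = inj₁ (suc i , e)

  cycle-edge⇒~ : (C : Cycle G) → ∀ {s t} → edge ⟦ C ⟧ᶜ s t → s ~ t
  cycle-edge⇒~ C (inj₁ e) = edge⇒~ (Cycle.path C) e
  cycle-edge⇒~ C (inj₂ (inj₁ (refl , refl))) = ~-sym (Cycle.close C)
  cycle-edge⇒~ C (inj₂ (inj₂ (refl , refl))) = Cycle.close C

  isCycle : ∀ {v a b l} → Hole G v a b l → (∀ z → z ∈ v ∷ l) → IsCycle G
  isCycle h all = cycle h , cycle⁺ h ∘ all ,
    λ s t → mk⇔ (cycle-edge h (all s) (all t)) (cycle-edge⇒~ (cycle h))

  isPyramid : ∀ {v a b l w} → Hole G v a b l → w ∉ v ∷ l → (∀ z → z ≡ w ⊎ z ∈ v ∷ l) →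
              (f : Fin 3 → A) → (∀ {i j} → f i ≡ f j → i ≡ j) →
              (∀ i → f i ∈ v ∷ l) → (∀ i → w ~ f i) → IsPyramid G
  isPyramid {v} {l = l} {w} h w∉ all f f-inj f∈ w~f = record
    { C = cycle h ; w = w ; w∉C = w∉ ∘ cycle⁻ h ; foot = f ; foot-inj = f-inj
    ; foot∈C = cycle⁺ h ∘ f∈ ; w~foot = w~f
    ; union = (λ z → vert (all z)) , λ s t → mk⇔ (edge′ (all s) (all t)) edge⁻ }
    where
    vert : ∀ {z} → z ≡ w ⊎ z ∈ v ∷ l → vertex (⟦ cycle h ⟧ᶜ ∪ spokes w (cycle h)) z
    vert (inj₁ e)  = inj₂ e
    vert (inj₂ z∈) = inj₁ (cycle⁺ h z∈)
    edge′ : ∀ {s t} → s ≡ w ⊎ s ∈ v ∷ l → t ≡ w ⊎ t ∈ v ∷ l → s ~ t →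
            edge (⟦ cycle h ⟧ᶜ ∪ spokes w (cycle h)) s t
    edge′ (inj₁ refl) (inj₁ refl) s~t = ⊥-elim (~-irrefl refl s~t)
    edge′ (inj₁ refl) (inj₂ t∈) s~t = inj₂ (s~t , inj₁ (refl , cycle⁺ h t∈))
    edge′ (inj₂ s∈) (inj₁ refl) s~t = inj₂ (s~t , inj₂ (refl , cycle⁺ h s∈))
    edge′ (inj₂ s∈) (inj₂ t∈) s~t = inj₁ (cycle-edge h s∈ t∈ s~t)
    edge⁻ : ∀ {s t} → edge (⟦ cycle h ⟧ᶜ ∪ spokes w (cycle h)) s t → s ~ t
    edge⁻ (inj₁ e) = cycle-edge⇒~ (cycle h) e
    edge⁻ (inj₂ (s~t , _)) = s~t

  -- By `far`, an edge between two different paths has an end in `x` or `y` and therefore lies on a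
  -- single path, so the paths account for all edges. Nonadjacency of `x` and `y` gives every path
  -- an inner vertex.
  isTrihedron : ∀ {x y} → x ≢ y → ¬ x ~ y → (l : Fin 3 → List A) → (∀ i → Chordless G x y (l i)) →
                (∀ {i j} → i ≢ j → ∀ {s t} → s ∈ l i → t ∈ l j → s ≢ x → s ≢ y → t ≢ x → t ≢ y →
                   s ≢ t × ¬ s ~ t) →
                (∀ z → ∃[ i ] z ∈ l i) → DecidableEquality A → IsTrihedron G
  isTrihedron {x} {y} x≢y x≁y l p far all _≟_ = record
    { x≢y = x≢y ; P = P ; 2≤len = λ i → 2≤len (P i) x≢y x≁y
    ; interior = λ i≢j v∈i v≢x v≢y v∈j →
        proj₁ (far i≢j (path⁻ (p _) v∈i) (path⁻ (p _) v∈j) v≢x v≢y v≢x v≢y) refl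
    ; union = (λ z → proj₁ (all z) , path⁺ (p _) (proj₂ (all z)))
            , λ s t → mk⇔ (edge′ (all s) (all t)) λ { (i , e) → edge⇒~ (P i) e } }
    where
    P : ∀ i → Path G x y
    P i = path (p i)
    on-path : ∀ {s t} i → s ∈ l i → t ∈ l i → s ~ t → edge (⋃ (λ i → ⟦ P i ⟧ᵖ)) s t
    on-path i s∈ t∈ s~t = i , path-edge (p i) s∈ t∈ s~t
    edge′ : ∀ {s t} → ∃[ i ] s ∈ l i → ∃[ i ] t ∈ l i → s ~ t → edge (⋃ (λ i → ⟦ P i ⟧ᵖ)) s t
    edge′ {s} {t} (i , s∈) (j , t∈) s~t with i Fin.≟ j
    ... | yes refl = on-path i s∈ t∈ s~t
    ... | no i≢j with s ≟ x | s ≟ y | t ≟ x | t ≟ y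
    ...   | yes refl | _ | _ | _ = on-path j (first∈ (p j)) t∈ s~t
    ...   | _ | yes refl | _ | _ = on-path j (last∈ (p j)) t∈ s~t
    ...   | _ | _ | yes refl | _ = on-path i s∈ (first∈ (p i)) s~t
    ...   | _ | _ | _ | yes refl = on-path i s∈ (last∈ (p i)) s~t
    ...   | no a | no b | no c | no d = ⊥-elim (proj₂ (far i≢j s∈ t∈ a b c d) s~t)

  -- The paths run from the apex to the triangle, opposite to those of IsStamp.
  isStamp : ∀ {x} (t : Fin 3 → A) → (∀ {i j} → i ≢ j → t i ~ t j) →
            (l : Fin 3 → List A) → (∀ i → Chordless G x (t i) (l i)) → (∀ i → x ≢ t i) →
            (∀ {i j} → i ≢ j → ∀ {u v} → u ∈ l i → v ∈ l j → u ≢ x → v ≢ x →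
               u ≢ v × (u ~ v → u ≡ t i × v ≡ t j)) →
            (∀ z → ∃[ i ] z ∈ l i) → DecidableEquality A → IsStamp G
  isStamp {x} t adj l p x≢t far all _≟_ = record
    { T = T ; x = x ; x∉T = λ { (i , e) → x≢t i (sym e) } ; P = P
    ; 1≤len = λ i → 1≤len (P i) (x≢t i ∘ sym)
    ; disjoint = disj
    ; P∩T = λ { i v∈ (j , refl) → P∩T i j v∈ }
    ; union = (λ z → inj₂ (proj₁ (all z) , path⁺ (q _) (Any.reverse⁺ (proj₂ (all z)))))
            , λ u v → mk⇔ (edge′ (all u) (all v)) edge⁻ }
    where
    T : Triangle G
    T = record { corner = t ; adjacent = adj }
    q : ∀ i → Chordless G (t i) x (reverse (l i))
    q i = rev (p i)
    P : ∀ i → Path G (t i) x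
    P i = path (q i)
    disj : ∀ {i j} → i ≢ j → ∀ {v} → vertex ⟦ P i ⟧ᵖ v → vertex ⟦ P j ⟧ᵖ v → v ≡ x
    disj i≢j {v} v∈i v∈j with v ≟ x
    ... | yes e = e
    ... | no v≢x = ⊥-elim (proj₁ (far i≢j (Any.reverse⁻ (path⁻ (q _) v∈i))
                                            (Any.reverse⁻ (path⁻ (q _) v∈j)) v≢x v≢x) refl)
    P∩T : ∀ i j → vertex ⟦ P i ⟧ᵖ (t j) → t j ≡ t i
    P∩T i j v∈ with i Fin.≟ j
    ... | yes refl = refl
    ... | no i≢j = ⊥-elim (x≢t j (sym (disj i≢j v∈ (path⁺ (q j) (first∈ (q j))))))
    X = ⟦ T ⟧ᵗ ∪ ⋃ (λ i → ⟦ P i ⟧ᵖ)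
    on-path : ∀ {u v} i → u ∈ l i → v ∈ l i → u ~ v → edge X u v
    on-path i u∈ v∈ u~v = inj₂ (i , path-edge (q i) (Any.reverse⁺ u∈) (Any.reverse⁺ v∈) u~v)
    edge′ : ∀ {u v} → ∃[ i ] u ∈ l i → ∃[ i ] v ∈ l i → u ~ v → edge X u v
    edge′ {u} {v} (i , u∈) (j , v∈) u~v with i Fin.≟ j
    ... | yes refl = on-path i u∈ v∈ u~v
    ... | no i≢j with u ≟ x | v ≟ x
    ...   | yes refl | _ = on-path j (first∈ (p j)) v∈ u~v
    ...   | _ | yes refl = on-path i u∈ (first∈ (p i)) u~v
    ...   | no a | no b with proj₂ (far i≢j u∈ v∈ a b) u~v
    ...     | refl , refl = inj₁ (i , j , i≢j , refl , refl)
    edge⁻ : ∀ {u v} → edge X u v → u ~ v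
    edge⁻ (inj₁ (i , j , i≢j , refl , refl)) = adj i≢j
    edge⁻ (inj₂ (i , e)) = edge⇒~ (P i) e

  isPrism : (s t : Fin 3 → A) → (∀ {i j} → i ≢ j → s i ~ s j) → (∀ {i j} → i ≢ j → t i ~ t j) →
            (l : Fin 3 → List A) → (∀ i → Chordless G (s i) (t i) (l i)) → (∀ i → s i ≢ t i) →
            (∀ {i j} → i ≢ j → ∀ {u v} → u ∈ l i → v ∈ l j →
               u ≢ v × (u ~ v → (u ≡ s i × v ≡ s j) ⊎ (u ≡ t i × v ≡ t j))) →
            (∀ z → ∃[ i ] z ∈ l i) → IsPrism G
  isPrism s t adjs adjt l p s≢t far all = record
    { T = T ; T′ = T′ ; T∩T′ = λ { (i , refl) (j , e) → s≢t′ i j (sym e) } ; P = P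
    ; disjoint = disj
    ; P∩T∪T′ = λ { i v∈ (inj₁ (j , refl)) → P∩T i j v∈ ; i v∈ (inj₂ (j , refl)) → P∩T′ i j v∈ }
    ; union = (λ z → inj₂ (inj₂ (proj₁ (all z) , path⁺ (p _) (proj₂ (all z)))))
            , λ u v → mk⇔ (edge′ (all u) (all v)) edge⁻ }
    where
    T T′ : Triangle G
    T  = record { corner = s ; adjacent = adjs }
    T′ = record { corner = t ; adjacent = adjt }
    P : ∀ i → Path G (s i) (t i)
    P i = path (p i)
    s≢t′ : ∀ i j → s i ≢ t j
    s≢t′ i j with i Fin.≟ j
    ... | yes refl = s≢t i
    ... | no i≢j = proj₁ (far i≢j (first∈ (p i)) (last∈ (p j)))
    disj : ∀ {i j} → i ≢ j → ∀ {v} → vertex ⟦ P i ⟧ᵖ v → ¬ vertex ⟦ P j ⟧ᵖ v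
    disj i≢j v∈i v∈j = proj₁ (far i≢j (path⁻ (p _) v∈i) (path⁻ (p _) v∈j)) refl
    P∩T : ∀ i j → vertex ⟦ P i ⟧ᵖ (s j) → s j ≡ s i ⊎ s j ≡ t i
    P∩T i j v∈ with i Fin.≟ j
    ... | yes refl = inj₁ refl
    ... | no i≢j = ⊥-elim (disj i≢j v∈ (path⁺ (p j) (first∈ (p j))))
    P∩T′ : ∀ i j → vertex ⟦ P i ⟧ᵖ (t j) → t j ≡ s i ⊎ t j ≡ t i
    P∩T′ i j v∈ with i Fin.≟ j
    ... | yes refl = inj₂ refl
    ... | no i≢j = ⊥-elim (disj i≢j v∈ (path⁺ (p j) (last∈ (p j))))
    X = ⟦ T ⟧ᵗ ∪ ⟦ T′ ⟧ᵗ ∪ ⋃ (λ i → ⟦ P i ⟧ᵖ)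
    edge′ : ∀ {u v} → ∃[ i ] u ∈ l i → ∃[ i ] v ∈ l i → u ~ v → edge X u v
    edge′ (i , u∈) (j , v∈) u~v with i Fin.≟ j
    ... | yes refl = inj₂ (inj₂ (i , path-edge (p i) u∈ v∈ u~v))
    ... | no i≢j with proj₂ (far i≢j u∈ v∈) u~v
    ...   | inj₁ (refl , refl) = inj₁ (i , j , i≢j , refl , refl)
    ...   | inj₂ (refl , refl) = inj₂ (inj₁ (i , j , i≢j , refl , refl))
    edge⁻ : ∀ {u v} → edge X u v → u ~ v
    edge⁻ (inj₁ (i , j , i≢j , refl , refl)) = adjs i≢j
    edge⁻ (inj₂ (inj₁ (i , j , i≢j , refl , refl))) = adjt i≢j
    edge⁻ (inj₂ (inj₂ (i , e))) = edge⇒~ (P i) e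

-- Solids spanned by induced paths

module _ {P : Pred (Fin n) 0ℓ} (P? : Decidable P) where

  sub : Subset n
  sub = Vec.tabulate (λ x → does (P? x))

  ∈-sub⁺ : ∀ {x} → P x → x ∈ˢ sub
  ∈-sub⁺ {x} px = lookup⇒[]= x sub (trans (lookup∘tabulate _ x) (dec-true (P? x) px))

  ∈-sub⁻ : ∀ {x} → x ∈ˢ sub → P x
  ∈-sub⁻ {x} x∈ = witness (P? x) (trans (sym (lookup∘tabulate _ x)) ([]=⇒lookup x∈))
    where
    witness : ∀ {A : Set} (a? : Dec A) → does a? ≡ inside → A
    witness (yes a) _ = a
    witness (no _) ()

open module ListMembership {n} = DecMembership (Fin._≟_ {n}) using (_∈?_)

abstract
  set : List (Fin n) → Subset n
  set l = sub (_∈? l)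

  ∈-set⁺ : ∀ {l : List (Fin n)} {x} → x ∈ l → x ∈ˢ set l
  ∈-set⁺ {l = l} = ∈-sub⁺ (_∈? l)

  ∈-set⁻ : ∀ {l : List (Fin n)} {x} → x ∈ˢ set l → x ∈ l
  ∈-set⁻ {l = l} = ∈-sub⁻ (_∈? l)

module _ (G : Graph (Fin n)) where
  open Graph G

  module _ {S : Subset n} where

    private
      Vertex : Set
      Vertex = ∃[ v ] v ∈ˢ S

    vertex-≡ : {u v : Vertex} → proj₁ u ≡ proj₁ v → u ≡ v
    vertex-≡ {u , p} {_ , q} refl = cong (u ,_) ([]=-irrelevant p q)

    _≟ᵛ_ : DecidableEquality Vertex
    u ≟ᵛ v = map′ vertex-≡ (cong proj₁) (proj₁ u Fin.≟ proj₁ v)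

    lift : (l : List (Fin n)) → (∀ {z} → z ∈ l → z ∈ˢ S) → List Vertex
    lift []      _ = []
    lift (x ∷ l) f = (x , f (here refl)) ∷ lift l (f ∘ there)

    lift⁻ : ∀ l (f : ∀ {z} → z ∈ l → z ∈ˢ S) {z} → z ∈ lift l f → proj₁ z ∈ l
    lift⁻ (x ∷ l) f (here refl) = here refl
    lift⁻ (x ∷ l) f (there z∈) = there (lift⁻ l (f ∘ there) z∈)

    lift⁺ : ∀ l (f : ∀ {z} → z ∈ l → z ∈ˢ S) {z} → proj₁ z ∈ l → z ∈ lift l f
    lift⁺ (x ∷ l) f (here e) = here (vertex-≡ e)
    lift⁺ (x ∷ l) f (there z∈) = there (lift⁺ l (f ∘ there) z∈)

    lift-chordless : ∀ {x y l} (f : ∀ {z} → z ∈ l → z ∈ˢ S) {p q} → Chordless G x y l →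
                     Chordless (G [ S ]) (x , p) (y , q) (lift l f)
    lift-chordless {x} f {p} {q} (single x) with []=-irrelevant p (f (here refl)) | []=-irrelevant q (f (here refl))
    ... | refl | refl = single _
    lift-chordless f {p} {q} (cons x~y x∉ only c) with []=-irrelevant p (f (here refl))
    ... | refl = cons {y = _ , f (there (first∈ c))} x~y (x∉ ∘ lift⁻ _ _)
                   (λ w∈ x~w → vertex-≡ (only (lift⁻ _ _ w∈) x~w))
                   (lift-chordless (f ∘ there) c)

    lift-hole : ∀ {v a b l} (f : ∀ {z} → z ∈ v ∷ l → z ∈ˢ S) (h : Hole G v a b l) →
                Hole (G [ S ]) (v , f (here refl)) (a , f (there (first∈ (Hole.rim h))))
                     (b , f (there (last∈ (Hole.rim h)))) (lift l (f ∘ there))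
    lift-hole f h = record
      { rim = lift-chordless (f ∘ there) (Hole.rim h) ; v∉ = Hole.v∉ h ∘ lift⁻ _ _
      ; v~a = Hole.v~a h ; v~b = Hole.v~b h ; a≢b = Hole.a≢b h ∘ cong proj₁
      ; only = λ z∈ v~z → Data.Sum.map vertex-≡ vertex-≡ (Hole.only h (lift⁻ _ _ z∈) v~z) }

  -- Recorded with every solid, since a set of minimum degree two that enters a path without side
  -- exits must traverse it; `follow` uses this to show that a solid contains a prescribed path.
  Deg≥2 : Pred (Fin n) 0ℓ → Set
  Deg≥2 P = ∀ {z} → P z → ∃[ p ] ∃[ q ] p ≢ q × P p × P q × z ~ p × z ~ q

  record SolidOn (l : List (Fin n)) : Set where
    field
      solid : Solid G (set l)
      deg≥2 : Deg≥2 (_∈ l)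

  hole-deg≥2 : ∀ {v a b l} → Hole G v a b l → Deg≥2 (_∈ v ∷ l)
  hole-deg≥2 {v} {a} {b} h {z} z∈ = go z∈
    where
    open Hole h
    go : z ∈ v ∷ _ → ∃[ p ] ∃[ q ] p ≢ q × p ∈ v ∷ _ × q ∈ v ∷ _ × z ~ p × z ~ q
    go (here refl) = _ , _ , a≢b , there (first∈ rim) , there (last∈ rim) , v~a , v~b
    go (there z∈) with z Fin.≟ a | z Fin.≟ b
    ... | yes refl | _ with second rim a≢b
    ...   | q , q∈ , a~q = v , q , (λ { refl → v∉ q∈ }) , here refl , there q∈ , ~-sym v~a , a~q
    go (there z∈) | _ | yes refl with second (rev rim) (a≢b ∘ sym)
    ...   | q , q∈ , b~q = v , q , (λ { refl → v∉ (Any.reverse⁻ q∈) }) , here refl , there (Any.reverse⁻ q∈)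
                         , ~-sym v~b , b~q
    go (there z∈) | no z≢a | no z≢b with inner-nbrs rim z∈ z≢a z≢b
    ... | p , q , p≢q , p∈ , q∈ , e , e′ = p , q , p≢q , there p∈ , there q∈ , e , e′

  holeCycle : ∀ {v a b l} → Hole G v a b l → InducedCycle G (set (v ∷ l))
  holeCycle {v} {l = l} h = isCycle (lift-hole in-S h) all
    where
    in-S : ∀ {z} → z ∈ v ∷ l → z ∈ˢ set (v ∷ l)
    in-S = ∈-set⁺
    all : ∀ z → z ∈ _
    all (z , z∈) with ∈-set⁻ {l = v ∷ l} z∈
    ... | here e = here (vertex-≡ e)
    ... | there z∈l = there (lift⁺ l (in-S ∘ there) z∈l)

  pyramid : ∀ {v a b l w x y z} → Hole G v a b l → w ∉ v ∷ l →
            x ∈ v ∷ l → y ∈ v ∷ l → z ∈ v ∷ l → x ≢ y → x ≢ z → y ≢ z →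
            w ~ x → w ~ y → w ~ z → SolidOn (w ∷ v ∷ l)
  pyramid {v} {l = l} {w} {x} {y} {z} h w∉ x∈ y∈ z∈ x≢y x≢z y≢z w~x w~y w~z = record
    { solid = inj₁ (isPyramid (lift-hole in-S h) w∉′ all foot foot-inj foot∈ w~foot)
    ; deg≥2 = deg }
    where
    S = set (w ∷ v ∷ l)
    in-S : ∀ {z} → z ∈ v ∷ l → z ∈ˢ S
    in-S = ∈-set⁺ ∘ there
    v∷l′ : List (∃[ u ] u ∈ˢ S)
    v∷l′ = lift (v ∷ l) in-S
    w∉′ : (w , ∈-set⁺ (here refl)) ∉ v∷l′
    w∉′ = w∉ ∘ lift⁻ (v ∷ l) in-S
    all : ∀ u → u ≡ (w , ∈-set⁺ (here refl)) ⊎ u ∈ v∷l′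
    all (u , u∈) with ∈-set⁻ {l = w ∷ v ∷ l} u∈
    ... | here e = inj₁ (vertex-≡ e)
    ... | there u∈′ = inj₂ (lift⁺ (v ∷ l) in-S u∈′)
    foot : Fin 3 → ∃[ u ] u ∈ˢ S
    foot = triple (x , ∈-set⁺ (there x∈)) (y , ∈-set⁺ (there y∈)) (z , ∈-set⁺ (there z∈))
    foot-inj : ∀ {i j} → foot i ≡ foot j → i ≡ j
    foot-inj = ≢-triple (x≢y ∘ cong proj₁) (x≢z ∘ cong proj₁) (y≢z ∘ cong proj₁)
    foot∈ : ∀ i → foot i ∈ v∷l′
    foot∈ 0F = lift⁺ (v ∷ l) in-S x∈
    foot∈ 1F = lift⁺ (v ∷ l) in-S y∈
    foot∈ 2F = lift⁺ (v ∷ l) in-S z∈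
    w~foot : ∀ i → w ~ proj₁ (foot i)
    w~foot 0F = w~x
    w~foot 1F = w~y
    w~foot 2F = w~z
    deg : Deg≥2 (_∈ w ∷ v ∷ l)
    deg (here refl) = x , y , x≢y , there x∈ , there y∈ , w~x , w~y
    deg (there u∈) with hole-deg≥2 h u∈
    ... | p , q , p≢q , p∈ , q∈ , e = p , q , p≢q , there p∈ , there q∈ , e

  module _ {l m k : List (Fin n)} where

    private
      L : List (Fin n)
      L = l ++ m ++ k

      incl : ∀ i {z} → z ∈ triple l m k i → z ∈ L
      incl 0F = ∈-++⁺ˡ
      incl 1F = ∈-++⁺ʳ l ∘ ∈-++⁺ˡ
      incl 2F = ∈-++⁺ʳ l ∘ ∈-++⁺ʳ m

      which : ∀ {z} → z ∈ L → ∃[ i ] z ∈ triple l m k i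
      which z∈ with ∈-++⁻ l z∈
      ... | inj₁ z∈l = 0F , z∈l
      ... | inj₂ z∈′ with ∈-++⁻ m z∈′
      ...   | inj₁ z∈m = 1F , z∈m
      ...   | inj₂ z∈k = 2F , z∈k

      lists : Fin 3 → List (∃[ u ] u ∈ˢ set L)
      lists i = lift (triple l m k i) (∈-set⁺ ∘ incl i)

      lists-all : ∀ z → ∃[ i ] z ∈ lists i
      lists-all (z , z∈) with which (∈-set⁻ {l = L} z∈)
      ... | i , z∈i = i , lift⁺ (triple l m k i) _ z∈i

      inner : ∀ {x y} i → Chordless G x y (triple l m k i) → ∀ {z} → z ∈ triple l m k i → z ≢ x → z ≢ y →
              ∃[ p ] ∃[ q ] p ≢ q × p ∈ L × q ∈ L × z ~ p × z ~ q
      inner i c z∈ z≢x z≢y with inner-nbrs c z∈ z≢x z≢y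
      ... | p , q , p≢q , p∈ , q∈ , e = p , q , p≢q , incl i p∈ , incl i q∈ , e

    module _ {x y : Fin n} where

      private
        Far : Fin 3 → Fin 3 → Set
        Far i j = ∀ {s t} → s ∈ triple l m k i → t ∈ triple l m k j →
                  s ≢ x → s ≢ y → t ≢ x → t ≢ y → s ≢ t × ¬ s ~ t

      trihedron : x ≢ y → ¬ x ~ y → Chordless G x y l → Chordless G x y m → Chordless G x y k →
                  Far 0F 1F → Far 0F 2F → Far 1F 2F → SolidOn L
      trihedron x≢y x≁y p q r far₀₁ far₀₂ far₁₂ = record
        { solid = inj₂ (inj₁ (isTrihedron {x = x , incl∈ (first∈ p)} {y = y , incl∈ (last∈ p)} (x≢y ∘ cong proj₁) x≁y lists
            (λ i → lift-chordless _ (c i))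
            (λ i≢j s∈ t∈ s≢x s≢y t≢x t≢y →
               let s≢t , s≁t = far i≢j (lift⁻ _ _ s∈) (lift⁻ _ _ t∈) (s≢x ∘ vertex-≡) (s≢y ∘ vertex-≡)
                                 (t≢x ∘ vertex-≡) (t≢y ∘ vertex-≡)
               in s≢t ∘ cong proj₁ , s≁t)
            lists-all _≟ᵛ_))
        ; deg≥2 = λ z∈ → deg (which z∈) }
        where
        incl∈ : ∀ {z} → z ∈ l → z ∈ˢ set L
        incl∈ = ∈-set⁺ ∘ incl 0F
        c : ∀ i → Chordless G x y (triple l m k i)
        c 0F = p
        c 1F = q
        c 2F = r
        far : ∀ {i j} → i ≢ j → Far i j
        far = distinct-pairs Far
          (λ f s∈ t∈ a b c d → let s≢t , s≁t = f t∈ s∈ c d a b in s≢t ∘ sym , s≁t ∘ ~-sym)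
          far₀₁ far₀₂ far₁₂
        -- The ends `x` and `y` get two neighbours from the first two paths: the second vertices
        -- there are inner ones, because `x` and `y` are not adjacent, and `far₀₁` separates them.
        ends : ∀ {u w} → u ≢ w → (∀ {s t} → s ∈ l → t ∈ m → s ≢ u → s ≢ w → t ≢ u → t ≢ w → s ≢ t) →
               ¬ u ~ w → ∀ {l′ m′} → (∀ {z} → z ∈ l′ → z ∈ l) → (∀ {z} → z ∈ m′ → z ∈ m) →
               Chordless G u w l′ → Chordless G u w m′ →
               ∃[ p ] ∃[ q ] p ≢ q × p ∈ L × q ∈ L × u ~ p × u ~ q
        ends u≢w f u≁w l⊆ m⊆ p q with second p u≢w | second q u≢w
        ... | s , s∈ , u~s | t , t∈ , u~t =
          s , t , f (l⊆ s∈) (m⊆ t∈) (~⇒≢ {G = G} u~s ∘ sym) (λ { refl → u≁w u~s })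
                                    (~⇒≢ {G = G} u~t ∘ sym) (λ { refl → u≁w u~t })
          , incl 0F (l⊆ s∈) , incl 1F (m⊆ t∈) , u~s , u~t
        deg : ∀ {z} → ∃[ i ] z ∈ triple l m k i → ∃[ p ] ∃[ q ] p ≢ q × p ∈ L × q ∈ L × z ~ p × z ~ q
        deg {z} (i , z∈) with z Fin.≟ x | z Fin.≟ y
        ... | yes refl | _ = ends x≢y (λ s∈ t∈ a b c d → proj₁ (far₀₁ s∈ t∈ a b c d)) x≁y
                               (λ z∈ → z∈) (λ z∈ → z∈) p q
        ... | _ | yes refl = ends (x≢y ∘ sym) (λ s∈ t∈ a b c d → proj₁ (far₀₁ s∈ t∈ b a d c)) (x≁y ∘ ~-sym)
                               Any.reverse⁻ Any.reverse⁻ (rev p) (rev q)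
        ... | no z≢x | no z≢y = inner i (c i) z∈ z≢x z≢y

    module _ {x a b c : Fin n} where

      private
        corners : Fin 3 → Fin n
        corners = triple a b c
        Far : Fin 3 → Fin 3 → Set
        Far i j = ∀ {s t} → s ∈ triple l m k i → t ∈ triple l m k j → s ≢ x → t ≢ x →
                  s ≢ t × (s ~ t → s ≡ corners i × t ≡ corners j)

      stamp : a ~ b → a ~ c → b ~ c → x ≢ a → x ≢ b → x ≢ c →
              Chordless G x a l → Chordless G x b m → Chordless G x c k →
              Far 0F 1F → Far 0F 2F → Far 1F 2F → SolidOn L
      stamp a~b a~c b~c x≢a x≢b x≢c p q r far₀₁ far₀₂ far₁₂ = record
        { solid = inj₂ (inj₂ (inj₁ (isStamp {x = x , ∈-set⁺ (incl 0F (first∈ p))}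
            (λ i → corners i , ∈-set⁺ (incl i (last∈ (ch i))))
            adj lists (λ i → lift-chordless _ (ch i)) (λ i → x≢ i ∘ cong proj₁)
            (λ i≢j s∈ t∈ s≢x t≢x →
               let s≢t , e = far i≢j (lift⁻ _ _ s∈) (lift⁻ _ _ t∈) (s≢x ∘ vertex-≡) (t≢x ∘ vertex-≡)
               in s≢t ∘ cong proj₁ , λ s~t → vertex-≡ (proj₁ (e s~t)) , vertex-≡ (proj₂ (e s~t)))
            lists-all _≟ᵛ_)))
        ; deg≥2 = λ z∈ → deg (which z∈) }
        where
        ch : ∀ i → Chordless G x (corners i) (triple l m k i)
        ch 0F = p
        ch 1F = q
        ch 2F = r
        x≢ : ∀ i → x ≢ corners i
        x≢ 0F = x≢a
        x≢ 1F = x≢b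
        x≢ 2F = x≢c
        adj : ∀ {i j} → i ≢ j → corners i ~ corners j
        adj = distinct-pairs (λ i j → corners i ~ corners j) ~-sym a~b a~c b~c
        far : ∀ {i j} → i ≢ j → Far i j
        far = distinct-pairs Far
          (λ f s∈ t∈ a b → let s≢t , e = f t∈ s∈ b a
                           in s≢t ∘ sym , λ s~t → proj₂ (e (~-sym s~t)) , proj₁ (e (~-sym s~t)))
          far₀₁ far₀₂ far₁₂
        deg : ∀ {z} → ∃[ i ] z ∈ triple l m k i → ∃[ p ] ∃[ q ] p ≢ q × p ∈ L × q ∈ L × z ~ p × z ~ q
        deg {z} (i , z∈) with z Fin.≟ x | z Fin.≟ corners i
        deg {z} (i , z∈) | yes refl | _ with second p x≢a | second q x≢b
        ... | s , s∈ , x~s | t , t∈ , x~t =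
          s , t , proj₁ (far₀₁ s∈ t∈ (~⇒≢ {G = G} x~s ∘ sym) (~⇒≢ {G = G} x~t ∘ sym))
          , incl 0F s∈ , incl 1F t∈ , x~s , x~t
        deg (0F , z∈) | _ | yes refl =
          b , c , ~⇒≢ {G = G} b~c , incl 1F (last∈ q) , incl 2F (last∈ r) , a~b , a~c
        deg (1F , z∈) | _ | yes refl =
          a , c , ~⇒≢ {G = G} a~c , incl 0F (last∈ p) , incl 2F (last∈ r) , ~-sym a~b , b~c
        deg (2F , z∈) | _ | yes refl =
          a , b , ~⇒≢ {G = G} a~b , incl 0F (last∈ p) , incl 1F (last∈ q) , ~-sym a~c , ~-sym b~c
        deg (i , z∈) | no z≢x | no z≢c = inner i (ch i) z∈ z≢x z≢c

    module _ {a b c a′ b′ c′ : Fin n} where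

      private
        start finish : Fin 3 → Fin n
        start = triple a b c
        finish = triple a′ b′ c′
        Far : Fin 3 → Fin 3 → Set
        Far i j = ∀ {s t} → s ∈ triple l m k i → t ∈ triple l m k j →
                  s ≢ t × (s ~ t → (s ≡ start i × t ≡ start j) ⊎ (s ≡ finish i × t ≡ finish j))

      prism : a ~ b → a ~ c → b ~ c → a′ ~ b′ → a′ ~ c′ → b′ ~ c′ → a ≢ a′ → b ≢ b′ → c ≢ c′ →
              Chordless G a a′ l → Chordless G b b′ m → Chordless G c c′ k →
              Far 0F 1F → Far 0F 2F → Far 1F 2F → SolidOn L
      prism a~b a~c b~c a′~b′ a′~c′ b′~c′ a≢a′ b≢b′ c≢c′ p q r far₀₁ far₀₂ far₁₂ = record
        { solid = inj₂ (inj₂ (inj₂ (isPrism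
            (λ i → start i , ∈-set⁺ (incl i (first∈ (ch i))))
            (λ i → finish i , ∈-set⁺ (incl i (last∈ (ch i))))
            adj adj′ lists (λ i → lift-chordless _ (ch i)) (λ i → s≢f i ∘ cong proj₁)
            (λ i≢j s∈ t∈ →
               let s≢t , e = far i≢j (lift⁻ _ _ s∈) (lift⁻ _ _ t∈)
               in s≢t ∘ cong proj₁ , λ s~t → Data.Sum.map both both (e s~t))
            lists-all)))
        ; deg≥2 = λ z∈ → deg (which z∈) }
        where
        both : ∀ {s t u v : ∃[ w ] w ∈ˢ set L} → proj₁ s ≡ proj₁ t × proj₁ u ≡ proj₁ v → s ≡ t × u ≡ v
        both (e , e′) = vertex-≡ e , vertex-≡ e′
        ch : ∀ i → Chordless G (start i) (finish i) (triple l m k i)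
        ch 0F = p
        ch 1F = q
        ch 2F = r
        s≢f : ∀ i → start i ≢ finish i
        s≢f 0F = a≢a′
        s≢f 1F = b≢b′
        s≢f 2F = c≢c′
        adj : ∀ {i j} → i ≢ j → start i ~ start j
        adj = distinct-pairs (λ i j → start i ~ start j) ~-sym a~b a~c b~c
        adj′ : ∀ {i j} → i ≢ j → finish i ~ finish j
        adj′ = distinct-pairs (λ i j → finish i ~ finish j) ~-sym a′~b′ a′~c′ b′~c′
        swap : ∀ {s t u v : Fin n} {A B : Set} → (s ≡ t × A) ⊎ (u ≡ v × B) → (A × s ≡ t) ⊎ (B × u ≡ v)
        swap = Data.Sum.map Data.Product.swap Data.Product.swap
        far : ∀ {i j} → i ≢ j → Far i j
        far = distinct-pairs Far
          (λ f s∈ t∈ → let s≢t , e = f t∈ s∈ in s≢t ∘ sym , λ s~t → swap (e (~-sym s~t)))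
          far₀₁ far₀₂ far₁₂
        triangle : ∀ {x y z} → x ~ y → x ~ z → y ~ z → y ∈ L → z ∈ L →
                   ∃[ p ] ∃[ q ] p ≢ q × p ∈ L × q ∈ L × x ~ p × x ~ q
        triangle x~y x~z y~z y∈ z∈ = _ , _ , ~⇒≢ {G = G} y~z , y∈ , z∈ , x~y , x~z
        deg : ∀ {z} → ∃[ i ] z ∈ triple l m k i → ∃[ p ] ∃[ q ] p ≢ q × p ∈ L × q ∈ L × z ~ p × z ~ q
        deg {z} (i , z∈) with z Fin.≟ start i | z Fin.≟ finish i
        deg (0F , z∈) | yes refl | _ = triangle a~b a~c b~c (incl 1F (first∈ q)) (incl 2F (first∈ r))
        deg (1F , z∈) | yes refl | _ = triangle (~-sym a~b) b~c a~c (incl 0F (first∈ p)) (incl 2F (first∈ r))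
        deg (2F , z∈) | yes refl | _ = triangle (~-sym a~c) (~-sym b~c) a~b (incl 0F (first∈ p)) (incl 1F (first∈ q))
        deg (0F , z∈) | _ | yes refl = triangle a′~b′ a′~c′ b′~c′ (incl 1F (last∈ q)) (incl 2F (last∈ r))
        deg (1F , z∈) | _ | yes refl = triangle (~-sym a′~b′) b′~c′ a′~c′ (incl 0F (last∈ p)) (incl 2F (last∈ r))
        deg (2F , z∈) | _ | yes refl = triangle (~-sym a′~c′) (~-sym b′~c′) a′~b′ (incl 0F (last∈ p)) (incl 1F (last∈ q))
        deg (i , z∈) | no z≢s | no z≢f = inner i (ch i) z∈ z≢s z≢f

-- Cutting, joining and attaching induced paths

module _ (G : Graph (Fin n)) where
  open Graph G

  private
    V : Set
    V = Fin n

  Apart : V → V → Set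
  Apart s t = s ≢ t × ¬ s ~ t

  -- The shape of the solid is forgotten here: later a solid is counted only by the vertices that it
  -- surely contains and the region in which it stays.
  record SolidWith (must : List V) (allowed : Pred V 0ℓ) : Set where
    field
      S        : Subset n
      solid    : Solid G S
      deg≥2    : Deg≥2 G (_∈ˢ S)
      contains : ∀ {z} → z ∈ must → z ∈ˢ S
      within   : ∀ {z} → z ∈ˢ S → allowed z

  solidWith : ∀ {l must allowed} → SolidOn G l → All (_∈ l) must → All allowed l → SolidWith must allowed
  solidWith {l} s m⊆ ⊆a = record
    { S = set l ; solid = solid
    ; deg≥2 = λ z∈ → let p , q , p≢q , p∈ , q∈ , e = deg≥2 (∈-set⁻ z∈)
                     in p , q , p≢q , ∈-set⁺ p∈ , ∈-set⁺ q∈ , e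
    ; contains = ∈-set⁺ ∘ All.lookup m⊆ ; within = All.lookup ⊆a ∘ ∈-set⁻ }
    where open SolidOn s

  weaken : ∀ {must must′ allowed allowed′} → SolidWith must allowed →
           All (_∈ must) must′ → (∀ {z} → allowed z → allowed′ z) → SolidWith must′ allowed′
  weaken s f g = record
    { S = S ; solid = solid ; deg≥2 = deg≥2 ; contains = contains ∘ All.lookup f ; within = g ∘ within }
    where open SolidWith s

  module _ {Q : Pred V 0ℓ} (Q? : Decidable Q) where

    -- The last clause holds because a cut anywhere but at the start loses the start. A caller whose
    -- `Q` excludes `a` thereby learns that the remaining path avoids `a`.
    last-part : ∀ {a b l} → Chordless G a b l → Any Q l →
                ∃[ u ] ∃[ m ] Chordless G u b m × (∀ {z} → z ∈ m → z ∈ l) × Q u ×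
                (∀ {z} → z ∈ m → Q z → z ≡ u) × (a ∈ m → a ≡ u)
    last-part (single x) (here qx) =
      x , _ , single x , (λ z∈ → z∈) , qx , (λ { (here e) _ → e }) , λ _ → refl
    last-part (cons {x} {l = l} x~y x∉ only p) q with Any.any? Q? l
    ... | yes q′ with last-part p q′
    ...   | u , m , p′ , m⊆ , qu , last , _ = u , m , p′ , there ∘ m⊆ , qu , last , ⊥-elim ∘ x∉ ∘ m⊆
    last-part (cons {x} {l = l} x~y x∉ only p) (there q) | no ¬q = ⊥-elim (¬q q)
    last-part (cons {x} {l = l} x~y x∉ only p) (here qx) | no ¬q =
      x , _ , cons x~y x∉ only p , (λ z∈ → z∈) , qx
      , (λ { (here e) _ → e ; (there z∈) qz → ⊥-elim (¬q (lose z∈ qz)) }) , λ _ → refl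

    -- The remainder is kept in an equation between lists, so that two prefixes of the same path can
    -- be compared by `nested-prefixes`.
    first-part : ∀ {a b l} → Chordless G a b l → Any Q l →
                 ∃[ w ] ∃[ m ] ∃[ rest ] Chordless G a w m × l ≡ m ++ rest × Q w ×
                 (∀ {z} → z ∈ m → Q z → z ≡ w)
    first-part (single x) (here qx) = x , _ , [] , single x , refl , qx , λ { (here e) _ → e }
    first-part (cons {x} {l = l} x~y x∉ only p) q with Q? x
    ... | yes qx = x , _ , l , single x , refl , qx , λ { (here e) _ → e }
    first-part (cons x~y x∉ only p) (here qx) | no ¬qx = ⊥-elim (¬qx qx)
    first-part (cons x~y x∉ only p) (there q) | no ¬qx with first-part p q
    ... | w , m , rest , p′ , refl , qw , first =
      w , _ , rest , cons x~y (x∉ ∘ ∈-++⁺ˡ) (only ∘ ∈-++⁺ˡ) p′ , refl , qw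
      , λ { (here refl) qz → ⊥-elim (¬qx qz) ; (there z∈) → first z∈ }

    -- The part of an induced path up to its first vertex satisfying Q and the
    -- part from its last such vertex on.
    record Bisection (a b : V) (l : List V) : Set where
      field
        w u   : V
        k m   : List V
        left  : Chordless G a w k
        right : Chordless G u b m
        k⊆    : ∀ {z} → z ∈ k → z ∈ l
        m⊆    : ∀ {z} → z ∈ m → z ∈ l
        Qw    : Q w
        Qu    : Q u
        first : ∀ {z} → z ∈ k → Q z → z ≡ w
        last  : ∀ {z} → z ∈ m → Q z → z ≡ u
        cross : (w ≡ u × (∀ {z} → z ∈ l → z ∈ k ⊎ z ∈ m) ×
                 (∀ {s t} → s ∈ k → t ∈ m → s ≢ w → t ≢ w → Apart s t))
              ⊎ (w ≢ u × (∀ {s t} → s ∈ k → t ∈ m → s ≢ t × (s ~ t → s ≡ w × t ≡ u)))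

    -- Vertices before the first one in `Q` are collected on the left. From there `last-part` finds
    -- the right part, and the two parts share a vertex exactly if no further vertex of `Q` follows.
    bisect : ∀ {a b l} → Chordless G a b l → Any Q l → Bisection a b l
    bisect (single x) (here qx) = record
      { left = single x ; right = single x ; k⊆ = λ z∈ → z∈ ; m⊆ = λ z∈ → z∈ ; Qw = qx ; Qu = qx
      ; first = λ { (here e) _ → e } ; last = λ { (here e) _ → e }
      ; cross = inj₁ (refl , inj₁ , λ { (here e) _ s≢ → ⊥-elim (s≢ e) }) }
    bisect (cons {x} {l = l} x~y x∉ only p) q with Q? x | Any.any? Q? l
    ... | yes qx | yes q′ with last-part p q′
    ...   | u , m , p′ , m⊆ , qu , last , y∈⇒ = record
      { left = single x ; right = p′ ; k⊆ = λ { (here e) → here e } ; m⊆ = there ∘ m⊆ ; Qw = qx ; Qu = qu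
      ; first = λ { (here e) _ → e } ; last = last
      ; cross = inj₂ ((λ { refl → x∉ (m⊆ (first∈ p′)) }) ,
          λ { (here refl) t∈ → (λ { refl → x∉ (m⊆ t∈) }) ,
              λ x~t → refl , trans (only (m⊆ t∈) x~t) (y∈⇒ (subst (_∈ m) (only (m⊆ t∈) x~t) t∈)) }) }
    bisect (cons {x} {l = l} x~y x∉ only p) q | yes qx | no ¬q = record
      { left = single x ; right = cons x~y x∉ only p ; k⊆ = λ { (here e) → here e } ; m⊆ = λ z∈ → z∈
      ; Qw = qx ; Qu = qx ; first = λ { (here e) _ → e }
      ; last = λ { (here e) _ → e ; (there z∈) qz → ⊥-elim (¬q (lose z∈ qz)) }
      ; cross = inj₁ (refl , inj₂ , λ { (here e) _ s≢ → ⊥-elim (s≢ e) }) }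
    bisect (cons x~y x∉ only p) (here qx) | no ¬qx | _ = ⊥-elim (¬qx qx)
    bisect (cons {x} {y} x~y x∉ only p) (there q) | no ¬qx | _ = record
      { left = cons x~y (x∉ ∘ k⊆) (only ∘ k⊆) left ; right = right
      ; k⊆ = λ { (here e) → here e ; (there z∈) → there (k⊆ z∈) } ; m⊆ = there ∘ m⊆ ; Qw = Qw ; Qu = Qu
      ; first = λ { (here refl) qx → ⊥-elim (¬qx qx) ; (there z∈) → first z∈ } ; last = last
      ; cross = Data.Sum.map shared apart cross }
      where
      B : Bisection _ _ _
      B = bisect p q
      open Bisection B
      shared : w ≡ u × (∀ {z} → z ∈ _ → z ∈ k ⊎ z ∈ m) ×
               (∀ {s t} → s ∈ k → t ∈ m → s ≢ w → t ≢ w → Apart s t) →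
               w ≡ u × (∀ {z} → z ∈ x ∷ _ → z ∈ x ∷ k ⊎ z ∈ m) ×
               (∀ {s t} → s ∈ x ∷ k → t ∈ m → s ≢ w → t ≢ w → Apart s t)
      shared (e , cover , f) = e
        , (λ { (here e) → inj₁ (here e) ; (there z∈) → Data.Sum.map there (λ z → z) (cover z∈) })
        , λ { (here refl) t∈ _ t≢w → (λ { refl → x∉ (m⊆ t∈) })
              -- The only neighbour of `x` further along is `y`, where the left part of the rest
              -- starts; lying in both parts, `y` would have to be the common vertex `w`.
              , λ x~t → let t≡y = only (m⊆ t∈) x~t
                            y∈m = subst (_∈ m) t≡y t∈
                            y≢w = t≢w ∘ trans t≡y
                        in proj₁ (f (first∈ left) y∈m y≢w y≢w) refl
            ; (there s∈) → f s∈ }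
      apart : w ≢ u × (∀ {s t} → s ∈ k → t ∈ m → s ≢ t × (s ~ t → s ≡ w × t ≡ u)) →
              w ≢ u × (∀ {s t} → s ∈ x ∷ k → t ∈ m → s ≢ t × (s ~ t → s ≡ w × t ≡ u))
      apart (w≢u , f) = w≢u ,
        λ { (here refl) t∈ → (λ { refl → x∉ (m⊆ t∈) })
              , λ x~t → ⊥-elim (proj₁ (f (first∈ left) t∈) (sym (only (m⊆ t∈) x~t)))
          ; (there s∈) → f s∈ }

  join : ∀ {a b c d k m} → Chordless G a b k → Chordless G c d m → b ~ c →
         (∀ {s t} → s ∈ k → t ∈ m → s ≢ t × (s ~ t → s ≡ b × t ≡ c)) →
         Chordless G a d (k ++ m)
  join (single b) q b~c f = cons b~c (λ b∈ → proj₁ (f (here refl) b∈) refl)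
                                 (λ w∈ b~w → proj₂ (proj₂ (f (here refl) w∈) b~w)) q
  join {k = k} {m} (cons {x} {y} {l = l} x~y x∉ only p) q b~c f =
    cons x~y x∉′ only′ (join p q b~c (f ∘ there))
    where
    x∉′ : x ∉ l ++ m
    x∉′ x∈ with ∈-++⁻ l x∈
    ... | inj₁ x∈l = x∉ x∈l
    ... | inj₂ x∈m = proj₁ (f (here refl) x∈m) refl
    only′ : ∀ {w} → w ∈ l ++ m → x ~ w → w ≡ y
    only′ w∈ x~w with ∈-++⁻ l w∈
    ... | inj₁ w∈l = only w∈l x~w
    ... | inj₂ w∈m = ⊥-elim (x∉ (subst (_∈ l) (sym (proj₁ (proj₂ (f (here refl) w∈m) x~w))) (last∈ p)))

  suffix : ∀ {x y z l} → Chordless G y z l → x ∈ l →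
           ∃[ m ] Chordless G x z m × (∀ {w} → w ∈ m → w ∈ l)
  suffix (single _) (here refl) = _ , single _ , λ w∈ → w∈
  suffix (cons x~y x∉ only p) (here refl) = _ , cons x~y x∉ only p , λ w∈ → w∈
  suffix (cons _ _ _ p) (there x∈) with suffix p x∈
  ... | m , p′ , m⊆ = m , p′ , there ∘ m⊆

  -- If `x` already lies on the path, the path is cut there; otherwise `x` is joined to its last
  -- neighbour on it, which leaves no chord at `x`.
  prepend : ∀ {x y z l} → x ~ y → Chordless G y z l →
            ∃[ m ] Chordless G x z m × (∀ {w} → w ∈ m → w ≡ x ⊎ w ∈ l)
  prepend {x} {l = l} x~y p with x ∈? l
  ... | yes x∈ with suffix p x∈
  ...   | m , p′ , m⊆ = m , p′ , inj₂ ∘ m⊆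
  prepend {x} {l = l} x~y p | no x∉ with last-part (x ~?_) p (lose (first∈ p) x~y)
  ... | u , m , p′ , m⊆ , x~u , last , _ =
    _ , cons x~u (x∉ ∘ m⊆) last p′ , λ { (here e) → inj₁ e ; (there w∈) → inj₂ (m⊆ w∈) }

  -- A step of a walk whose vertices, except possibly the first, satisfy D.
  Step : Pred V 0ℓ → V → V → Set
  Step D x y = x ~ y × D y

  Walk : Pred V 0ℓ → V → V → Set
  Walk D = Star (Step D)

  shorten : ∀ {D x y} → Walk D x y →
            ∃[ l ] Chordless G x y l × (∀ {z} → z ∈ l → z ≡ x ⊎ D z)
  shorten ε = _ , single _ , λ { (here e) → inj₁ e }
  shorten ((x~y , dy) ◅ ws) with shorten ws
  ... | l , p , l⊆ with prepend x~y p
  ...   | m , p′ , m⊆ = m , p′ , λ z∈ → [ inj₁ , inj₂ ∘ [ (λ { refl → dy }) , (λ d → d) ]′ ∘ l⊆ ]′ (m⊆ z∈)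

  Touches : Pred V 0ℓ → V → Set
  Touches T x = ∃[ z ] T z × x ~ z

  -- The end `r` is the first vertex of the walk with a neighbour in `T`, so the walk has not
  -- entered `T` up to there. Making the path induced only discards vertices and preserves this.
  approach : ∀ {D T : Pred V 0ℓ} → Decidable T → ∀ {x t} → Walk D x t → T t → ¬ T x →
             ∃[ r ] ∃[ l ] Chordless G x r l × (∀ {z} → z ∈ l → z ≡ x ⊎ D z) ×
             (∀ {z} → z ∈ l → ¬ T z) × Touches T r × (∀ {z} → z ∈ l → Touches T z → z ≡ r)
  approach T? ε tt ¬tx = ⊥-elim (¬tx tt)
  approach {T = T} T? {x} (_◅_ {j = y} (x~y , dy) ws) tt ¬tx with any? (λ z → T? z ×-dec x ~? z)
  ... | yes q = x , _ , single x , (λ { (here e) → inj₁ e }) , (λ { (here refl) → ¬tx }) , q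
              , λ { (here e) _ → e }
  ... | no ¬q with approach {T = T} T? ws tt (λ ty → ¬q (y , ty , x~y))
  ...   | r , l , p , l⊆ , l∩T , q , only with prepend x~y p
  ...     | m , p′ , m⊆ = r , m , p′
    , (λ z∈ → [ inj₁ , inj₂ ∘ [ (λ { refl → dy }) , (λ d → d) ]′ ∘ l⊆ ]′ (m⊆ z∈))
    , (λ z∈ → [ (λ { refl → ¬tx }) , l∩T ]′ (m⊆ z∈)) , q
    , λ z∈ → [ (λ { refl q′ → ⊥-elim (¬q q′) }) , only ]′ (m⊆ z∈)

  -- Three paths start in neighbours a, b, c of v, of which only a and c may be
  -- adjacent.  Whether they are, and whether the paths meet in a vertex or in a
  -- triangle, decides which solid they form with v.
  module _ {v a b c e₁ e₂ e₃ : V} {k m l} (A : Chordless G a e₁ k) (B : Chordless G b e₂ m) (C : Chordless G c e₃ l)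
           (v~a : v ~ a) (v~b : v ~ b) (v~c : v ~ c) (v∉k : v ∉ k) (v∉m : v ∉ m) (v∉l : v ∉ l)
           (only-b : ∀ {z} → z ∈ m → v ~ z → z ≡ b)
           {allowed : Pred V 0ℓ} (ok : allowed v) (okA : All allowed k) (okB : All allowed m) (okC : All allowed l) where

    private
      Goal : Set
      Goal = SolidWith (v ∷ a ∷ b ∷ c ∷ []) allowed
      vB : Chordless G v e₂ (v ∷ m)
      vB = cons v~b v∉m only-b B
      from-v : ∀ {k m} {R : V → V → Set} → (∀ {s t} → s ∈ k → t ∈ m → R s t) →
               ∀ {s t} → s ∈ v ∷ k → t ∈ v ∷ m → s ≢ v → t ≢ v → R s t
      from-v f (here e) _ s≢v _ = ⊥-elim (s≢v e)
      from-v f (there _) (here e) _ t≢v = ⊥-elim (t≢v e)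
      from-v f (there s∈) (there t∈) _ _ = f s∈ t∈

      all-reverse : ∀ {P : Pred V 0ℓ} {l} → All P l → All P (reverse l)
      all-reverse ps = All.tabulate (All.lookup ps ∘ Any.reverse⁻)

    -- For nonadjacent `a` and `c` this is a trihedron with ends `v` and the common vertex. For
    -- adjacent ones `v`, `a`, `c` form the triangle of a stamp with the common vertex as apex, and
    -- the path through `b` leads from there to `v`.
    meet-in-vertex : (∀ {z} → z ∈ k → z ≢ e₁ → v ~ z → z ≡ a) → (∀ {z} → z ∈ l → z ≢ e₁ → v ~ z → z ≡ c) →
                     e₁ ≡ e₂ → e₁ ≡ e₃ → v ≢ e₁ → (¬ a ~ c × ¬ v ~ e₁) ⊎ (a ~ c × e₁ ≢ a × e₁ ≢ c) →
                     (∀ {s t} → s ∈ k → t ∈ m → s ≢ e₁ → t ≢ e₁ → Apart s t) →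
                     (∀ {s t} → s ∈ k → t ∈ l → s ≢ e₁ → t ≢ e₁ → s ≢ t × (s ~ t → s ≡ a × t ≡ c)) →
                     (∀ {s t} → s ∈ m → t ∈ l → s ≢ e₁ → t ≢ e₁ → Apart s t) → Goal
    meet-in-vertex only-a only-c refl refl v≢y (inj₁ (a≁c , v≁y)) k-m k-l m-l = solidWith
      (trihedron G v≢y v≁y (cons v~a v∉k (λ z∈ v~z → only-a z∈ (λ { refl → v≁y v~z }) v~z) A) vB
        (cons v~c v∉l (λ z∈ v~z → only-c z∈ (λ { refl → v≁y v~z }) v~z) C)
        (λ s∈ t∈ s≢v s≢y t≢v → from-v k-m s∈ t∈ s≢v t≢v s≢y)
        (λ s∈ t∈ s≢v s≢y t≢v t≢y → let s≢t , f = from-v k-l s∈ t∈ s≢v t≢v s≢y t≢y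
           in s≢t , λ s~t → a≁c (subst₂ _~_ (proj₁ (f s~t)) (proj₂ (f s~t)) s~t))
        (λ s∈ t∈ s≢v s≢y t≢v → from-v m-l s∈ t∈ s≢v t≢v s≢y))
      (here refl ∷ there (∈-++⁺ˡ (first∈ A)) ∷ there (∈-++⁺ʳ k (there (∈-++⁺ˡ (first∈ B))))
        ∷ there (∈-++⁺ʳ k (there (∈-++⁺ʳ m (there (first∈ C))))) ∷ [])
      (++⁺ (ok ∷ okA) (++⁺ (ok ∷ okB) (ok ∷ okC)))
    meet-in-vertex only-a only-c refl refl v≢y (inj₂ (a~c , y≢a , y≢c)) k-m k-l m-l = solidWith
      (stamp G v~a v~c a~c (v≢y ∘ sym) y≢a y≢c (rev vB) (rev A) (rev C)
        (λ s∈ t∈ → vm-k (Any.reverse⁻ s∈) (Any.reverse⁻ t∈)) (λ s∈ t∈ → vm-l (Any.reverse⁻ s∈) (Any.reverse⁻ t∈))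
        (λ s∈ t∈ → k-l (Any.reverse⁻ s∈) (Any.reverse⁻ t∈)))
      (∈-++⁺ˡ {xs = reverse (v ∷ m)} (Any.reverse⁺ {xs = v ∷ m} (here refl)) ∷ ∈-++⁺ʳ (reverse (v ∷ m)) (∈-++⁺ˡ (Any.reverse⁺ (first∈ A)))
        ∷ ∈-++⁺ˡ {xs = reverse (v ∷ m)} (Any.reverse⁺ {xs = v ∷ m} (there (first∈ B)))
        ∷ ∈-++⁺ʳ (reverse (v ∷ m)) (∈-++⁺ʳ (reverse k) (Any.reverse⁺ (first∈ C))) ∷ [])
      (++⁺ {xs = reverse (v ∷ m)} (all-reverse {l = v ∷ m} (ok ∷ okB)) (++⁺ (all-reverse okA) (all-reverse okC)))
      where
      vm-k : ∀ {s t} → s ∈ v ∷ m → t ∈ k → s ≢ e₁ → t ≢ e₁ → s ≢ t × (s ~ t → s ≡ v × t ≡ a)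
      vm-k (here refl) t∈ _ t≢ = (λ { refl → v∉k t∈ }) , λ v~t → refl , only-a t∈ t≢ v~t
      vm-k (there s∈) t∈ s≢ t≢ = let t≢s , t≁s = k-m t∈ s∈ t≢ s≢ in t≢s ∘ sym , ⊥-elim ∘ t≁s ∘ ~-sym
      vm-l : ∀ {s t} → s ∈ v ∷ m → t ∈ l → s ≢ e₁ → t ≢ e₁ → s ≢ t × (s ~ t → s ≡ v × t ≡ c)
      vm-l (here refl) t∈ _ t≢ = (λ { refl → v∉l t∈ }) , λ v~t → refl , only-c t∈ t≢ v~t
      vm-l (there s∈) t∈ s≢ t≢ = let s≢t , s≁t = m-l s∈ t∈ s≢ t≢ in s≢t , ⊥-elim ∘ s≁t

    -- Nonadjacent `a` and `c` give a stamp with apex `v`. Adjacent ones make `v`, `a`, `c` the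
    -- second triangle of a prism, whose paths must then be nontrivial.
    meet-in-triangle : (∀ {z} → z ∈ k → v ~ z → z ≡ a) → (∀ {z} → z ∈ l → v ~ z → z ≡ c) →
                       e₁ ~ e₂ → e₁ ~ e₃ → e₂ ~ e₃ → ¬ a ~ c ⊎ (a ~ c × a ≢ e₁ × c ≢ e₃) →
                       (∀ {s t} → s ∈ k → t ∈ m → s ≢ t × (s ~ t → s ≡ e₁ × t ≡ e₂)) →
                       (∀ {s t} → s ∈ k → t ∈ l → s ≢ t × (s ~ t → (s ≡ a × t ≡ c) ⊎ (s ≡ e₁ × t ≡ e₃))) →
                       (∀ {s t} → s ∈ m → t ∈ l → s ≢ t × (s ~ t → s ≡ e₂ × t ≡ e₃)) → Goal
    meet-in-triangle only-a only-c e₁~e₂ e₁~e₃ e₂~e₃ (inj₁ a≁c) k-m k-l m-l = solidWith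
      (stamp G e₁~e₂ e₁~e₃ e₂~e₃ (λ { refl → v∉k (last∈ A) }) (λ { refl → v∉m (last∈ B) }) (λ { refl → v∉l (last∈ C) })
        (cons v~a v∉k only-a A) vB (cons v~c v∉l only-c C) (from-v k-m) (from-v (λ s∈ t∈ → let s≢t , f = k-l s∈ t∈ in s≢t ,
          λ s~t → [ (λ { (refl , refl) → ⊥-elim (a≁c s~t) }) , (λ e → e) ]′ (f s~t))) (from-v m-l))
      (here refl ∷ there (∈-++⁺ˡ (first∈ A)) ∷ there (∈-++⁺ʳ k (there (∈-++⁺ˡ (first∈ B))))
        ∷ there (∈-++⁺ʳ k (there (∈-++⁺ʳ m (there (first∈ C))))) ∷ [])
      (++⁺ (ok ∷ okA) (++⁺ (ok ∷ okB) (ok ∷ okC)))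
    meet-in-triangle only-a only-c e₁~e₂ e₁~e₃ e₂~e₃ (inj₂ (a~c , a≢e₁ , c≢e₃)) k-m k-l m-l = solidWith
      (prism G v~a v~c a~c (~-sym e₁~e₂) e₂~e₃ e₁~e₃ (λ { refl → v∉m (last∈ B) }) a≢e₁ c≢e₃ vB A C vm-k vm-l k-l)
      (here refl ∷ there (∈-++⁺ʳ m (∈-++⁺ˡ (first∈ A))) ∷ there (∈-++⁺ˡ (first∈ B))
        ∷ there (∈-++⁺ʳ m (∈-++⁺ʳ k (first∈ C))) ∷ [])
      (++⁺ (ok ∷ okB) (++⁺ okA okC))
      where
      vm-k : ∀ {s t} → s ∈ v ∷ m → t ∈ k → s ≢ t × (s ~ t → (s ≡ v × t ≡ a) ⊎ (s ≡ e₂ × t ≡ e₁))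
      vm-k (here refl) t∈ = (λ { refl → v∉k t∈ }) , λ v~t → inj₁ (refl , only-a t∈ v~t)
      vm-k (there s∈) t∈ = let t≢s , f = k-m t∈ s∈
                           in t≢s ∘ sym , λ s~t → inj₂ (proj₂ (f (~-sym s~t)) , proj₁ (f (~-sym s~t)))
      vm-l : ∀ {s t} → s ∈ v ∷ m → t ∈ l → s ≢ t × (s ~ t → (s ≡ v × t ≡ c) ⊎ (s ≡ e₂ × t ≡ e₃))
      vm-l (here refl) t∈ = (λ { refl → v∉l t∈ }) , λ v~t → inj₁ (refl , only-c t∈ v~t)
      vm-l (there s∈) t∈ = let s≢t , f = m-l s∈ t∈ in s≢t , inj₂ ∘ f

  -- The first and the last neighbour w and u of r on the a-b path may coincide, be
  -- adjacent, or neither; in the last case the part between them is bypassed.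
  attach : ∀ {v a b lP} → Hole G v a b lP → ∀ {c r lR} → Chordless G c r lR →
           v ~ c → v ∉ lR → (∀ {z} → z ∈ lR → v ~ z → z ≡ c) → (∀ {z} → z ∈ lR → z ∉ lP) →
           (∀ {y z} → y ∈ lR → z ∈ lP → y ~ z → y ≡ r ⊎ (z ≡ a × y ≡ c)) →
           ∃[ z ] z ∈ lP × r ~ z × z ≢ a →
           (¬ a ~ c × ∃[ z ] z ∈ lP × r ~ z × z ≢ b) ⊎ (a ~ c × ¬ r ~ a) →
           SolidWith (v ∷ a ∷ b ∷ c ∷ []) (λ z → z ≡ v ⊎ z ∈ lR ⊎ z ∈ lP)
  attach {v} {a} {b} {lP} h {c} {r} {lR} R v~c v∉R only-c R∩P touch (z₁ , z₁∈ , r~z₁ , z₁≢a) kind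
    with bisect (r ~?_) (Hole.rim h) (lose z₁∈ r~z₁)
  ... | record { w = w ; u = u ; k = k ; m = m ; left = left ; right = right ; k⊆ = k⊆ ; m⊆ = m⊆
               ; Qw = r~w ; Qu = r~u ; first = first ; last = last ; cross = cross } = by cross
    where
    open Hole h
    OnTop : V → Set
    OnTop z = z ≡ v ⊎ z ∈ lR ⊎ z ∈ lP
    r∈ : r ∈ lR
    r∈ = last∈ R
    w∈ : w ∈ lP
    w∈ = k⊆ (last∈ left)
    u∈ : u ∈ lP
    u∈ = m⊆ (first∈ right)
    m⁻ : ∀ {z} → z ∈ reverse m → z ∈ m
    m⁻ = Any.reverse⁻
    okR : All OnTop lR
    okR = All.tabulate (inj₂ ∘ inj₁)
    okk : All OnTop k
    okk = All.tabulate (inj₂ ∘ inj₂ ∘ k⊆)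
    okm : All OnTop (reverse m)
    okm = All.tabulate (inj₂ ∘ inj₂ ∘ m⊆ ∘ m⁻)
    only-b : a ∉ m → ∀ {z} → z ∈ reverse m → v ~ z → z ≡ b
    only-b a∉ z∈ v~z = [ (λ { refl → ⊥-elim (a∉ (m⁻ z∈)) }) , (λ e → e) ]′ (only (m⊆ (m⁻ z∈)) v~z)
    k-R : ∀ {s t} → s ∈ k → t ∈ lR → s ≢ t × (s ~ t → (s ≡ a × t ≡ c) ⊎ (s ≡ w × t ≡ r))
    k-R {s} {t} s∈ t∈ = (λ { refl → R∩P t∈ (k⊆ s∈) }) , λ s~t → f s~t (touch t∈ (k⊆ s∈) (~-sym s~t))
      where
      f : s ~ t → t ≡ r ⊎ (s ≡ a × t ≡ c) → (s ≡ a × t ≡ c) ⊎ (s ≡ w × t ≡ r)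
      f s~t (inj₁ refl) = inj₂ (first s∈ (~-sym s~t) , refl)
      f s~t (inj₂ e) = inj₁ e
    m-R : a ∉ m → ∀ {s t} → s ∈ m → t ∈ lR → s ≢ t × (s ~ t → s ≡ u × t ≡ r)
    m-R a∉ {s} {t} s∈ t∈ = (λ { refl → R∩P t∈ (m⊆ s∈) }) , λ s~t → f s~t (touch t∈ (m⊆ s∈) (~-sym s~t))
      where
      f : s ~ t → t ≡ r ⊎ (s ≡ a × t ≡ c) → s ≡ u × t ≡ r
      f s~t (inj₁ refl) = last s∈ (~-sym s~t) , refl
      f s~t (inj₂ (refl , _)) = ⊥-elim (a∉ s∈)

    by : _ → SolidWith (v ∷ a ∷ b ∷ c ∷ []) OnTop
    -- Here `r` has a single neighbour on the path, and it is not `a`. `R` is lengthened by it, and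
    -- all three paths end there.
    by (inj₁ (w≡u , cover , far)) =
      meet-in-vertex left (rev right) (snoc R r~w (λ w∈R → R∩P w∈R w∈) only-r) v~a v~b v~c
        (v∉ ∘ k⊆) (v∉ ∘ m⊆ ∘ m⁻) (λ v∈ → [ v∉R , v≢w ]′ (in-Rw v∈)) (only-b a∉m)
        (inj₁ refl) okk okm (++⁺ okR (inj₂ (inj₂ w∈) ∷ []))
        only-a (λ z∈ z≢w → [ only-c , ⊥-elim ∘ z≢w ]′ (in-Rw z∈)) w≡u refl v≢w kind′
        (λ s∈ t∈ → far s∈ (m⁻ t∈))
        (λ s∈ t∈ s≢w t≢w → [ (λ t∈R → let s≢t , f = k-R s∈ t∈R in s≢t , λ s~t → [ id , ⊥-elim ∘ s≢w ∘ proj₁ ]′ (f s~t))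
                           , ⊥-elim ∘ t≢w ]′ (in-Rw t∈))
        (λ s∈ t∈ s≢w t≢w → [ (λ t∈R → let s≢t , f = m-R a∉m (m⁻ s∈) t∈R
                                      in s≢t , λ s~t → s≢w (trans (proj₁ (f s~t)) (sym w≡u)))
                           , ⊥-elim ∘ t≢w ]′ (in-Rw t∈))
      where
      nbr≡w : ∀ {z} → z ∈ lP → r ~ z → z ≡ w
      nbr≡w z∈ r~z = [ (λ z∈k → first z∈k r~z) , (λ z∈m → trans (last z∈m r~z) (sym w≡u)) ]′ (cover z∈)
      w≢a : w ≢ a
      w≢a = z₁≢a ∘ trans (nbr≡w z₁∈ r~z₁)
      v≢w : v ≢ w
      v≢w refl = v∉ w∈
      a∉m : a ∉ m
      a∉m a∈ = proj₁ (far (first∈ left) a∈ (w≢a ∘ sym) (w≢a ∘ sym)) refl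
      only-a : ∀ {z} → z ∈ k → z ≢ w → v ~ z → z ≡ a
      only-a z∈ z≢w v~z with only (k⊆ z∈) v~z
      ... | inj₁ e = e
      ... | inj₂ refl = ⊥-elim (proj₁ (far z∈ (last∈ right) z≢w z≢w) refl)
      in-Rw : ∀ {z} → z ∈ lR ∷ʳ w → z ∈ lR ⊎ z ≡ w
      in-Rw z∈ = Data.Sum.map id (λ { (here e) → e }) (∈-++⁻ lR z∈)
      only-r : ∀ {z} → z ∈ lR → z ~ w → z ≡ r
      only-r z∈ z~w = [ id , ⊥-elim ∘ w≢a ∘ proj₁ ]′ (touch z∈ w∈ z~w)
      kind′ : (¬ a ~ c × ¬ v ~ w) ⊎ (a ~ c × w ≢ a × w ≢ c)
      kind′ = Data.Sum.map
        (λ (a≁c , z₂ , z₂∈ , r~z₂ , z₂≢b) → a≁c , λ v~w → [ w≢a , z₂≢b ∘ trans (nbr≡w z₂∈ r~z₂) ]′ (only w∈ v~w))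
        (λ (a~c , _) → a~c , w≢a , λ { refl → R∩P (first∈ R) w∈ }) kind
    by (inj₂ (w≢u , apart)) with r Fin.≟ c
    -- With `r` equal to `c`, the vertex `c` itself sees `v`, `w` and `u` on the hole.
    ... | yes refl = solidWith
      (pyramid G h (λ { (here refl) → v∉R r∈ ; (there r∈P) → R∩P r∈ r∈P })
         (here refl) (there w∈) (there u∈) (λ { refl → v∉ w∈ }) (λ { refl → v∉ u∈ }) w≢u (~-sym v~c) r~w r~u)
      (here₁ refl ∷ there (there (first∈ rim)) ∷ there (there (last∈ rim)) ∷ here refl ∷ [])
      (inj₂ (inj₁ r∈) ∷ inj₁ refl ∷ All.tabulate (inj₂ ∘ inj₂))
    ... | no r≢c = by′ (w ~? u)
      where
      b∉k : b ∉ k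
      b∉k b∈ = proj₁ (apart b∈ (last∈ right)) refl
      a∉m : a ∉ m
      a∉m a∈ = proj₁ (apart (first∈ left) a∈) refl
      only-a : ∀ {z} → z ∈ k → v ~ z → z ≡ a
      only-a z∈ v~z = [ id , (λ { refl → ⊥-elim (b∉k z∈) }) ]′ (only (k⊆ z∈) v~z)
      by′ : Dec (w ~ u) → SolidWith (v ∷ a ∷ b ∷ c ∷ []) OnTop
      by′ (yes w~u) =
        meet-in-triangle left (rev right) R v~a v~b v~c (v∉ ∘ k⊆) (v∉ ∘ m⊆ ∘ m⁻) v∉R (only-b a∉m)
          (inj₁ refl) okk okm okR only-a only-c w~u (~-sym r~w) (~-sym r~u) kind′
          (λ s∈ t∈ → apart s∈ (m⁻ t∈)) k-R (λ s∈ → m-R a∉m (m⁻ s∈))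
        where
        kind′ : ¬ a ~ c ⊎ (a ~ c × a ≢ w × c ≢ r)
        kind′ = Data.Sum.map proj₁ (λ (a~c , r≁a) → a~c , (λ { refl → r≁a r~w }) , r≢c ∘ sym) kind
      by′ (no w≁u) =
        meet-in-vertex (snoc left (~-sym r~w) (R∩P r∈ ∘ k⊆) (λ z∈ z~r → first z∈ (~-sym z~r)))
          (snoc (rev right) (~-sym r~u) (R∩P r∈ ∘ m⊆ ∘ m⁻) (λ z∈ z~r → last (m⁻ z∈) (~-sym z~r))) R v~a v~b v~c
          (λ v∈ → [ v∉ ∘ k⊆ , v≢r ]′ (in-snoc k v∈)) (λ v∈ → [ v∉ ∘ m⊆ ∘ m⁻ , v≢r ]′ (in-snoc (reverse m) v∈)) v∉R
          (λ z∈ v~z → [ (λ z∈m → only-b a∉m z∈m v~z) , (λ { refl → ⊥-elim (v≁r v~z) }) ]′ (in-snoc (reverse m) z∈))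
          (inj₁ refl) (++⁺ okk (inj₂ (inj₁ r∈) ∷ [])) (++⁺ okm (inj₂ (inj₁ r∈) ∷ [])) okR
          (λ z∈ z≢r → [ only-a , ⊥-elim ∘ z≢r ]′ (in-snoc k z∈)) (λ z∈ _ → only-c z∈) refl refl v≢r kind′
          (λ s∈ t∈ s≢r t≢r → let s≢t , f = apart (inner k s∈ s≢r) (m⁻ (inner (reverse m) t∈ t≢r))
                             in s≢t , λ s~t → w≁u (subst₂ _~_ (proj₁ (f s~t)) (proj₂ (f s~t)) s~t))
          (λ s∈ t∈ s≢r t≢r → let s≢t , f = k-R (inner k s∈ s≢r) t∈
                             in s≢t , λ s~t → [ id , ⊥-elim ∘ t≢r ∘ proj₂ ]′ (f s~t))
          (λ s∈ t∈ s≢r t≢r → let s≢t , f = m-R a∉m (m⁻ (inner (reverse m) s∈ s≢r)) t∈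
                             in s≢t , λ s~t → t≢r (proj₂ (f s~t)))
        where
        in-snoc : ∀ l {z} → z ∈ l ∷ʳ r → z ∈ l ⊎ z ≡ r
        in-snoc l z∈ = Data.Sum.map id (λ { (here e) → e }) (∈-++⁻ l z∈)
        inner : ∀ l {z} → z ∈ l ∷ʳ r → z ≢ r → z ∈ l
        inner l z∈ z≢r = [ id , ⊥-elim ∘ z≢r ]′ (in-snoc l z∈)
        v≢r : v ≢ r
        v≢r refl = v∉R r∈
        v≁r : ¬ v ~ r
        v≁r v~r = r≢c (only-c r∈ v~r)
        kind′ : (¬ a ~ c × ¬ v ~ r) ⊎ (a ~ c × r ≢ a × r ≢ c)
        kind′ = Data.Sum.map (λ (a≁c , _) → a≁c , v≁r) (λ (a~c , _) → a~c , (λ { refl → R∩P r∈ (first∈ rim) }) , r≢c) kind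

-- Solids through three neighbours of a vertex

nested-prefixes : {A : Set} → ∀ (xs zs : List A) {ys ws} → xs ++ ys ≡ zs ++ ws →
                  (∀ {z} → z ∈ xs → z ∈ zs) ⊎ (∀ {z} → z ∈ zs → z ∈ xs)
nested-prefixes [] zs e = inj₁ λ ()
nested-prefixes (x ∷ xs) [] e = inj₂ λ ()
nested-prefixes (x ∷ xs) (z ∷ zs) e with ∷-injective e
... | refl , e′ = Data.Sum.map under under (nested-prefixes xs zs e′)
  where
  under : ∀ {as bs} → (∀ {w} → w ∈ as → w ∈ bs) → ∀ {w} → w ∈ x ∷ as → w ∈ x ∷ bs
  under f (here e) = here e
  under f (there w∈) = there (f w∈)

module _ (G : Graph (Fin n)) where
  open Graph G

  private
    V : Set
    V = Fin n

  attach-vertex : ∀ {v a b l} → Hole G v a b l → ∀ {c y} → v ~ c → c ∉ l → ¬ a ~ c →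
                  y ∈ l → c ~ y → y ≢ a → y ≢ b →
                  SolidWith G (v ∷ a ∷ b ∷ c ∷ []) (λ z → z ≡ v ⊎ z ∈ c ∷ [] ⊎ z ∈ l)
  attach-vertex h {c} {y} v~c c∉ a≁c y∈ c~y y≢a y≢b =
    attach G h (single c) v~c (λ { (here refl) → ~-irrefl refl v~c }) (λ { (here e) _ → e })
      (λ { (here refl) → c∉ }) (λ { (here e) _ _ → inj₁ e })
      (y , y∈ , c~y , y≢a) (inj₁ (a≁c , y , y∈ , c~y , y≢b))

  LinkedBy : Pred V 0ℓ → V → V → Set
  LinkedBy D a b = ∃[ l ] Chordless G a b l × (∀ {z} → z ∈ l → z ≡ a ⊎ D z ⊎ z ≡ b)

  SolidThrough : V → Pred V 0ℓ → V → V → V → Set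
  SolidThrough v D a b c = SolidWith G (v ∷ a ∷ b ∷ c ∷ []) (λ z → z ∈ v ∷ a ∷ b ∷ c ∷ [] ⊎ D z)

  permute : ∀ {v D a b c a′ b′ c′} → All (_∈ v ∷ a′ ∷ b′ ∷ c′ ∷ []) (v ∷ a ∷ b ∷ c ∷ []) →
            All (_∈ v ∷ a ∷ b ∷ c ∷ []) (v ∷ a′ ∷ b′ ∷ c′ ∷ []) → SolidThrough v D a b c → SolidThrough v D a′ b′ c′
  permute f g s = weaken G s g (Data.Sum.map (All.lookup f) id)

  swap-ab : ∀ {v D a b c} → SolidThrough v D a b c → SolidThrough v D b a c
  swap-ab = permute (here refl ∷ here₂ refl ∷ here₁ refl ∷ here₃ refl ∷ []) (here refl ∷ here₂ refl ∷ here₁ refl ∷ here₃ refl ∷ [])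

  swap-bc : ∀ {v D a b c} → SolidThrough v D a b c → SolidThrough v D a c b
  swap-bc = permute (here refl ∷ here₁ refl ∷ here₃ refl ∷ here₂ refl ∷ []) (here refl ∷ here₁ refl ∷ here₃ refl ∷ here₂ refl ∷ [])

  module _ {v : V} {D : Pred V 0ℓ} (D≁v : ∀ {z} → D z → ¬ v ~ z) (v∉D : ¬ D v) where

    private
      S[_,_,_] : V → V → V → Set
      S[_,_,_] = SolidThrough v D

      within : ∀ {L a b z} → a ∈ L → b ∈ L → z ≡ a ⊎ D z ⊎ z ≡ b → z ∈ L ⊎ D z
      within a∈ b∈ = [ (λ { refl → inj₁ a∈ }) , [ inj₂ , (λ { refl → inj₁ b∈ }) ]′ ]′

      off : ∀ {a b c l} → v ~ c → c ≢ a → c ≢ b → (∀ {z} → z ∈ l → z ≡ a ⊎ D z ⊎ z ≡ b) → c ∉ l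
      off v~c c≢a c≢b l⊆ c∈ = [ c≢a , [ (λ d → D≁v d v~c) , c≢b ]′ ]′ (l⊆ c∈)

    linked-hole : ∀ {a b l} → v ~ a → v ~ b → a ≢ b → Chordless G a b l →
                  (∀ {z} → z ∈ l → z ≡ a ⊎ D z ⊎ z ≡ b) → Hole G v a b l
    linked-hole v~a v~b a≢b p l⊆ = record
      { rim = p ; v∉ = λ v∈ → [ ~⇒≢ {G = G} v~a , [ v∉D , ~⇒≢ {G = G} v~b ]′ ]′ (l⊆ v∈)
      ; v~a = v~a ; v~b = v~b ; a≢b = a≢b
      ; only = λ z∈ v~z → [ inj₁ , [ (λ d → ⊥-elim (D≁v d v~z)) , inj₂ ]′ ]′ (l⊆ z∈) }

    -- The apex of the pyramid is `a`: the link between `b` and `c` closes up to a hole through `v`,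
    -- on which `a` sees `v`, `b` and `c`.
    hub : ∀ {a b c} → v ~ a → v ~ b → v ~ c → a ≢ b → a ≢ c → b ≢ c → a ~ b → a ~ c →
          LinkedBy D b c → S[ a , b , c ]
    hub v~a v~b v~c a≢b a≢c b≢c a~b a~c (l , p , l⊆) = solidWith G
      (pyramid G (linked-hole v~b v~c b≢c p l⊆)
        (λ { (here refl) → ~-irrefl refl v~a ; (there a∈) → off v~a a≢b a≢c l⊆ a∈ })
        (here refl) (there (first∈ p)) (there (last∈ p))
        (~⇒≢ {G = G} v~b) (~⇒≢ {G = G} v~c) b≢c (~-sym v~a) a~b a~c)
      (here₁ refl ∷ here refl ∷ there (there (first∈ p)) ∷ there (there (last∈ p)) ∷ [])
      (inj₁ (here₁ refl) ∷ inj₁ (here refl) ∷ All.tabulate (within (here₂ refl) (here₃ refl) ∘ l⊆))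

    module _ {c : V} (v~c : v ~ c) {r lR} (R : Chordless G c r lR) (R⊆ : ∀ {z} → z ∈ lR → z ≡ c ⊎ D z) where

      private
        end∉R : ∀ {a} → v ~ a → a ≢ c → a ∉ lR
        end∉R v~a a≢c a∈ = [ a≢c , (λ d → D≁v d v~a) ]′ (R⊆ a∈)

        v∉R : v ∉ lR
        v∉R v∈ = [ ~⇒≢ {G = G} v~c , v∉D ]′ (R⊆ v∈)

        only-c : ∀ {z} → z ∈ lR → v ~ z → z ≡ c
        only-c z∈ v~z = [ id , (λ d → ⊥-elim (D≁v d v~z)) ]′ (R⊆ z∈)

        attach-to : ∀ {a b lP} → v ~ a → v ~ b → a ≢ b → Chordless G a b lP → (∀ {z} → z ∈ lP → z ≡ a ⊎ D z ⊎ z ≡ b) →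
                    (∀ {z} → z ∈ lR → z ∉ lP) →
                    (∀ {y z} → y ∈ lR → z ∈ lP → y ~ z → y ≡ r ⊎ (z ≡ a × y ≡ c)) →
                    ∃[ z ] z ∈ lP × r ~ z × z ≢ a →
                    (¬ a ~ c × ∃[ z ] z ∈ lP × r ~ z × z ≢ b) ⊎ (a ~ c × ¬ r ~ a) → S[ a , b , c ]
        attach-to v~a v~b a≢b P P⊆ R∩P touch z₁ kind = weaken G
          (attach G (linked-hole v~a v~b a≢b P P⊆) R v~c v∉R only-c R∩P touch z₁ kind)
          (All.tabulate id)
          [ (λ { refl → inj₁ (here refl) }) , [ Data.Sum.map (λ { refl → here₃ refl }) id ∘ R⊆ , within (here₁ refl) (here₂ refl) ∘ P⊆ ]′ ]′

        -- The path R followed by the part of the a-b path behind its last neighbour of r.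
        extend : ∀ {a b lP} → Chordless G a b lP → (∀ {z} → z ∈ lP → z ≡ a ⊎ D z ⊎ z ≡ b) →
                 (∀ {z} → z ∈ lR → z ∉ lP) → (∀ {y z} → y ∈ lR → z ∈ lP → z ≢ a → y ~ z → y ≡ r) →
                 ∃[ z ] z ∈ lP × z ≢ a × r ~ z →
                 ∃[ m ] Chordless G c b (lR ++ m) × a ∉ m × (∀ {z} → z ∈ lR ++ m → z ≡ c ⊎ D z ⊎ z ≡ b)
        extend {a} {b} P P⊆ R∩P touch (z₀ , z₀∈ , z₀≢a , r~z₀)
          with last-part G (λ z → ¬? (z Fin.≟ a) ×-dec r ~? z) P (lose z₀∈ (z₀≢a , r~z₀))
        ... | u , m , M , m⊆ , (u≢a , r~u) , last , a∈⇒ = m , join G R M r~u cross , a∉m , Rm⊆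
          where
          a∉m : a ∉ m
          a∉m a∈ = u≢a (sym (a∈⇒ a∈))
          cross : ∀ {s t} → s ∈ lR → t ∈ m → s ≢ t × (s ~ t → s ≡ r × t ≡ u)
          cross {s} {t} s∈ t∈ = (λ { refl → R∩P s∈ (m⊆ t∈) }) , f
            where
            t≢a : t ≢ a
            t≢a refl = a∉m t∈
            f : s ~ t → s ≡ r × t ≡ u
            f s~t with touch s∈ (m⊆ t∈) t≢a s~t
            ... | refl = refl , last t∈ (t≢a , s~t)
          Rm⊆ : ∀ {z} → z ∈ lR ++ m → z ≡ c ⊎ D z ⊎ z ≡ b
          Rm⊆ z∈ with ∈-++⁻ lR z∈
          ... | inj₁ z∈R = Data.Sum.map id inj₁ (R⊆ z∈R)
          ... | inj₂ z∈m = [ (λ { refl → ⊥-elim (a∉m z∈m) }) , inj₂ ]′ (P⊆ (m⊆ z∈m))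

        -- The roles change: the hole runs through `v`, `c` and `b`, and `a` is the vertex attached
        -- to it. As `a` is adjacent to neither `b` nor `c`, its neighbour `y` is an inner vertex of
        -- the path.
        touching : ∀ {a b l y} → v ~ a → v ~ b → a ≢ b → a ≢ c → b ≢ c → ¬ a ~ b → ¬ a ~ c →
                   Chordless G c b l → a ∉ l → (∀ {z} → z ∈ l → z ≡ c ⊎ D z ⊎ z ≡ b) →
                   y ∈ l → a ~ y → S[ a , b , c ]
        touching v~a v~b a≢b a≢c b≢c a≁b a≁c p a∉ l⊆ y∈ a~y = weaken G
          (attach-vertex (linked-hole v~c v~b (b≢c ∘ sym) p l⊆) v~a a∉ (a≁c ∘ ~-sym)
            y∈ a~y (λ { refl → a≁c a~y }) (λ { refl → a≁b a~y }))
          (here refl ∷ here₃ refl ∷ here₂ refl ∷ here₁ refl ∷ [])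
          [ (λ { refl → inj₁ (here refl) }) , [ (λ { (here refl) → inj₁ (here₁ refl) }) , within (here₃ refl) (here₂ refl) ∘ l⊆ ]′ ]′

        -- Since `b` has no neighbour on `R`, only `r` sees the a-b path off `a`. So `R` extends to
        -- an induced path from `c` to `b` that avoids `a` but contains a neighbour of `a`.
        one-touches : ∀ {a b lP} → v ~ a → v ~ b → a ≢ b → a ≢ c → b ≢ c → ¬ a ~ b → ¬ a ~ c →
                      Chordless G a b lP → (∀ {z} → z ∈ lP → z ≡ a ⊎ D z ⊎ z ≡ b) → (∀ {z} → z ∈ lR → z ∉ lP) →
                      (∀ {y z} → y ∈ lR → z ∈ lP → z ≢ a → z ≢ b → y ~ z → y ≡ r) →
                      ∃[ z ] z ∈ lP × z ≢ a × r ~ z → Any (a ~_) lR → ¬ Any (b ~_) lR → S[ a , b , c ]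
        one-touches {a} {b} {lP} v~a v~b a≢b a≢c b≢c a≁b a≁c P P⊆ R∩P touch z₀ q ¬q
          with find q | extend P P⊆ R∩P touch′ z₀
          where
          touch′ : ∀ {y z} → y ∈ lR → z ∈ lP → z ≢ a → y ~ z → y ≡ r
          touch′ {z = z} y∈ z∈ z≢a y~z with z Fin.≟ b
          ... | yes refl = ⊥-elim (¬q (lose y∈ (~-sym y~z)))
          ... | no z≢b = touch y∈ z∈ z≢a z≢b y~z
        ... | y , y∈ , a~y | m , Rm , a∉m , Rm⊆ =
          touching v~a v~b a≢b a≢c b≢c a≁b a≁c Rm (λ a∈ → [ end∉R v~a a≢c , a∉m ]′ (∈-++⁻ lR a∈)) Rm⊆ (∈-++⁺ˡ y∈) a~y

        -- Here the path from `c` to `b` is the prefix of `R` up to the first neighbour of `b`,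
        -- followed by `b`.
        prefix-touches : ∀ {a b m w y} → v ~ a → v ~ b → a ≢ b → a ≢ c → b ≢ c → ¬ a ~ b → ¬ a ~ c →
                         Chordless G c w m → (∀ {z} → z ∈ m → z ∈ lR) → b ~ w →
                         (∀ {z} → z ∈ m → b ~ z → z ≡ w) → y ∈ m → a ~ y → S[ a , b , c ]
        prefix-touches {a} {b} {m} v~a v~b a≢b a≢c b≢c a≁b a≁c M m⊆ b~w first y∈ a~y =
          touching v~a v~b a≢b a≢c b≢c a≁b a≁c
            (snoc M (~-sym b~w) (end∉R v~b b≢c ∘ m⊆) (λ z∈ z~b → first z∈ (~-sym z~b)))
            (λ a∈ → [ end∉R v~a a≢c ∘ m⊆ , (λ { (here e) → a≢b e }) ]′ (∈-++⁻ m a∈))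
            (λ z∈ → [ Data.Sum.map id inj₁ ∘ R⊆ ∘ m⊆ , (λ { (here e) → inj₂ (inj₂ e) }) ]′ (∈-++⁻ m z∈))
            (∈-++⁺ˡ y∈) a~y

        both-touch : ∀ {a b} → v ~ a → v ~ b → a ≢ b → a ≢ c → b ≢ c → ¬ a ~ b → ¬ a ~ c → ¬ b ~ c →
                     Any (a ~_) lR → Any (b ~_) lR → S[ a , b , c ]
        both-touch {a} {b} v~a v~b a≢b a≢c b≢c a≁b a≁c b≁c qa qb
          with first-part G (a ~?_) R qa | first-part G (b ~?_) R qb
        ... | w , m , _ , M , e , a~w , firsta | w′ , m′ , _ , M′ , e′ , b~w′ , firstb =
          [ (λ m⊆m′ → prefix-touches v~a v~b a≢b a≢c b≢c a≁b a≁c M′ (λ z∈ → subst (_ ∈_) (sym e′) (∈-++⁺ˡ z∈))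
                        b~w′ firstb (m⊆m′ (last∈ M)) a~w)
          , (λ m′⊆m → swap-ab (prefix-touches v~b v~a (a≢b ∘ sym) b≢c a≢c (a≁b ∘ ~-sym) b≁c M
                        (λ z∈ → subst (_ ∈_) (sym e) (∈-++⁺ˡ z∈)) a~w firsta (m′⊆m (last∈ M′)) b~w′)) ]′
          (nested-prefixes m m′ (trans (sym e) e′))

      -- If a or b has neighbours on R, it is attached to a hole through c and the other
      -- one; if both have, this is done for the one that is met first along R.
      attach-apart : ∀ {a b lP} → v ~ a → v ~ b → a ≢ b → a ≢ c → b ≢ c → ¬ a ~ b → ¬ a ~ c → ¬ b ~ c →
                     Chordless G a b lP → (∀ {z} → z ∈ lP → z ≡ a ⊎ D z ⊎ z ≡ b) →
                     (∀ {z} → z ∈ lR → ¬ (z ∈ lP × z ≢ a × z ≢ b)) →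
                     (∀ {y z} → y ∈ lR → z ∈ lP → z ≢ a → z ≢ b → y ~ z → y ≡ r) →
                     ∃[ z ] z ∈ lP × z ≢ a × z ≢ b × r ~ z → S[ a , b , c ]
      attach-apart {a} {b} {lP} v~a v~b a≢b a≢c b≢c a≁b a≁c b≁c P P⊆ R∩T touch (z₀ , z₀∈ , z₀≢a , z₀≢b , r~z₀)
        with Any.any? (a ~?_) lR | Any.any? (b ~?_) lR
      ... | yes qa | yes qb = both-touch v~a v~b a≢b a≢c b≢c a≁b a≁c b≁c qa qb
      ... | yes qa | no ¬qb =
        one-touches v~a v~b a≢b a≢c b≢c a≁b a≁c P P⊆
          (λ z∈ z∈P → R∩T z∈ (z∈P , (λ { refl → end∉R v~a a≢c z∈ }) , λ { refl → end∉R v~b b≢c z∈ }))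
          touch (z₀ , z₀∈ , z₀≢a , r~z₀) qa ¬qb
      ... | no ¬qa | yes qb = swap-ab
        (one-touches v~b v~a (a≢b ∘ sym) b≢c a≢c (a≁b ∘ ~-sym) b≁c (rev P)
           ([ inj₂ ∘ inj₂ , [ inj₂ ∘ inj₁ , inj₁ ]′ ]′ ∘ P⊆ ∘ Any.reverse⁻)
           (λ z∈ z∈P → R∩T z∈ (Any.reverse⁻ z∈P , (λ { refl → end∉R v~a a≢c z∈ }) , λ { refl → end∉R v~b b≢c z∈ }))
           (λ y∈ z∈ z≢b z≢a → touch y∈ (Any.reverse⁻ z∈) z≢a z≢b)
           (z₀ , Any.reverse⁺ z₀∈ , z₀≢b , r~z₀) qb ¬qa)
      ... | no ¬qa | no ¬qb =
        attach-to v~a v~b a≢b P P⊆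
          (λ z∈ z∈P → R∩T z∈ (z∈P , (λ { refl → end∉R v~a a≢c z∈ }) , λ { refl → end∉R v~b b≢c z∈ }))
          (λ y∈ z∈ y~z → inj₁ (touch′ y∈ z∈ y~z)) (z₀ , z₀∈ , r~z₀ , z₀≢a) (inj₁ (a≁c , z₀ , z₀∈ , r~z₀ , z₀≢b))
        where
        touch′ : ∀ {y z} → y ∈ lR → z ∈ lP → y ~ z → y ≡ r
        touch′ y∈ z∈ y~z = touch y∈ z∈ (λ { refl → ¬qa (lose y∈ (~-sym y~z)) }) (λ { refl → ¬qb (lose y∈ (~-sym y~z)) }) y~z

      -- If `r` is `c`, then `c` sees `v`, `a` and `z₀` on the hole through `a` and `b`. If `a` has
      -- a neighbour on `R` besides `c`, then `a` sees `v`, `c` and that vertex on a hole through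
      -- `c` and `b`. Both are pyramids; otherwise the edge to `c` is the only contact of `a` with
      -- `R`.
      attach-edge : ∀ {a b lP} → v ~ a → v ~ b → a ≢ b → a ≢ c → b ≢ c → a ~ c →
                    Chordless G a b lP → (∀ {z} → z ∈ lP → z ≡ a ⊎ D z ⊎ z ≡ b) →
                    (∀ {z} → z ∈ lR → ¬ (z ∈ lP × z ≢ a)) →
                    (∀ {y z} → y ∈ lR → z ∈ lP → z ≢ a → y ~ z → y ≡ r) →
                    ∃[ z ] z ∈ lP × z ≢ a × r ~ z → S[ a , b , c ]
      attach-edge {a} {b} {lP} v~a v~b a≢b a≢c b≢c a~c P P⊆ R∩T touch (z₀ , z₀∈ , z₀≢a , r~z₀) with r Fin.≟ c
      ... | yes refl = solidWith G
        (pyramid G (linked-hole v~a v~b a≢b P P⊆)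
           (λ { (here refl) → ~-irrefl refl v~c ; (there c∈) → off v~c (a≢c ∘ sym) (b≢c ∘ sym) P⊆ c∈ })
           (here refl) (there (first∈ P)) (there z₀∈) (~⇒≢ {G = G} v~a)
           (λ { refl → Hole.v∉ (linked-hole v~a v~b a≢b P P⊆) z₀∈ }) (z₀≢a ∘ sym) (~-sym v~c) (~-sym a~c) r~z₀)
        (here₁ refl ∷ there (there (first∈ P)) ∷ there (there (last∈ P)) ∷ here refl ∷ [])
        (inj₁ (here₃ refl) ∷ inj₁ (here refl) ∷ All.tabulate (within (here₁ refl) (here₂ refl) ∘ P⊆))
      ... | no r≢c = by (Any.any? (λ y → ¬? (y Fin.≟ c) ×-dec a ~? y) lR)
        where
        R∩P : ∀ {z} → z ∈ lR → z ∉ lP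
        R∩P z∈ z∈P = R∩T z∈ (z∈P , λ { refl → end∉R v~a a≢c z∈ })
        by : Dec (Any (λ y → y ≢ c × a ~ y) lR) → S[ a , b , c ]
        by (no ¬q) = attach-to v~a v~b a≢b P P⊆ R∩P touch′ (z₀ , z₀∈ , r~z₀ , z₀≢a)
          (inj₂ (a~c , λ r~a → ¬q (lose (last∈ R) (r≢c , ~-sym r~a))))
          where
          touch′ : ∀ {y z} → y ∈ lR → z ∈ lP → y ~ z → y ≡ r ⊎ (z ≡ a × y ≡ c)
          touch′ {y} {z} y∈ z∈ y~z with z Fin.≟ a | y Fin.≟ c
          ... | no z≢a | _ = inj₁ (touch y∈ z∈ z≢a y~z)
          ... | yes refl | yes refl = inj₂ (refl , refl)
          ... | yes refl | no y≢c = ⊥-elim (¬q (lose y∈ (y≢c , ~-sym y~z)))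
        by (yes q) with find q | extend P P⊆ R∩P touch (z₀ , z₀∈ , z₀≢a , r~z₀)
        ... | y , y∈ , y≢c , a~y | m , Rm , a∉m , Rm⊆ = solidWith G
          (pyramid G (linked-hole v~c v~b (b≢c ∘ sym) Rm Rm⊆)
             (λ { (here refl) → ~-irrefl refl v~a ; (there a∈) → [ end∉R v~a a≢c , a∉m ]′ (∈-++⁻ lR a∈) })
             (here refl) (there (first∈ Rm)) (there (∈-++⁺ˡ y∈)) (~⇒≢ {G = G} v~c)
             (λ { refl → v∉R y∈ }) (y≢c ∘ sym) (~-sym v~a) a~c a~y)
          (here₁ refl ∷ here refl ∷ there (there (last∈ Rm)) ∷ there (there (first∈ Rm)) ∷ [])
          (inj₁ (here₁ refl) ∷ inj₁ (here refl) ∷ All.tabulate (within (here₃ refl) (here₂ refl) ∘ Rm⊆))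

    module _ (D-conn : ∀ {y z} → D y → D z → Walk G D y z) where

      private
        link : ∀ {a b} → Touches G D a → Touches G D b → Walk G (λ z → D z ⊎ z ≡ b) a b
        link (d , dd , a~d) (e , de , b~e) =
          (a~d , inj₁ dd) ◅ Star.map (λ (s~t , dt) → s~t , inj₁ dt) (D-conn dd de) ◅◅ (~-sym b~e , inj₂ refl) ◅ ε

      linkedBy : ∀ {a b} → Touches G D a → Touches G D b → LinkedBy D a b
      linkedBy a-D b-D = shorten G (link a-D b-D)

      module _ {a b c : V} (v~a : v ~ a) (v~b : v ~ b) (v~c : v ~ c) (a≢b : a ≢ b) (a≢c : a ≢ c) (b≢c : b ≢ c) where

        -- Only `a` is excluded from the target: its edge to `c` does not count as reaching the
        -- path, whereas contact with `b` does.
        one-edge : Touches G D a → Touches G D b → Touches G D c → a ~ c → S[ a , b , c ]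
        one-edge a-D b-D c-D a~c with linkedBy a-D b-D
        ... | lP , P , P⊆ with approach G {T = λ z → z ∈ lP × z ≢ a} (λ z → z ∈? lP ×-dec ¬? (z Fin.≟ a))
                                 (link c-D b-D) (last∈ P , a≢b ∘ sym)
                                 (λ (c∈ , _) → off v~c (a≢c ∘ sym) (b≢c ∘ sym) P⊆ c∈)
        ...   | r , lR , R , R⊆ , R∩T , (z₀ , (z₀∈ , z₀≢a) , r~z₀) , touch =
          attach-edge v~c R (λ z∈ → Data.Sum.map id [ id , (λ { refl → ⊥-elim (R∩T z∈ (last∈ P , a≢b ∘ sym)) }) ]′ (R⊆ z∈))
            v~a v~b a≢b a≢c b≢c a~c P P⊆ R∩T (λ y∈ z∈ z≢a y~z → touch y∈ (_ , (z∈ , z≢a) , y~z)) (z₀ , z₀∈ , z₀≢a , r~z₀)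

        -- Both ends are excluded from the target, so it has to be nonempty and reachable: as `a`
        -- and `b` are not adjacent, the vertex after `a` on the path lies in `D`, and `D` is
        -- connected.
        no-edge : Touches G D a → Touches G D b → Touches G D c → ¬ a ~ b → ¬ a ~ c → ¬ b ~ c → S[ a , b , c ]
        no-edge a-D b-D (d , dd , c~d) a≁b a≁c b≁c with linkedBy a-D b-D
        ... | lP , P , P⊆ with second P a≢b
        ...   | p , p∈ , a~p with approach G {T = λ z → z ∈ lP × z ≢ a × z ≢ b}
                                   (λ z → z ∈? lP ×-dec ¬? (z Fin.≟ a) ×-dec ¬? (z Fin.≟ b))
                                   ((c~d , dd) ◅ D-conn dd (inner (P⊆ p∈)))
                                   (p∈ , ~⇒≢ {G = G} a~p ∘ sym , λ { refl → a≁b a~p })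
                                   (λ (c∈ , _) → off v~c (a≢c ∘ sym) (b≢c ∘ sym) P⊆ c∈)
          where
          inner : p ≡ a ⊎ D p ⊎ p ≡ b → D p
          inner = [ (λ { refl → ⊥-elim (~-irrefl refl a~p) }) , [ id , (λ { refl → ⊥-elim (a≁b a~p) }) ]′ ]′
        ...     | r , lR , R , R⊆ , R∩T , (z₀ , (z₀∈ , z₀≢a , z₀≢b) , r~z₀) , touch =
          attach-apart v~c R R⊆ v~a v~b a≢b a≢c b≢c a≁b a≁c b≁c P P⊆ R∩T
            (λ y∈ z∈ z≢a z≢b y~z → touch y∈ (_ , (z∈ , z≢a , z≢b) , y~z)) (z₀ , z₀∈ , z₀≢a , z₀≢b , r~z₀)

      -- The number of edges among the three neighbours decides: with two or more, one of the three
      -- is a hub; with fewer, two are joined through `D` and a path from the third is attached.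
      three-neighbours : ∀ {a b c} → v ~ a → v ~ b → v ~ c → a ≢ b → a ≢ c → b ≢ c →
                         Touches G D a → Touches G D b → Touches G D c → S[ a , b , c ]
      three-neighbours {a} {b} {c} v~a v~b v~c a≢b a≢c b≢c a-D b-D c-D with a ~? b | a ~? c | b ~? c
      ... | yes a~b | yes a~c | _ = hub v~a v~b v~c a≢b a≢c b≢c a~b a~c (linkedBy b-D c-D)
      ... | yes a~b | no _ | yes b~c = swap-ab
        (hub v~b v~a v~c (a≢b ∘ sym) b≢c a≢c (~-sym a~b) b~c (linkedBy a-D c-D))
      ... | no _ | yes a~c | yes b~c = swap-bc (swap-ab
        (hub v~c v~a v~b (a≢c ∘ sym) (b≢c ∘ sym) a≢b (~-sym a~c) (~-sym b~c) (linkedBy a-D b-D)))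
      ... | no _ | yes a~c | no _ = one-edge v~a v~b v~c a≢b a≢c b≢c a-D b-D c-D a~c
      ... | yes a~b | no _ | no _ = swap-bc (one-edge v~a v~c v~b a≢c a≢b (b≢c ∘ sym) a-D c-D b-D a~b)
      ... | no _ | no _ | yes b~c = swap-ab (one-edge v~b v~a v~c (a≢b ∘ sym) b≢c a≢c b-D a-D c-D b~c)
      ... | no a≁b | no a≁c | no b≁c = no-edge v~a v~b v~c a≢b a≢c b≢c a-D b-D c-D a≁b a≁c b≁c

  Beyond : V → Subset n → Pred V 0ℓ
  Beyond v U z = z ∈ˢ U × z ≢ v × ¬ v ~ z

-- Induced cycles as holes

tabulate-chordless : {H : Graph A} → let open Graph H in ∀ {m} (f : Fin (suc m) → A) →
  (∀ {i j} → f i ≡ f j → i ≡ j) → (∀ i → f (inject₁ i) ~ f (suc i)) →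
  (∀ i j → f i ~ f j → toℕ j ≡ suc (toℕ i) ⊎ toℕ i ≡ suc (toℕ j)) →
  Chordless H (f zero) (f (fromℕ m)) (tabulate f)
tabulate-chordless {m = zero} f inj step chord = single _
tabulate-chordless {H = H} {m = suc m} f inj step chord =
  cons (step zero) f0∉ only
    (tabulate-chordless {H = H} (f ∘ suc) (suc-injective ∘ inj) (step ∘ suc)
      (λ i j e → Data.Sum.map ℕ.suc-injective ℕ.suc-injective (chord (suc i) (suc j) e)))
  where
  open Graph H
  f0∉ : f zero ∉ tabulate (f ∘ suc)
  f0∉ f0∈ with ∈-tabulate⁻ {f = f ∘ suc} f0∈
  ... | i , e with inj e
  ...   | ()
  only : ∀ {w} → w ∈ tabulate (f ∘ suc) → f zero ~ w → w ≡ f (suc zero)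
  only w∈ e with ∈-tabulate⁻ {f = f ∘ suc} w∈
  ... | j , refl with chord zero (suc j) e
  ...   | inj₁ e′ = cong (f ∘ suc) (toℕ-injective (ℕ.suc-injective e′))

-- All edges of the graph are edges of its cycle, so removing the first vertex of the cycle leaves a
-- path without chords.
cycle⇒hole : {H : Graph A} → IsCycle H → ∃[ v ] ∃[ a ] ∃[ b ] ∃[ l ] Hole H v a b l × (∀ z → z ∈ v ∷ l)
cycle⇒hole {H = H} (record { path = record { len = suc (suc k) ; at = at ; injective = inj ; step = step
                                    ; start = refl ; end = refl } ; 2≤len = s≤s (s≤s _) ; close = y~x } , verts , edges) =
  _ , _ , _ , _ , record
    { rim = tabulate-chordless {H = H} (at ∘ suc) (suc-injective ∘ inj) (step ∘ suc) chord
    ; v∉ = v∉ ; v~a = step zero ; v~b = ~-sym y~x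
    ; a≢b = λ e → a≢b (inj e) ; only = λ z∈ → only (∈-tabulate⁻ {f = at ∘ suc} z∈) }
  , all
  where
  open Graph H
  edge-of : ∀ {u v} → u ~ v → _
  edge-of {u} {v} = Equivalence.to (edges u v)
  a≢b : Fin.suc Fin.zero ≢ suc (suc (fromℕ k))
  a≢b ()
  v∉ : at zero ∉ tabulate (at ∘ suc)
  v∉ v∈ with ∈-tabulate⁻ {f = at ∘ suc} v∈
  ... | i , e with inj e
  ...   | ()
  index : ∀ {l i j} → inject₁ l ≡ Fin.suc i → Fin.suc l ≡ suc j → toℕ j ≡ suc (toℕ i)
  index {l} e refl = trans (sym (toℕ-inject₁ l)) (cong toℕ e)
  chord : ∀ i j → at (suc i) ~ at (suc j) → toℕ j ≡ suc (toℕ i) ⊎ toℕ i ≡ suc (toℕ j)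
  chord i j e with edge-of e
  ... | inj₁ (l , inj₁ (e₁ , e₂)) = inj₁ (index (inj e₁) (inj e₂))
  ... | inj₁ (l , inj₂ (e₁ , e₂)) = inj₂ (index (inj e₁) (inj e₂))
  ... | inj₂ (inj₁ (e₁ , _)) with inj e₁
  ...   | ()
  chord i j e | inj₂ (inj₂ (_ , e₂)) with inj e₂
  ...   | ()
  only : ∀ {z} → ∃[ j ] z ≡ at (suc j) → at zero ~ z → z ≡ at (suc zero) ⊎ z ≡ at (suc (suc (fromℕ k)))
  only (j , refl) e with edge-of e
  ... | inj₁ (zero , inj₁ (_ , e₂)) = inj₁ (sym e₂)
  ... | inj₁ (suc l , inj₁ (e₁ , _)) with inj e₁
  ...   | ()
  only (j , refl) e | inj₁ (l , inj₂ (_ , e₂)) with inj e₂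
  ...   | ()
  only (j , refl) e | inj₂ (inj₁ (_ , e₂)) = inj₂ e₂
  only (j , refl) e | inj₂ (inj₂ (_ , e₂)) with inj e₂
  ...   | ()
  all : ∀ z → z ∈ at zero ∷ tabulate (at ∘ suc)
  all z with verts z
  ... | zero , refl = here refl
  ... | suc i , refl = there (∈-tabulate⁺ {f = at ∘ suc} i)

module _ {G : Graph (Fin n)} where
  open Graph G

  private
    lower-∈ : ∀ {S : Subset n} {z : ∃[ v ] v ∈ˢ S} {l} → proj₁ z ∈ map proj₁ l → z ∈ l
    lower-∈ {l = l} z∈ with ∈-map⁻ proj₁ z∈
    ... | y , y∈ , e = subst (_∈ l) (sym (vertex-≡ G e)) y∈

  lower-chordless : ∀ {S : Subset n} {x y l} → Chordless (G [ S ]) x y l →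
                    Chordless G (proj₁ x) (proj₁ y) (map proj₁ l)
  lower-chordless (single x) = single _
  lower-chordless {S} (cons {x} {y} {l = l} x~y x∉ only p) = cons x~y (x∉ ∘ lower-∈) only′ (lower-chordless p)
    where
    only′ : ∀ {w} → w ∈ map proj₁ l → proj₁ x ~ w → w ≡ proj₁ y
    only′ w∈ x~w with ∈-map⁻ proj₁ w∈
    ... | w′ , w′∈ , refl = cong proj₁ (only w′∈ x~w)

  lower-hole : ∀ {S : Subset n} {v a b l} → Hole (G [ S ]) v a b l →
               Hole G (proj₁ v) (proj₁ a) (proj₁ b) (map proj₁ l)
  lower-hole {l = l} h = record
    { rim = lower-chordless rim ; v∉ = v∉ ∘ lower-∈ ; v~a = v~a ; v~b = v~b
    ; a≢b = a≢b ∘ vertex-≡ G ; only = λ z∈ → only′ (∈-map⁻ proj₁ z∈) }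
    where
    open Hole h
    only′ : ∀ {z} → ∃[ y ] y ∈ l × z ≡ proj₁ y → _ → _
    only′ (y , y∈ , refl) v~z = Data.Sum.map (cong proj₁) (cong proj₁) (only y∈ v~z)

  rotate : ∀ {v a b l} → Hole G v a b (a ∷ l) → ∃[ y ] Hole G a y v (l ∷ʳ v)
  rotate {l = l} record { rim = single _ ; a≢b = a≢b } = ⊥-elim (a≢b refl)
  rotate {v} {a} {b} {l} record { rim = cons {y = y} a~y a∉ only-y p ; v∉ = v∉ ; v~a = v~a ; v~b = v~b ; a≢b = a≢b ; only = only } =
    y , record
      { rim = snoc p (~-sym v~b) (v∉ ∘ there) only-b
      ; v∉ = a∉′ ; v~a = a~y ; v~b = ~-sym v~a ; a≢b = λ { refl → v∉ (there (first∈ p)) } ; only = only′ }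
    where
    only-b : ∀ {w} → w ∈ l → w ~ v → w ≡ b
    only-b w∈ w~v with only (there w∈) (~-sym w~v)
    ... | inj₁ refl = ⊥-elim (a∉ w∈)
    ... | inj₂ e = e
    a∉′ : a ∉ l ∷ʳ v
    a∉′ a∈ with ∈-++⁻ l a∈
    ... | inj₁ a∈l = a∉ a∈l
    ... | inj₂ (here e) = ~⇒≢ {G = G} v~a (sym e)
    only′ : ∀ {z} → z ∈ l ∷ʳ v → a ~ z → z ≡ y ⊎ z ≡ v
    only′ z∈ a~z with ∈-++⁻ l z∈
    ... | inj₁ z∈l = inj₁ (only-y z∈l a~z)
    ... | inj₂ (here e) = inj₂ e

  -- The opening vertex is moved to the back of the list until the wanted vertex is in front; the
  -- recursion is on `m`, the part still ahead.
  rotate-to : ∀ {v a b} m rest → Hole G v a b (m ++ rest) → ∀ {z} → z ∈ m →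
              ∃[ p ] ∃[ q ] ∃[ l ] Hole G z p q l × (∀ {w} → w ∈ z ∷ l → w ∈ v ∷ m ++ rest) ×
              (∀ {w} → w ∈ v ∷ m ++ rest → w ∈ z ∷ l)
  rotate-to {v} {a} (x ∷ m) rest h z∈ with starts (Hole.rim h)
    where
    starts : ∀ {x y z l} → Chordless G x y (z ∷ l) → x ≡ z
    starts (single _) = refl
    starts (cons _ _ _ _) = refl
  ... | refl with rotate h
  ...   | y , h′ = go z∈
    where
    forth : ∀ {w} → w ∈ v ∷ a ∷ m ++ rest → w ∈ a ∷ (m ++ rest) ∷ʳ v
    forth (here e) = there (∈-++⁺ʳ (m ++ rest) (here e))
    forth (here₁ e) = here e
    forth (there (there w∈)) = there (∈-++⁺ˡ w∈)
    back : ∀ {w} → w ∈ a ∷ (m ++ rest) ∷ʳ v → w ∈ v ∷ a ∷ m ++ rest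
    back (here e) = here₁ e
    back (there w∈) with ∈-++⁻ (m ++ rest) w∈
    ... | inj₁ w∈′ = there (there w∈′)
    ... | inj₂ (here e) = here e
    assoc : (m ++ rest) ∷ʳ v ≡ m ++ (rest ∷ʳ v)
    assoc = ++-assoc m rest (v ∷ [])
    go : ∀ {z} → z ∈ a ∷ m → ∃[ p ] ∃[ q ] ∃[ l ] Hole G z p q l ×
         (∀ {w} → w ∈ z ∷ l → w ∈ v ∷ a ∷ m ++ rest) × (∀ {w} → w ∈ v ∷ a ∷ m ++ rest → w ∈ z ∷ l)
    go (here refl) = _ , _ , _ , h′ , back , forth
    go (there z∈m) with rotate-to m (rest ∷ʳ v) (subst (Hole G a y v) assoc h′) z∈m
    ... | p , q , l , h″ , to , from =
      p , q , l , h″ , back ∘ subst (λ k → _ ∈ a ∷ k) (sym assoc) ∘ to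
      , from ∘ subst (λ k → _ ∈ a ∷ k) assoc ∘ forth

module _ (G : Graph (Fin n)) where
  open Graph G

  record CycleAt (S : Subset n) (v : Fin n) : Set where
    field
      {a b}   : Fin n
      {l}     : List (Fin n)
      hole    : Hole G v a b l
      covers  : ∀ {z} → z ∈ˢ S → z ∈ v ∷ l
      covers⁻ : ∀ {z} → z ∈ v ∷ l → z ∈ˢ S
    open Hole hole public

  cycleAt : ∀ {S v} → InducedCycle G S → v ∈ˢ S → CycleAt S v
  cycleAt {S} {v} cyc v∈ with cycle⇒hole cyc
  ... | (u , u∈) , a , b , l , h , all = by (to v∈)
    where
    to : ∀ {z} → z ∈ˢ S → z ∈ u ∷ map proj₁ l
    to {z} z∈ with all (z , z∈)
    ... | here e = here (cong proj₁ e)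
    ... | there z∈l = there (∈-map⁺ proj₁ z∈l)
    from : ∀ {z} → z ∈ u ∷ map proj₁ l → z ∈ˢ S
    from (here refl) = u∈
    from (there z∈) with ∈-map⁻ proj₁ z∈
    ... | (_ , y∈) , _ , refl = y∈
    by : v ∈ u ∷ map proj₁ l → CycleAt S v
    by (here refl) = record { hole = lower-hole h ; covers = to ; covers⁻ = from }
    by (there v∈l) with rotate-to (map proj₁ l) [] (subst (Hole G u _ _) (sym (++-identityʳ _)) (lower-hole h)) v∈l
      where open import Data.List.Properties using (++-identityʳ)
    ... | p , q , k , h′ , f , g = record
      { hole = h′ ; covers = g ∘ subst (λ k → _ ∈ u ∷ k) (sym (++-identityʳ _)) ∘ to
      ; covers⁻ = from ∘ subst (λ k → _ ∈ u ∷ k) (++-identityʳ _) ∘ f }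
      where open import Data.List.Properties using (++-identityʳ)

  flip : ∀ {S v} → CycleAt S v → CycleAt S v
  flip c = record
    { hole = record
        { rim = rev rim ; v∉ = v∉ ∘ Any.reverse⁻ ; v~a = v~b ; v~b = v~a ; a≢b = a≢b ∘ sym
        ; only = λ z∈ v~z → Data.Sum.swap (only (Any.reverse⁻ z∈) v~z) }
    ; covers = λ z∈ → to (covers z∈) ; covers⁻ = λ { (here refl) → covers⁻ (here refl) ; (there z∈) → covers⁻ (there (Any.reverse⁻ z∈)) } }
    where
    open CycleAt c
    to : ∀ {u z} → z ∈ u ∷ l → z ∈ u ∷ reverse l
    to (here e) = here e
    to (there z∈) = there (Any.reverse⁺ z∈)

  cycle-nbrs : ∀ {S v} (c : CycleAt S v) → ∀ {z} → z ∈ˢ S → v ~ z → z ≡ CycleAt.a c ⊎ z ≡ CycleAt.b c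
  cycle-nbrs c z∈ v~z with CycleAt.covers c z∈
  ... | here refl = ⊥-elim (~-irrefl refl v~z)
  ... | there z∈l = CycleAt.only c z∈l v~z

  two-nbrs : ∀ {S v p q} → InducedCycle G S → v ∈ˢ S → p ∈ˢ S → q ∈ˢ S → p ≢ q → v ~ p → v ~ q →
             ∀ {z} → z ∈ˢ S → v ~ z → z ≡ p ⊎ z ≡ q
  two-nbrs {v = v} cyc v∈ p∈ q∈ p≢q v~p v~q z∈ v~z with cycleAt cyc v∈
  ... | c with cycle-nbrs c p∈ v~p | cycle-nbrs c q∈ v~q | cycle-nbrs c z∈ v~z
  ... | inj₁ refl | inj₁ refl | _ = ⊥-elim (p≢q refl)
  ... | inj₂ refl | inj₂ refl | _ = ⊥-elim (p≢q refl)
  ... | inj₁ refl | inj₂ refl | e = e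
  ... | inj₂ refl | inj₁ refl | inj₁ e = inj₂ e
  ... | inj₂ refl | inj₁ refl | inj₂ e = inj₁ e

  -- Every vertex of the hole has two neighbours on the hole, and these are its only neighbours in
  -- `S`. So the hole is closed under adjacency in `S`, and walking around the cycle never leaves
  -- it.
  cycle-minimal : ∀ {S v a b l} → InducedCycle G S → Hole G v a b l → (∀ {z} → z ∈ v ∷ l → z ∈ˢ S) →
                  ∀ {z} → z ∈ˢ S → z ∈ v ∷ l
  cycle-minimal {S} {v} {l = l} cyc h h⊆ z∈ with cycleAt cyc (h⊆ (here refl))
  ... | c = spread (CycleAt.covers c z∈)
    where
    closed : ∀ {y z} → y ∈ v ∷ l → z ∈ˢ S → y ~ z → z ∈ v ∷ l
    closed y∈ z∈ y~z with hole-deg≥2 G h y∈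
    ... | p , q , p≢q , p∈ , q∈ , y~p , y~q with two-nbrs cyc (h⊆ y∈) (h⊆ p∈) (h⊆ q∈) p≢q y~p y~q z∈ y~z
    ...   | inj₁ refl = p∈
    ...   | inj₂ refl = q∈
    along : ∀ {x y k} → Chordless G x y k → (∀ {z} → z ∈ k → z ∈ˢ S) → x ∈ v ∷ l → ∀ {z} → z ∈ k → z ∈ v ∷ l
    along (single _) _ x∈ (here refl) = x∈
    along (cons _ _ _ _) _ x∈ (here refl) = x∈
    along (cons x~y _ _ p) k⊆ x∈ (there z∈) =
      along p (k⊆ ∘ there) (closed x∈ (k⊆ (there (first∈ p))) x~y) z∈
    open CycleAt c using (rim; v~a; covers⁻)
    spread : ∀ {z} → z ∈ v ∷ CycleAt.l c → z ∈ v ∷ l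
    spread (here e) = here e
    spread (there z∈) = along rim (covers⁻ ∘ there) (closed (here refl) (covers⁻ (there (first∈ rim))) v~a) z∈

  loop : ∀ {x l z} → Chordless G x x l → z ∈ l → z ≡ x
  loop (single _) (here e) = e
  loop (cons _ x∉ _ p) _ = ⊥-elim (x∉ (last∈ p))

  walk-sym : ∀ {D x y} → D x → Walk G D x y → Walk G D y x
  walk-sym dx ε = ε
  walk-sym dx ((x~y , dy) ◅ ws) = walk-sym dy ws ◅◅ (~-sym x~y , dx) ◅ ε

  walk-along : ∀ {x y l z} → Chordless G x y l → z ∈ l → z ≢ y → Walk G (λ w → w ∈ l × w ≢ y) x z
  walk-along (single _) (here refl) _ = ε
  walk-along (cons _ _ _ _) (here refl) _ = ε
  walk-along (cons x~y _ _ p) (there z∈) z≢ =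
    (x~y , there (first∈ p) , λ { refl → z≢ (loop p z∈) })
    ◅ Star.map (λ { (e , w∈ , w≢) → e , there w∈ , w≢ }) (walk-along p z∈ z≢)

  NonNbr : Subset n → Fin n → Pred (Fin n) 0ℓ
  NonNbr S x z = z ∈ˢ S × z ≢ x × ¬ x ~ z

  private
    inner-root : ∀ {S x t} (c : CycleAt S x) → NonNbr S x t →
            ∃[ y ] NonNbr S x y × CycleAt.a c ~ y × (∀ {z} → NonNbr S x z → Walk G (NonNbr S x) y z)
    inner-root {S} {x} {t} record { a = a ; b = b ; l = l ; hole = record { rim = single _ ; a≢b = a≢b } } _ = ⊥-elim (a≢b refl)
    inner-root {S} {x} {t} c@(record { a = a ; b = b ; covers = covers ; covers⁻ = covers⁻ ; hole = record
      { rim = cons {y = y} {l = l} a~y a∉ only-y p ; v∉ = v∉ ; v~a = v~a ; v~b = v~b ; only = only } }) inner-t =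
      y , inner-y , a~y , λ iz → let z∈ , z≢b = in-tail iz in Star.map widen (walk-along p z∈ z≢b)
      where
      in-tail : ∀ {z} → NonNbr S x z → z ∈ l × z ≢ b
      in-tail (z∈ , z≢x , x≁z) with covers z∈
      ... | here e = ⊥-elim (z≢x e)
      ... | here₁ refl = ⊥-elim (x≁z v~a)
      ... | there (there z∈l) = z∈l , λ { refl → x≁z v~b }
      out : ∀ {z} → z ∈ l → z ≢ b → NonNbr S x z
      out {z} z∈ z≢b = covers⁻ (there (there z∈)) , (λ { refl → v∉ (there z∈) }) , x≁z
        where
        x≁z : ¬ x ~ z
        x≁z x~z with only (there z∈) x~z
        ... | inj₁ refl = a∉ z∈
        ... | inj₂ e = z≢b e
      widen : ∀ {s z} → s ~ z × z ∈ l × z ≢ b → s ~ z × NonNbr S x z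
      widen (e , z∈ , z≢b) = e , out z∈ z≢b
      inner-y : NonNbr S x y
      inner-y = out (first∈ p) (λ { refl → proj₂ (in-tail inner-t) (loop p (proj₁ (in-tail inner-t))) })

  -- What remains of a cycle without `x` and its neighbours is a path. The remainders of two cycles
  -- later form the set `D` of `three-neighbours`.
  cycle-connected : ∀ {S x} → InducedCycle G S → x ∈ˢ S → ∀ {y z} → NonNbr S x y → NonNbr S x z →
                    Walk G (NonNbr S x) y z
  cycle-connected cyc x∈ iy iz with inner-root (cycleAt cyc x∈) iy
  ... | r , ir , _ , walk = walk-sym ir (walk iy) ◅◅ walk iz

  cycle-touches : ∀ {S x t c} → InducedCycle G S → x ∈ˢ S → NonNbr S x t → c ∈ˢ S → x ~ c →
                  Touches G (NonNbr S x) c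
  cycle-touches cyc x∈ it c∈ x~c with cycleAt cyc x∈
  ... | k with cycle-nbrs k c∈ x~c
  ...   | inj₁ refl = let r , ir , e , _ = inner-root k it in r , ir , e
  ...   | inj₂ refl = let r , ir , e , _ = inner-root (flip k) it in r , ir , e

-- Counting cycles and solids

module _ {A : Set} where

  count : {P : Pred A 0ℓ} → Decidable P → List A → ℕ
  count P? xs = length (filter P? xs)

  module _ {P Q R : Pred A 0ℓ} (P? : Decidable P) (Q? : Decidable Q) (R? : Decidable R) where

    count-⊎ : ∀ xs → (∀ {x} → x ∈ xs → P x → Q x ⊎ R x) → count P? xs ≤ count Q? xs + count R? xs
    count-⊎ [] f = z≤n
    count-⊎ (x ∷ xs) f with P? x | Q? x | R? x | count-⊎ xs (f ∘ there)
    ... | no _  | no _  | no _  | rec = rec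
    ... | no _  | no _  | yes _ | rec = ℕ.≤-trans (ℕ.m≤n⇒m≤1+n rec) (ℕ.≤-reflexive (sym (ℕ.+-suc _ _)))
    ... | no _  | yes _ | no _  | rec = ℕ.m≤n⇒m≤1+n rec
    ... | no _  | yes _ | yes _ | rec = ℕ.m≤n⇒m≤1+n (ℕ.≤-trans (ℕ.m≤n⇒m≤1+n rec) (ℕ.≤-reflexive (sym (ℕ.+-suc _ _))))
    ... | yes _ | yes _ | no _  | rec = s≤s rec
    ... | yes _ | yes _ | yes _ | rec = s≤s (ℕ.≤-trans (ℕ.m≤n⇒m≤1+n rec) (ℕ.≤-reflexive (sym (ℕ.+-suc _ _))))
    ... | yes _ | no _  | yes _ | rec = ℕ.≤-trans (s≤s rec) (ℕ.≤-reflexive (sym (ℕ.+-suc _ _)))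
    ... | yes p | no ¬q | no ¬r | _ = ⊥-elim ([ ¬q , ¬r ]′ (f (here refl) p))

    count-⊎⁻ : ∀ xs → (∀ {x} → x ∈ xs → Q x → P x) → (∀ {x} → x ∈ xs → R x → P x) →
               (∀ {x} → x ∈ xs → Q x → ¬ R x) → count Q? xs + count R? xs ≤ count P? xs
    count-⊎⁻ [] f g d = z≤n
    count-⊎⁻ (x ∷ xs) f g d with P? x | Q? x | R? x | count-⊎⁻ xs (f ∘ there) (g ∘ there) (d ∘ there)
    ... | no _  | no _  | no _  | rec = rec
    ... | yes _ | no _  | no _  | rec = ℕ.m≤n⇒m≤1+n rec
    ... | yes _ | no _  | yes _ | rec = ℕ.≤-trans (ℕ.≤-reflexive (ℕ.+-suc _ _)) (s≤s rec)
    ... | yes _ | yes _ | no _  | rec = s≤s rec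
    ... | _     | yes q | yes r | _ = ⊥-elim (d (here refl) q r)
    ... | no ¬p | yes q | no _  | _ = ⊥-elim (¬p (f (here refl) q))
    ... | no ¬p | no _  | yes r | _ = ⊥-elim (¬p (g (here refl) r))

  module _ {P Q : Pred A 0ℓ} (P? : Decidable P) (Q? : Decidable Q) where

    count-mono : ∀ xs → (∀ {x} → x ∈ xs → P x → Q x) → count P? xs ≤ count Q? xs
    count-mono [] f = z≤n
    count-mono (x ∷ xs) f with P? x | Q? x | count-mono xs (f ∘ there)
    ... | no _  | no _  | rec = rec
    ... | no _  | yes _ | rec = ℕ.m≤n⇒m≤1+n rec
    ... | yes _ | yes _ | rec = s≤s rec
    ... | yes p | no ¬q | _ = ⊥-elim (¬q (f (here refl) p))

  module _ {P : Pred A 0ℓ} (P? : Decidable P) where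

    count≡0 : ∀ xs → (∀ {x} → x ∈ xs → ¬ P x) → count P? xs ≡ 0
    count≡0 [] f = refl
    count≡0 (x ∷ xs) f with P? x
    ... | yes p = ⊥-elim (f (here refl) p)
    ... | no _  = count≡0 xs (f ∘ there)

    count>0 : ∀ {xs x} → x ∈ xs → P x → 1 ≤ count P? xs
    count>0 x∈ px = ∈-length (∈-filter⁺ P? x∈ px)

    count⇒∃ : ∀ xs → count P? xs ≡ 0 ⊎ ∃[ x ] x ∈ xs × P x
    count⇒∃ xs with Any.any? P? xs
    ... | yes q = inj₂ (let x , x∈ , px = find q in x , x∈ , px)
    ... | no ¬q = inj₁ (count≡0 xs (λ x∈ px → ¬q (lose x∈ px)))

    count≤1 : ∀ xs → Unique xs → (∀ {x y} → x ∈ xs → y ∈ xs → P x → P y → x ≡ y) → count P? xs ≤ 1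
    count≤1 [] u f = z≤n
    count≤1 (x ∷ xs) (x≢ ∷ u) f with P? x
    ... | no _  = count≤1 xs u (λ x∈ y∈ → f (there x∈) (there y∈))
    ... | yes p = s≤s (ℕ.≤-reflexive (count≡0 xs
                    (λ y∈ py → All.lookup x≢ y∈ (f (here refl) (there y∈) p py))))

infixl 6 _∖_
abstract
  _∖_ : Subset n → Fin n → Subset n
  U ∖ c = sub (λ z → z ∈ˢ? U ×-dec ¬? (z Fin.≟ c))

  ∈-∖⁺ : ∀ {U : Subset n} {c z} → z ∈ˢ U → z ≢ c → z ∈ˢ U ∖ c
  ∈-∖⁺ {U = U} {c} z∈ z≢c = ∈-sub⁺ (λ z → z ∈ˢ? U ×-dec ¬? (z Fin.≟ c)) (z∈ , z≢c)

  ∈-∖⁻ : ∀ {U : Subset n} {c z} → z ∈ˢ U ∖ c → z ∈ˢ U × z ≢ c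
  ∈-∖⁻ {U = U} {c} = ∈-sub⁻ (λ z → z ∈ˢ? U ×-dec ¬? (z Fin.≟ c))

infixl 6 _∖*_
abstract
  _∖*_ : Subset n → List (Fin n) → Subset n
  U ∖* l = sub (λ z → z ∈ˢ? U ×-dec ¬? (z ∈? l))

  ∈-∖*⁺ : ∀ {U : Subset n} {l z} → z ∈ˢ U → z ∉ l → z ∈ˢ U ∖* l
  ∈-∖*⁺ {U = U} {l} z∈ z∉ = ∈-sub⁺ (λ z → z ∈ˢ? U ×-dec ¬? (z ∈? l)) (z∈ , z∉)

  ∈-∖*⁻ : ∀ {U : Subset n} {l z} → z ∈ˢ U ∖* l → z ∈ˢ U × z ∉ l
  ∈-∖*⁻ {U = U} {l} = ∈-sub⁻ (λ z → z ∈ˢ? U ×-dec ¬? (z ∈? l))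

∖-⊂ : ∀ {U : Subset n} {c} → c ∈ˢ U → U ∖ c ⊂ U
∖-⊂ c∈ = proj₁ ∘ ∈-∖⁻ , _ , c∈ , λ c∈′ → proj₂ (∈-∖⁻ c∈′) refl

-- One enumeration of the cycles or solids of the whole graph is filtered by intervals of vertex
-- sets. Thus `hi` plays the induced subgraph, `lo` the vertices that must be used, and membership
-- in an interval is decidable.
record Between (lo : List (Fin n)) (hi S : Subset n) : Set where
  constructor between
  field
    lo⊆ : ∀ {z} → z ∈ lo → z ∈ˢ S
    ⊆hi : ∀ {z} → z ∈ˢ S → z ∈ˢ hi

between? : ∀ (lo : List (Fin n)) hi → Decidable (Between lo hi)
between? lo hi S = map′ to from (All.all? (_∈ˢ? S) lo ×-dec S ⊆? hi)
  where
  to : All (_∈ˢ S) lo × S ⊆ hi → Between lo hi S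
  to (a , s) = between (All.lookup a) s
  from : Between lo hi S → All (_∈ˢ S) lo × S ⊆ hi
  from (between a s) = All.tabulate a , s

abstract
  cnt : List (Subset n) → List (Fin n) → Subset n → ℕ
  cnt L lo hi = count (between? lo hi) L

module _ (L : List (Subset n)) where

  abstract
    -- The set form of Pascal's rule, on which the counting recursions rest. It holds for every `c`:
    -- if `c` lies in `lo`, no set avoids it, and if it lies outside `hi`, no set contains it.
    cnt-split : ∀ lo hi c → cnt L lo hi ≡ cnt L (c ∷ lo) hi + cnt L lo (hi ∖ c)
    cnt-split lo hi c = ℕ.≤-antisym
      (count-⊎ (between? lo hi) (between? (c ∷ lo) hi) (between? lo (hi ∖ c)) L (λ _ → case))
      (count-⊎⁻ (between? lo hi) (between? (c ∷ lo) hi) (between? lo (hi ∖ c)) L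
        (λ { _ (between l h) → between (l ∘ there) h })
        (λ { _ (between l h) → between l (proj₁ ∘ ∈-∖⁻ ∘ h) })
        (λ { _ (between l h) (between l′ h′) → proj₂ (∈-∖⁻ (h′ (l (here refl)))) refl }))
      where
      case : ∀ {S} → Between lo hi S → Between (c ∷ lo) hi S ⊎ Between lo (hi ∖ c) S
      case {S} (between l h) with c ∈ˢ? S
      ... | yes c∈ = inj₁ (between (λ { (here refl) → c∈ ; (there z∈) → l z∈ }) h)
      ... | no c∉ = inj₂ (between l (λ z∈ → ∈-∖⁺ (h z∈) (λ { refl → c∉ z∈ })))

    cnt-mono : ∀ {lo lo′ hi hi′} → (∀ {S} → S ∈ L → Between lo hi S → Between lo′ hi′ S) →
               cnt L lo hi ≤ cnt L lo′ hi′
    cnt-mono = count-mono (between? _ _) (between? _ _) L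

    cnt≡0 : ∀ {lo hi} → (∀ {S} → S ∈ L → ¬ Between lo hi S) → cnt L lo hi ≡ 0
    cnt≡0 = count≡0 (between? _ _) L

    cnt-full : cnt L [] full ≡ length L
    cnt-full = cong length (filter-all (between? [] full) {xs = L} (All.tabulate (λ _ → between (λ ()) (λ _ → ∈⊤))))

    cnt⇒∃ : ∀ lo hi → cnt L lo hi ≡ 0 ⊎ ∃[ S ] S ∈ L × Between lo hi S
    cnt⇒∃ lo hi = count⇒∃ (between? lo hi) L

    cnt>0 : ∀ {lo hi S} → S ∈ L → Between lo hi S → 1 ≤ cnt L lo hi
    cnt>0 = count>0 (between? _ _)

    cnt≤1 : ∀ {lo hi} → Unique L → (∀ {S T} → S ∈ L → T ∈ L → Between lo hi S → Between lo hi T → S ≡ T) →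
            cnt L lo hi ≤ 1
    cnt≤1 = count≤1 (between? _ _) L

-- Solids from branching cycles

module _ (G : Graph (Fin n)) where
  open Graph G

  -- A set of minimum degree 2 cannot leave a path whose inner vertices have no
  -- further neighbours in hi.
  follow : ∀ {S hi : Subset n} → Deg≥2 G (_∈ˢ S) → (∀ {z} → z ∈ˢ S → z ∈ˢ hi) →
           ∀ {y b l} p → Chordless G y b l → y ∈ˢ S →
           (∀ {x z} → x ∈ l → x ≢ b → z ∈ˢ hi → x ~ z → z ∈ l ⊎ (z ≡ p × x ≡ y)) →
           ∀ {z} → z ∈ l → z ∈ˢ S
  follow deg S⊆ p (single _) y∈ inv (here refl) = y∈
  follow deg S⊆ p (cons _ _ _ _) y∈ inv (here refl) = y∈
  follow {S} deg S⊆ p (cons {y} {y′} {b} {l} y~y′ y∉ only c) y∈ inv (there z∈) =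
    follow deg S⊆ y c y′∈ inv′ z∈
    where
    nbr : ∀ {z} → z ∈ˢ S → y ~ z → z ≡ y′ ⊎ z ≡ p
    nbr z∈ y~z with inv (here refl) (λ { refl → y∉ (last∈ c) }) (S⊆ z∈) y~z
    ... | inj₁ (here refl) = ⊥-elim (~-irrefl refl y~z)
    ... | inj₁ (there z∈l) = inj₁ (only z∈l y~z)
    ... | inj₂ (e , _) = inj₂ e
    y′∈ : y′ ∈ˢ S
    y′∈ with deg y∈
    ... | s , t , s≢t , s∈ , t∈ , y~s , y~t with nbr s∈ y~s | nbr t∈ y~t
    ...   | inj₁ refl | _ = s∈
    ...   | _ | inj₁ refl = t∈
    ...   | inj₂ refl | inj₂ refl = ⊥-elim (s≢t refl)
    inv′ : ∀ {x z} → x ∈ l → x ≢ b → z ∈ˢ _ → x ~ z → z ∈ l ⊎ (z ≡ y × x ≡ y′)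
    inv′ x∈ x≢b z∈ x~z with inv (there x∈) x≢b z∈ x~z
    ... | inj₁ (here refl) = inj₂ (refl , only x∈ (~-sym x~z))
    ... | inj₁ (there z∈l) = inj₁ z∈l
    ... | inj₂ (_ , refl) = ⊥-elim (y∉ x∈)

  -- A cycle or solid inside `hi` can leave the path `T` only at its ends `x` and `b`.
  Closed : Fin n → Fin n → List (Fin n) → Subset n → Set
  Closed x b T hi = ∀ {z w} → z ∈ T → z ≢ x → z ≢ b → w ∈ˢ hi → z ~ w → w ∈ T

  -- A solid through x and its neighbours on T, S₁ and S₂; it contains T by follow.
  branching : ∀ {x b T hi S₁ S₂ c} → Chordless G x b T → x ≢ b → ¬ x ~ b → Closed x b T hi →
              InducedCycle G S₁ → InducedCycle G S₂ → Between T hi S₁ → Between T hi S₂ →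
              c ∈ˢ S₁ → c ∉ T → x ~ c → c ∉ˢ S₂ →
              ∃[ S ] ∃[ c′ ] Solid G S × Between (c ∷ T) hi S × c′ ∈ˢ S × c′ ≢ c × x ~ c′ × c′ ∉ T
  branching (single _) x≢b = ⊥-elim (x≢b refl)
  branching {x} {b} {hi = hi} {S₁} {S₂} {c} (cons {y = t} {l = T} x~t x∉ only p) x≢b x≁b closed
            cyc₁ cyc₂ (between T⊆₁ ⊆hi₁) (between T⊆₂ ⊆hi₂) c∈ c∉ x~c c∉₂
    with second p (λ { refl → x≁b x~t }) | other
    where
    x∈₂ : x ∈ˢ S₂
    x∈₂ = T⊆₂ (here refl)
    other : ∃[ c′ ] c′ ∈ˢ S₂ × x ~ c′ × c′ ≢ t
    other with cycleAt G cyc₂ x∈₂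
    ... | k with CycleAt.a k Fin.≟ t
    ...   | no a≢t = _ , CycleAt.covers⁻ k (there (first∈ (CycleAt.rim k))) , CycleAt.v~a k , a≢t
    ...   | yes refl = _ , CycleAt.covers⁻ k (there (last∈ (CycleAt.rim k))) , CycleAt.v~b k , CycleAt.a≢b k ∘ sym
  ... | t₂ , t₂∈ , t~t₂ | c′ , c′∈ , x~c′ , c′≢t = S , c′ , solid , between S⊇ S⊆ , contains (here₃ refl) , c′≢c , x~c′ , c′∉
    where
    c′≢c : c′ ≢ c
    c′≢c refl = c∉₂ c′∈
    c′∉ : c′ ∉ x ∷ T
    c′∉ (here refl) = ~-irrefl refl x~c′
    c′∉ (there c′∈T) = c′≢t (only c′∈T x~c′)
    -- The two cycles without `x` and its neighbours. Each remainder is connected and contains `t₂`,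
    -- the vertex of `T` behind `t`, so their union is connected.
    D : Pred (Fin n) 0ℓ
    D z = NonNbr G S₁ x z ⊎ NonNbr G S₂ x z
    x≁t₂ : ¬ x ~ t₂
    x≁t₂ x~t₂ = ~⇒≢ {G = G} t~t₂ (sym (only t₂∈ x~t₂))
    t₂≢x : t₂ ≢ x
    t₂≢x refl = x∉ t₂∈
    n₁ : NonNbr G S₁ x t₂
    n₁ = T⊆₁ (there t₂∈) , t₂≢x , x≁t₂
    n₂ : NonNbr G S₂ x t₂
    n₂ = T⊆₂ (there t₂∈) , t₂≢x , x≁t₂
    to : ∀ {z} → D z → Walk G D t₂ z
    to (inj₁ d) = Star.map (λ { (e , d) → e , inj₁ d }) (cycle-connected G cyc₁ (T⊆₁ (here refl)) n₁ d)
    to (inj₂ d) = Star.map (λ { (e , d) → e , inj₂ d }) (cycle-connected G cyc₂ (T⊆₂ (here refl)) n₂ d)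
    D-conn : ∀ {y z} → D y → D z → Walk G D y z
    D-conn dy dz = walk-sym G (inj₁ n₁) (to dy) ◅◅ to dz
    t₁ : ∀ {u} → u ∈ˢ S₁ → x ~ u → Touches G D u
    t₁ u∈ x~u = let z , d , e = cycle-touches G cyc₁ (T⊆₁ (here refl)) n₁ u∈ x~u in z , inj₁ d , e
    t₂′ : ∀ {u} → u ∈ˢ S₂ → x ~ u → Touches G D u
    t₂′ u∈ x~u = let z , d , e = cycle-touches G cyc₂ (T⊆₂ (here refl)) n₂ u∈ x~u in z , inj₂ d , e
    sol : SolidWith G (x ∷ t ∷ c ∷ c′ ∷ []) (λ z → z ∈ x ∷ t ∷ c ∷ c′ ∷ [] ⊎ D z)
    sol = three-neighbours G (λ { (inj₁ (_ , _ , e)) → e ; (inj₂ (_ , _ , e)) → e })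
      (λ { (inj₁ (_ , e , _)) → e refl ; (inj₂ (_ , e , _)) → e refl }) D-conn
      x~t x~c x~c′ (λ { refl → c∉ (there (first∈ p)) }) (c′≢t ∘ sym) (c′≢c ∘ sym)
      (t₁ (T⊆₁ (there (first∈ p))) x~t) (t₁ c∈ x~c) (t₂′ c′∈ x~c′)
    open SolidWith sol
    S⊆ : ∀ {z} → z ∈ˢ S → z ∈ˢ hi
    S⊆ z∈ with within z∈
    ... | inj₁ (here refl) = ⊆hi₁ (T⊆₁ (here refl))
    ... | inj₁ (here₁ refl) = ⊆hi₁ (T⊆₁ (there (first∈ p)))
    ... | inj₁ (here₂ refl) = ⊆hi₁ c∈
    ... | inj₁ (here₃ refl) = ⊆hi₂ c′∈
    ... | inj₂ (inj₁ (z∈₁ , _)) = ⊆hi₁ z∈₁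
    ... | inj₂ (inj₂ (z∈₂ , _)) = ⊆hi₂ z∈₂
    inv : ∀ {y z} → y ∈ T → y ≢ b → z ∈ˢ hi → y ~ z → z ∈ T ⊎ (z ≡ x × y ≡ t)
    inv y∈ y≢b z∈ y~z with closed (there y∈) (λ { refl → x∉ y∈ }) y≢b z∈ y~z
    ... | here refl = inj₂ (refl , only y∈ (~-sym y~z))
    ... | there z∈T = inj₁ z∈T
    S⊇ : ∀ {z} → z ∈ c ∷ x ∷ T → z ∈ˢ S
    S⊇ (here refl) = contains (here₂ refl)
    S⊇ (here₁ refl) = contains (here refl)
    S⊇ (there (there z∈)) = follow deg≥2 S⊆ x p (contains (here₁ refl)) inv z∈

  module _ {Cs Ss : List (Subset n)} (Cs-unique : Unique Cs)
           (Cs-complete : ∀ S → S ∈ Cs ⇔ InducedCycle G S) (Ss-complete : ∀ S → S ∈ Ss ⇔ Solid G S) where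

    private
      cyc : ∀ {S} → S ∈ Cs → InducedCycle G S
      cyc = Equivalence.to (Cs-complete _)

    -- By `cycle-minimal`, any two cycles that contain the hole have the same vertices.
    unique-cycle : ∀ {v a b l lo hi} → Hole G v a b l → (∀ {z} → z ∈ v ∷ l → z ∈ lo) → cnt Cs lo hi ≤ 1
    unique-cycle {v} {l = l} h ⊆lo = cnt≤1 Cs Cs-unique λ { S∈ T∈ (between lo⊆S _) (between lo⊆T _) →
      ⊆-antisym (lo⊆T ∘ ⊆lo ∘ cycle-minimal G (cyc S∈) h (lo⊆S ∘ ⊆lo))
                (lo⊆S ∘ ⊆lo ∘ cycle-minimal G (cyc T∈) h (lo⊆T ∘ ⊆lo)) }

    -- Induction along the extensions of the path T at x: splitting both counts
    -- on a neighbour c of x, the two bounds for the cycles with and without c add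
    -- up to one too much, which is compensated by the solid from branching.
    cycles≤1+solids : ∀ {x b T} hi → Acc _<_ ∣ hi ∖* T ∣ → Chordless G x b T → x ≢ b → ¬ x ~ b → (∀ {z} → z ∈ T → z ∈ˢ hi) →
                      Closed x b T hi → cnt Cs T hi ≤ suc (cnt Ss T hi)
    cycles≤1+solids hi _ (single _) x≢b = ⊥-elim (x≢b refl)
    cycles≤1+solids {x} {b} {T} hi (acc rs) ch@(cons {y = t} x~t x∉ only p) x≢b x≁b T⊆ closed
      with any? (λ c → c ∈ˢ? hi ×-dec ¬? (c ∈? T) ×-dec x ~? c)
    -- Within `hi` the vertex `x` has no neighbour other than `t`, so no cycle passes through it.
    ... | no ¬c = ℕ.≤-trans (ℕ.≤-reflexive (cnt≡0 Cs none)) z≤n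
      where
      none : ∀ {S} → S ∈ Cs → ¬ Between T hi S
      none S∈ (between T⊆S S⊆) = CycleAt.a≢b k (trans (is-t a∈ (CycleAt.v~a k)) (sym (is-t b∈ (CycleAt.v~b k))))
        where
        k : CycleAt G _ x
        k = cycleAt G (cyc S∈) (T⊆S (here refl))
        is-t : ∀ {z} → z ∈ˢ _ → x ~ z → z ≡ t
        is-t {z} z∈ x~z with z ∈? T
        ... | yes (here refl) = ⊥-elim (~-irrefl refl x~z)
        ... | yes (there z∈T) = only z∈T x~z
        ... | no z∉ = ⊥-elim (¬c (z , S⊆ z∈ , z∉ , x~z))
        a∈ = CycleAt.covers⁻ k (there (first∈ (CycleAt.rim k)))
        b∈ = CycleAt.covers⁻ k (there (last∈ (CycleAt.rim k)))
    ... | yes (c , c∈ , c∉ , x~c) = begin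
      cnt Cs T hi                               ≡⟨ cnt-split Cs T hi c ⟩
      cnt Cs (c ∷ T) hi + cnt Cs T (hi ∖ c)     ≤⟨ merge (cnt⇒∃ Cs (c ∷ T) hi) (cnt⇒∃ Cs T (hi ∖ c)) ⟩
      suc (cnt Ss (c ∷ T) hi + cnt Ss T (hi ∖ c)) ≡⟨ cong suc (sym (cnt-split Ss T hi c)) ⟩
      suc (cnt Ss T hi) ∎
      where
      open ℕ.≤-Reasoning
      -- A cycle through `c` and `T` meets no neighbours of `x` other than `t` and `c`. Deleting the
      -- others from `hi` loses no such cycle and makes `x` an inner vertex without side exits on
      -- the longer path that starts in `c`.
      keep? : Decidable (λ z → z ∈ˢ hi × (z ∈ c ∷ T ⊎ ¬ x ~ z))
      keep? z = z ∈ˢ? hi ×-dec (z ∈? c ∷ T Relation.Nullary.Decidable.⊎-dec ¬? (x ~? z))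
      hi′ : Subset n
      hi′ = sub keep?
      to-hi′ : ∀ {S} → S ∈ Cs → Between (c ∷ T) hi S → Between (c ∷ T) hi′ S
      to-hi′ {S} S∈ (between l h) = between l (λ z∈ → ∈-sub⁺ keep? (h z∈ , near z∈))
        where
        near : ∀ {z} → z ∈ˢ S → z ∈ c ∷ T ⊎ ¬ x ~ z
        near {z} z∈ with x ~? z
        ... | no x≁z = inj₂ x≁z
        ... | yes x~z with two-nbrs G (cyc S∈) (l (here₁ refl)) (l (there (there (first∈ p)))) (l (here refl))
                             (λ { refl → c∉ (there (first∈ p)) }) x~t x~c z∈ x~z
        ...   | inj₁ refl = inj₁ (there (there (first∈ p)))
        ...   | inj₂ refl = inj₁ (here refl)
      left : cnt Cs (c ∷ T) hi ≤ suc (cnt Ss (c ∷ T) hi′)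
      left with c ~? b
      -- The path closes up to a hole through `c`, and no other cycle contains it.
      ... | yes c~b = ℕ.≤-trans (unique-cycle {v = c} (record
          { rim = ch ; v∉ = c∉ ; v~a = ~-sym x~c ; v~b = c~b ; a≢b = x≢b ; only = only-c }) (λ z∈ → z∈)) (s≤s z≤n)
        where
        only-c : ∀ {z} → z ∈ T → c ~ z → z ≡ x ⊎ z ≡ b
        only-c {z} z∈ c~z with z Fin.≟ x | z Fin.≟ b
        ... | yes e | _ = inj₁ e
        ... | _ | yes e = inj₂ e
        ... | no z≢x | no z≢b = ⊥-elim (c∉ (closed z∈ z≢x z≢b c∈ (~-sym c~z)))
      ... | no c≁b = ℕ.≤-trans (cnt-mono Cs to-hi′)
        (cycles≤1+solids hi′ (rs (p⊂q⇒∣p∣<∣q∣ smaller))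
          (cons (~-sym x~c) c∉ only-x ch) (λ { refl → c∉ (last∈ ch) }) c≁b T⊆′ closed′)
        where
        smaller : hi′ ∖* (c ∷ T) ⊂ hi ∖* T
        smaller = (λ z∈ → let z∈hi′ , z∉ = ∈-∖*⁻ z∈ in ∈-∖*⁺ (proj₁ (∈-sub⁻ keep? z∈hi′)) (z∉ ∘ there))
                , c , ∈-∖*⁺ c∈ c∉ , λ c∈′ → proj₂ (∈-∖*⁻ c∈′) (here refl)
        only-x : ∀ {z} → z ∈ T → c ~ z → z ≡ x
        only-x {z} z∈ c~z with z Fin.≟ x | z Fin.≟ b
        ... | yes e | _ = e
        ... | _ | yes refl = ⊥-elim (c≁b c~z)
        ... | no z≢x | no z≢b = ⊥-elim (c∉ (closed z∈ z≢x z≢b c∈ (~-sym c~z)))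
        T⊆′ : ∀ {z} → z ∈ c ∷ T → z ∈ˢ hi′
        T⊆′ (here refl) = ∈-sub⁺ keep? (c∈ , inj₁ (here refl))
        T⊆′ (there z∈) = ∈-sub⁺ keep? (T⊆ z∈ , inj₁ (there z∈))
        closed′ : Closed c b (c ∷ T) hi′
        closed′ (here refl) z≢c _ _ _ = ⊥-elim (z≢c refl)
        closed′ {z} (there z∈) _ z≢b w∈ z~w with z Fin.≟ x
        ... | no z≢x = there (closed z∈ z≢x z≢b (proj₁ (∈-sub⁻ keep? w∈)) z~w)
        ... | yes refl with proj₂ (∈-sub⁻ keep? w∈)
        ...   | inj₁ w∈′ = w∈′
        ...   | inj₂ x≁w = ⊥-elim (x≁w z~w)
      right : cnt Cs T (hi ∖ c) ≤ suc (cnt Ss T (hi ∖ c))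
      right = cycles≤1+solids (hi ∖ c) (rs (p⊂q⇒∣p∣<∣q∣ smaller)) ch x≢b x≁b
        (λ z∈ → ∈-∖⁺ (T⊆ z∈) (λ { refl → c∉ z∈ }))
        (λ z∈ z≢x z≢b w∈ → closed z∈ z≢x z≢b (proj₁ (∈-∖⁻ w∈)))
        where
        smaller : hi ∖ c ∖* T ⊂ hi ∖* T
        smaller = (λ z∈ → let z∈′ , z∉ = ∈-∖*⁻ z∈ in ∈-∖*⁺ (proj₁ (∈-∖⁻ z∈′)) z∉)
                , c , ∈-∖*⁺ c∈ c∉ , λ c∈′ → proj₂ (∈-∖⁻ (proj₁ (∈-∖*⁻ c∈′))) refl
      hi′⇒hi : ∀ {S} → Between (c ∷ T) hi′ S → Between (c ∷ T) hi S
      hi′⇒hi (between l h) = between l (proj₁ ∘ ∈-sub⁻ keep? ∘ h)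
      merge : cnt Cs (c ∷ T) hi ≡ 0 ⊎ ∃[ S ] S ∈ Cs × Between (c ∷ T) hi S →
              cnt Cs T (hi ∖ c) ≡ 0 ⊎ ∃[ S ] S ∈ Cs × Between T (hi ∖ c) S →
              cnt Cs (c ∷ T) hi + cnt Cs T (hi ∖ c) ≤ suc (cnt Ss (c ∷ T) hi + cnt Ss T (hi ∖ c))
      merge (inj₁ e) _ = begin
        cnt Cs (c ∷ T) hi + cnt Cs T (hi ∖ c) ≡⟨ cong (_+ cnt Cs T (hi ∖ c)) e ⟩
        cnt Cs T (hi ∖ c)                     ≤⟨ right ⟩
        suc (cnt Ss T (hi ∖ c))               ≤⟨ s≤s (ℕ.m≤n+m _ _) ⟩
        suc (cnt Ss (c ∷ T) hi + cnt Ss T (hi ∖ c)) ∎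
      merge (inj₂ _) (inj₁ e) = begin
        cnt Cs (c ∷ T) hi + cnt Cs T (hi ∖ c) ≡⟨ cong (cnt Cs (c ∷ T) hi +_) e ⟩
        cnt Cs (c ∷ T) hi + 0                 ≡⟨ ℕ.+-identityʳ _ ⟩
        cnt Cs (c ∷ T) hi                     ≤⟨ left ⟩
        suc (cnt Ss (c ∷ T) hi′)              ≤⟨ s≤s (cnt-mono Ss (λ _ → hi′⇒hi)) ⟩
        suc (cnt Ss (c ∷ T) hi)               ≤⟨ s≤s (ℕ.m≤m+n _ _) ⟩
        suc (cnt Ss (c ∷ T) hi + cnt Ss T (hi ∖ c)) ∎
      merge (inj₂ (S₁ , S₁∈ , between l₁ h₁)) (inj₂ (S₂ , S₂∈ , between l₂ h₂)) = begin
        cnt Cs (c ∷ T) hi + cnt Cs T (hi ∖ c) ≤⟨ ℕ.+-mono-≤ left right ⟩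
        suc (cnt Ss (c ∷ T) hi′) + suc (cnt Ss T (hi ∖ c)) ≤⟨ ℕ.+-monoˡ-≤ _ extra ⟩
        cnt Ss (c ∷ T) hi + suc (cnt Ss T (hi ∖ c)) ≡⟨ ℕ.+-suc _ _ ⟩
        suc (cnt Ss (c ∷ T) hi + cnt Ss T (hi ∖ c)) ∎
        where
        -- The solid from `branching` uses a neighbour `c′` of `x` that `hi′` lacks, so the
        -- recursive count has not included it.
        extra : suc (cnt Ss (c ∷ T) hi′) ≤ cnt Ss (c ∷ T) hi
        extra with branching {S₁ = S₁} {S₂ = S₂} ch x≢b x≁b closed (cyc S₁∈) (cyc S₂∈) (between (l₁ ∘ there) h₁)
                     (between l₂ (proj₁ ∘ ∈-∖⁻ ∘ h₂)) (l₁ (here refl)) c∉ x~c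
                     (λ c∈₂ → proj₂ (∈-∖⁻ (h₂ c∈₂)) refl)
        ... | S , c′ , solid , btw , c′∈ , c′≢c , x~c′ , c′∉ = begin
          suc (cnt Ss (c ∷ T) hi′) ≤⟨ s≤s (cnt-mono Ss avoid) ⟩
          suc (cnt Ss (c ∷ T) (hi ∖ c′)) ≤⟨ ℕ.+-monoˡ-≤ _ (cnt>0 Ss (Equivalence.from (Ss-complete S) solid)
            (between (λ { (here refl) → c′∈ ; (there z∈) → Between.lo⊆ btw z∈ }) (Between.⊆hi btw))) ⟩
          cnt Ss (c′ ∷ c ∷ T) hi + cnt Ss (c ∷ T) (hi ∖ c′) ≡⟨ sym (cnt-split Ss (c ∷ T) hi c′) ⟩
          cnt Ss (c ∷ T) hi ∎
          where
          avoid : ∀ {S} → S ∈ Ss → Between (c ∷ T) hi′ S → Between (c ∷ T) (hi ∖ c′) S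
          avoid _ (between l h) = between l (λ z∈ → ∈-∖⁺ (proj₁ (∈-sub⁻ keep? (h z∈))) λ { refl → out (h z∈) })
            where
            out : ¬ c′ ∈ˢ hi′
            out c′∈′ with proj₂ (∈-sub⁻ keep? c′∈′)
            ... | inj₁ (here e) = c′≢c e
            ... | inj₁ (there c′∈T) = c′∉ c′∈T
            ... | inj₂ x≁c′ = x≁c′ x~c′

abstract
  _choose_ : ℕ → ℕ → ℕ
  n choose k = n Combinatorics.C k

  pascal : ∀ n k → suc n choose suc k ≡ n choose k + n choose suc k
  pascal n k = sym (nCk+nC[k+1]≡[n+1]C[k+1] n k)

  choose-0 : ∀ n → n choose 0 ≡ 1
  choose-0 n = trans (nCk≡nC[n∸k] {0} {n} z≤n) (nCn≡1 n)

  choose-1 : ∀ n → n choose 1 ≡ n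
  choose-1 = nC1≡n

  0-choose : ∀ k → 0 choose suc k ≡ 0
  0-choose k = k>n⇒nCk≡0 {0} {suc k} (s≤s z≤n)

-- Edges, cycles and solids through a linked vertex

module _ (G : Graph (Fin n)) where
  open Graph G

  -- Edges are given by their vertex sets, so that `cnt` applies to them as to cycles and solids.
  IsEdge : Subset n → Set
  IsEdge S = ∃[ u ] ∃[ w ] u ~ w × S ≡ set (u ∷ w ∷ [])

  -- The neighbours of v in hi are those listed in ex and, once each, those in xs.
  record Nbrs (v : Fin n) (U : Subset n) (xs ex : List (Fin n)) (hi : Subset n) : Set where
    field
      unique   : Unique xs
      sound    : ∀ {z} → z ∈ xs → z ∈ˢ hi × v ~ z × z ∉ ex
      ex-sound : ∀ {z} → z ∈ ex → z ∈ˢ hi × v ~ z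
      complete : ∀ {z} → z ∈ˢ hi → v ~ z → z ∈ ex ⊎ z ∈ xs
      v∈       : v ∈ˢ hi
      hi⊆      : ∀ {z} → z ∈ˢ hi → z ∈ˢ U
      core     : ∀ {z} → z ∈ˢ U → ¬ v ~ z → z ∈ˢ hi

  module _ {v U c xs ex hi} (N : Nbrs v U (c ∷ xs) ex hi) where
    open Nbrs N
    private
      c∉xs : c ∉ xs
      c∉xs c∈ with unique
      ... | c≢ ∷ _ = All.lookup c≢ c∈ refl
      uniq : Unique xs
      uniq with unique
      ... | _ ∷ u = u

    -- The branch of `cnt-split` that excludes the neighbour `c`; `move-nbr` is the branch that
    -- requires it. Only neighbours of `v` are ever deleted, which preserves `core`.
    drop-nbr : Nbrs v U xs ex (hi ∖ c)
    drop-nbr = record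
      { unique = uniq
      ; sound = λ z∈ → let z∈hi , v~z , z∉ = sound (there z∈)
                       in ∈-∖⁺ z∈hi (λ { refl → c∉xs z∈ }) , v~z , z∉
      ; ex-sound = λ z∈ → let z∈hi , v~z = ex-sound z∈
                          in ∈-∖⁺ z∈hi (λ { refl → proj₂ (proj₂ (sound (here refl))) z∈ }) , v~z
      ; complete = λ z∈ v~z → let z∈hi , z≢c = ∈-∖⁻ z∈ in
          Data.Sum.map (λ e → e) (λ { (here e) → ⊥-elim (z≢c e) ; (there z∈) → z∈ }) (complete z∈hi v~z)
      ; v∈ = ∈-∖⁺ v∈ (λ { refl → ~-irrefl refl (proj₁ (proj₂ (sound (here refl)))) })
      ; hi⊆ = hi⊆ ∘ proj₁ ∘ ∈-∖⁻
      ; core = λ z∈ v≁z → ∈-∖⁺ (core z∈ v≁z) (λ { refl → v≁z (proj₁ (proj₂ (sound (here refl)))) }) }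

    move-nbr : Nbrs v U xs (c ∷ ex) hi
    move-nbr = record
      { unique = uniq
      ; sound = λ z∈ → let z∈hi , v~z , z∉ = sound (there z∈)
                       in z∈hi , v~z , λ { (here refl) → c∉xs z∈ ; (there z∈ex) → z∉ z∈ex }
      ; ex-sound = λ { (here refl) → let z∈hi , v~z , _ = sound (here refl) in z∈hi , v~z
                     ; (there z∈) → ex-sound z∈ }
      ; complete = λ z∈ v~z → reorder (complete z∈ v~z)
      ; v∈ = v∈ ; hi⊆ = hi⊆ ; core = core }
      where
      reorder : ∀ {z} → z ∈ ex ⊎ z ∈ c ∷ xs → z ∈ c ∷ ex ⊎ z ∈ xs
      reorder (inj₁ z∈) = inj₁ (there z∈)
      reorder (inj₂ (here e)) = inj₁ (here e)
      reorder (inj₂ (there z∈)) = inj₂ z∈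

  module _ {Es : List (Subset n)} (Es-unique : Unique Es) (Es-complete : ∀ S → S ∈ Es ⇔ IsEdge S) where

    degree-edges : ∀ {v U} xs {hi} → Nbrs v U xs [] hi → cnt Es (v ∷ []) hi ≡ length xs
    degree-edges {v} [] {hi} N = cnt≡0 Es none
      where
      open Nbrs N
      none : ∀ {S} → S ∈ Es → ¬ Between (v ∷ []) hi S
      none {S} S∈ (between l h) with Equivalence.to (Es-complete S) S∈
      ... | u , w , u~w , refl with ∈-set⁻ (l (here refl))
      ...   | here refl with complete (h (∈-set⁺ (here₁ refl))) u~w
      ...     | inj₁ ()
      ...     | inj₂ ()
      none {S} S∈ (between l h) | u , w , u~w , refl | here₁ refl with complete (h (∈-set⁺ (here refl))) (~-sym u~w)
      ...     | inj₁ ()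
      ...     | inj₂ ()
    degree-edges {v} (c ∷ xs) {hi} N = trans (cnt-split Es (v ∷ []) hi c)
      (cong₂ _+_ one (degree-edges xs (drop-nbr N)))
      where
      open Nbrs N
      v~c : v ~ c
      v~c = proj₁ (proj₂ (sound (here refl)))
      E : Subset n
      E = set (v ∷ c ∷ [])
      is-E : ∀ {S} → S ∈ Es → Between (c ∷ v ∷ []) hi S → S ≡ E
      is-E {S} S∈ (between l h) with Equivalence.to (Es-complete S) S∈
      ... | u , w , u~w , refl with ∈-set⁻ (l (here refl)) | ∈-set⁻ (l (here₁ refl))
      ...   | here refl | here refl = ⊥-elim (~-irrefl refl v~c)
      ...   | here₁ refl | here₁ refl = ⊥-elim (~-irrefl refl v~c)
      ...   | here₁ refl | here refl = refl
      ...   | here refl | here₁ refl = ⊆-antisym (∈-set⁺ ∘ swap ∘ ∈-set⁻) (∈-set⁺ ∘ swap ∘ ∈-set⁻)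
        where
        swap : ∀ {a b z : Fin n} → z ∈ a ∷ b ∷ [] → z ∈ b ∷ a ∷ []
        swap (here e) = here₁ e
        swap (here₁ e) = here e
      one : cnt Es (c ∷ v ∷ []) hi ≡ 1
      one = ℕ.≤-antisym (cnt≤1 Es Es-unique (λ S∈ T∈ s t → trans (is-E S∈ s) (sym (is-E T∈ t))))
        (cnt>0 Es (Equivalence.from (Es-complete E) (v , c , v~c , refl))
          (between (λ { (here refl) → ∈-set⁺ (here₁ refl) ; (here₁ refl) → ∈-set⁺ (here refl) })
             (λ z∈ → incl (∈-set⁻ z∈))))
        where
        incl : ∀ {z} → z ∈ v ∷ c ∷ [] → z ∈ˢ hi
        incl (here refl) = v∈
        incl (here₁ refl) = proj₁ (sound (here refl))

  record Linked (v : Fin n) (U : Subset n) : Set where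
    field
      linked  : ∀ {a b} → a ∈ˢ U → b ∈ˢ U → v ~ a → v ~ b → a ≢ b → LinkedBy G (Beyond G v U) a b
      linked₃ : ∀ {a b c} → a ∈ˢ U → b ∈ˢ U → c ∈ˢ U → v ~ a → v ~ b → v ~ c → a ≢ b → a ≢ c → b ≢ c →
                SolidThrough G v (Beyond G v U) a b c

  module _ {v U} (L : Linked v U) where
    open Linked L

    module _ {Cs : List (Subset n)} (Cs-complete : ∀ S → S ∈ Cs ⇔ InducedCycle G S) where

      -- Every further neighbour `c` is linked to `a`, which closes a cycle. The cycle contains no
      -- third neighbour of `v`, so by `core` it survives the deletion of the neighbours treated
      -- before.
      cycles-through-nbr : ∀ xs {a hi} → Nbrs v U xs (a ∷ []) hi → length xs ≤ cnt Cs (a ∷ v ∷ []) hi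
      cycles-through-nbr [] N = z≤n
      cycles-through-nbr (c ∷ xs) {a} {hi} N = begin
        suc (length xs)                                          ≤⟨ ℕ.+-mono-≤ one (cycles-through-nbr xs (drop-nbr N)) ⟩
        cnt Cs (c ∷ a ∷ v ∷ []) hi + cnt Cs (a ∷ v ∷ []) (hi ∖ c) ≡⟨ sym (cnt-split Cs (a ∷ v ∷ []) hi c) ⟩
        cnt Cs (a ∷ v ∷ []) hi ∎
        where
        open ℕ.≤-Reasoning
        open Nbrs N
        a∈ = proj₁ (ex-sound (here refl))
        v~a = proj₂ (ex-sound (here refl))
        c∈ = proj₁ (sound (here refl))
        v~c = proj₁ (proj₂ (sound (here refl)))
        c≢a : c ≢ a
        c≢a refl = proj₂ (proj₂ (sound (here refl))) (here refl)
        one : 1 ≤ cnt Cs (c ∷ a ∷ v ∷ []) hi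
        one with linked (hi⊆ c∈) (hi⊆ a∈) v~c v~a c≢a
        ... | l , p , l⊆ = cnt>0 Cs (Equivalence.from (Cs-complete _) (holeCycle G
            (linked-hole G (proj₂ ∘ proj₂) (λ (_ , v≢v , _) → v≢v refl) v~c v~a c≢a p l⊆))) (between
          (λ { (here refl) → ∈-set⁺ (there (first∈ p))
             ; (here₁ refl) → ∈-set⁺ (there (last∈ p))
             ; (here₂ refl) → ∈-set⁺ (here refl) })
          (λ z∈ → incl (∈-set⁻ z∈)))
          where
          incl : ∀ {z} → z ∈ v ∷ l → z ∈ˢ hi
          incl (here refl) = v∈
          incl (there z∈) with l⊆ z∈
          ... | inj₁ refl = c∈
          ... | inj₂ (inj₁ (z∈U , _ , v≁z)) = core z∈U v≁z
          ... | inj₂ (inj₂ refl) = a∈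

      cycles-through : ∀ xs {hi} → Nbrs v U xs [] hi → length xs choose 2 ≤ cnt Cs (v ∷ []) hi
      cycles-through [] N = ℕ.≤-trans (ℕ.≤-reflexive (0-choose 1)) z≤n
      cycles-through (c ∷ xs) {hi} N = begin
        suc (length xs) choose 2                                  ≡⟨ pascal (length xs) 1 ⟩
        length xs choose 1 + length xs choose 2                        ≡⟨ cong (_+ length xs choose 2) (choose-1 (length xs)) ⟩
        length xs + length xs choose 2                            ≤⟨ ℕ.+-mono-≤ (cycles-through-nbr xs (move-nbr N)) (cycles-through xs (drop-nbr N)) ⟩
        cnt Cs (c ∷ v ∷ []) hi + cnt Cs (v ∷ []) (hi ∖ c)    ≡⟨ sym (cnt-split Cs (v ∷ []) hi c) ⟩
        cnt Cs (v ∷ []) hi ∎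
        where open ℕ.≤-Reasoning

    module _ {Cs Ss : List (Subset n)} (Cs-unique : Unique Cs)
             (Cs-complete : ∀ S → S ∈ Cs ⇔ InducedCycle G S) (Ss-complete : ∀ S → S ∈ Ss ⇔ Solid G S) where

      open ℕ.≤-Reasoning

      private
        cyc : ∀ {S} → S ∈ Cs → InducedCycle G S
        cyc = Equivalence.to (Cs-complete _)

      -- A third neighbour `c` of `v` lies on no cycle through `a`, `v`, `b`, but by `linked₃` on a
      -- solid with them. When all such `c` have been split off, `v` has only `a` and `b` left: then
      -- either there is at most a triangle, or `cycles≤1+solids` applies to the path `a`, `v`, `b`.
      solids-on-pair : ∀ xs {a b hi} → a ≢ b → Nbrs v U xs (b ∷ a ∷ []) hi →
                       cnt Cs (b ∷ a ∷ v ∷ []) hi + length xs ≤ suc (cnt Ss (b ∷ a ∷ v ∷ []) hi)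
      solids-on-pair [] {a} {b} {hi} a≢b N with a ~? b
      ... | yes a~b = begin
        cnt Cs (b ∷ a ∷ v ∷ []) hi + 0 ≡⟨ ℕ.+-identityʳ _ ⟩
        cnt Cs (b ∷ a ∷ v ∷ []) hi     ≤⟨ unique-cycle G {Ss = Ss} Cs-unique Cs-complete Ss-complete triangle (λ { (here e) → here₂ e
              ; (here₁ e) → here₁ e ; (here₂ e) → here e }) ⟩
        1                              ≤⟨ s≤s z≤n ⟩
        suc (cnt Ss (b ∷ a ∷ v ∷ []) hi) ∎
        where
        v~ : ∀ {z} → z ∈ b ∷ a ∷ [] → v ~ z
        v~ z∈ = proj₂ (Nbrs.ex-sound N z∈)
        triangle : Hole G v a b (a ∷ b ∷ [])
        triangle = record
          { rim = cons a~b (λ { (here e) → a≢b e }) (λ { (here e) _ → e }) (single b)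
          ; v∉ = λ { (here refl) → ~-irrefl refl (v~ (here₁ refl)) ; (here₁ refl) → ~-irrefl refl (v~ (here refl)) }
          ; v~a = v~ (here₁ refl) ; v~b = v~ (here refl) ; a≢b = a≢b
          ; only = λ { (here e) _ → inj₁ e ; (here₁ e) _ → inj₂ e } }
      ... | no a≁b = begin
        cnt Cs (b ∷ a ∷ v ∷ []) hi + 0   ≡⟨ ℕ.+-identityʳ _ ⟩
        cnt Cs (b ∷ a ∷ v ∷ []) hi       ≤⟨ cnt-mono Cs (λ { _ (between l h) → between (l ∘ avb⇒bav) h }) ⟩
        cnt Cs (a ∷ v ∷ b ∷ []) hi       ≤⟨ cycles≤1+solids G Cs-unique Cs-complete Ss-complete hi (<-wellFounded _) p a≢b a≁b T⊆ closed ⟩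
        suc (cnt Ss (a ∷ v ∷ b ∷ []) hi) ≤⟨ s≤s (cnt-mono Ss (λ { _ (between l h) → between (l ∘ bav⇒avb) h })) ⟩
        suc (cnt Ss (b ∷ a ∷ v ∷ []) hi) ∎
        where
        open Nbrs N
        v~a = proj₂ (ex-sound (here₁ refl))
        v~b = proj₂ (ex-sound (here refl))
        avb⇒bav : ∀ {z} → z ∈ a ∷ v ∷ b ∷ [] → z ∈ b ∷ a ∷ v ∷ []
        avb⇒bav (here e) = here₁ e
        avb⇒bav (here₁ e) = here₂ e
        avb⇒bav (here₂ e) = here e
        bav⇒avb : ∀ {z} → z ∈ b ∷ a ∷ v ∷ [] → z ∈ a ∷ v ∷ b ∷ []
        bav⇒avb (here e) = here₂ e
        bav⇒avb (here₁ e) = here e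
        bav⇒avb (here₂ e) = here₁ e
        p : Chordless G a b (a ∷ v ∷ b ∷ [])
        p = cons (~-sym v~a) (λ { (here refl) → ~-irrefl refl v~a ; (here₁ e) → a≢b e })
              (λ { (here e) _ → e ; (here₁ refl) a~b → ⊥-elim (a≁b a~b) })
              (cons v~b (λ { (here refl) → ~-irrefl refl v~b }) (λ { (here e) _ → e }) (single b))
        T⊆ : ∀ {z} → z ∈ a ∷ v ∷ b ∷ [] → z ∈ˢ hi
        T⊆ (here refl) = proj₁ (ex-sound (here₁ refl))
        T⊆ (here₁ refl) = v∈
        T⊆ (here₂ refl) = proj₁ (ex-sound (here refl))
        closed : Closed G a b (a ∷ v ∷ b ∷ []) hi
        closed (here e) z≢a = ⊥-elim (z≢a e)
        closed (here₂ e) _ z≢b = ⊥-elim (z≢b e)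
        closed (here₁ refl) _ _ w∈ v~w with complete w∈ v~w
        ... | inj₁ (here e) = here₂ e
        ... | inj₁ (here₁ e) = here e
      solids-on-pair (c ∷ xs) {a} {b} {hi} a≢b N = begin
        cnt Cs bav hi + suc (length xs)                                   ≡⟨ cong (_+ suc (length xs)) (cnt-split Cs bav hi c) ⟩
        cnt Cs (c ∷ bav) hi + cnt Cs bav (hi ∖ c) + suc (length xs)       ≡⟨ cong (λ k → k + cnt Cs bav (hi ∖ c) + suc (length xs)) none ⟩
        cnt Cs bav (hi ∖ c) + suc (length xs)                             ≡⟨ ℕ.+-suc _ _ ⟩
        suc (cnt Cs bav (hi ∖ c) + length xs)                             ≤⟨ s≤s (solids-on-pair xs a≢b (drop-nbr N)) ⟩
        suc (1 + cnt Ss bav (hi ∖ c))                                     ≤⟨ s≤s (ℕ.+-monoˡ-≤ _ one) ⟩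
        suc (cnt Ss (c ∷ bav) hi + cnt Ss bav (hi ∖ c))                   ≡⟨ cong suc (sym (cnt-split Ss bav hi c)) ⟩
        suc (cnt Ss bav hi) ∎
        where
        open Nbrs N
        bav : List (Fin n)
        bav = b ∷ a ∷ v ∷ []
        c∈ = proj₁ (sound (here refl))
        v~c = proj₁ (proj₂ (sound (here refl)))
        c∉ = proj₂ (proj₂ (sound (here refl)))
        a∈ = proj₁ (ex-sound (here₁ refl))
        v~a = proj₂ (ex-sound (here₁ refl))
        b∈ = proj₁ (ex-sound (here refl))
        v~b = proj₂ (ex-sound (here refl))
        none : cnt Cs (c ∷ bav) hi ≡ 0
        none = cnt≡0 Cs λ { S∈ (between l _) →
          [ (λ e → c∉ (here₁ e)) , (λ e → c∉ (here e)) ]′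
            (two-nbrs G (cyc S∈) (l (here₃ refl)) (l (here₂ refl))
              (l (here₁ refl)) a≢b v~a v~b (l (here refl)) v~c) }
        one : 1 ≤ cnt Ss (c ∷ bav) hi
        one = cnt>0 Ss (Equivalence.from (Ss-complete S) solid) (between
          (λ { (here refl) → contains (here₃ refl)
             ; (here₁ refl) → contains (here₂ refl)
             ; (here₂ refl) → contains (here₁ refl)
             ; (here₃ refl) → contains (here refl) })
          (λ z∈ → incl (within z∈)))
          where
          sol = linked₃ (hi⊆ a∈) (hi⊆ b∈) (hi⊆ c∈) v~a v~b v~c a≢b
                  (λ { refl → c∉ (here₁ refl) }) (λ { refl → c∉ (here refl) })
          open SolidWith sol
          incl : ∀ {z} → z ∈ v ∷ a ∷ b ∷ c ∷ [] ⊎ (z ∈ˢ U × z ≢ v × ¬ v ~ z) → z ∈ˢ hi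
          incl (inj₁ (here refl)) = v∈
          incl (inj₁ (here₁ refl)) = a∈
          incl (inj₁ (here₂ refl)) = b∈
          incl (inj₁ (here₃ refl)) = c∈
          incl (inj₂ (z∈ , _ , v≁z)) = core z∈ v≁z

      -- Sum of `solids-on-pair` over the second neighbour. As long as another neighbour remains,
      -- one of the remaining ones absorbs the excess 1, which turns the gains into the sum for
      -- C(|xs|, 2); only the last pair keeps its excess.
      solids-through-nbr : ∀ b xs {a hi} → Nbrs v U (b ∷ xs) (a ∷ []) hi →
                           cnt Cs (a ∷ v ∷ []) hi + length xs choose 2 ≤ suc (cnt Ss (a ∷ v ∷ []) hi)
      solids-through-nbr b xs {a} {hi} N = go xs N
        where
        av : List (Fin n)
        av = a ∷ v ∷ []
        a≢b : a ≢ b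
        a≢b refl = proj₂ (proj₂ (Nbrs.sound N (here refl))) (here refl)
        go : ∀ xs → Nbrs v U (b ∷ xs) (a ∷ []) hi → cnt Cs av hi + length xs choose 2 ≤ suc (cnt Ss av hi)
        go [] N = begin
          cnt Cs av hi + 0 choose 2                ≡⟨ trans (cong (cnt Cs av hi +_) (0-choose 1)) (ℕ.+-identityʳ _) ⟩
          cnt Cs av hi                             ≡⟨ cnt-split Cs av hi b ⟩
          cnt Cs (b ∷ av) hi + cnt Cs av (hi ∖ b)  ≡⟨ cong (cnt Cs (b ∷ av) hi +_) (cnt≡0 Cs none) ⟩
          cnt Cs (b ∷ av) hi + 0                   ≤⟨ solids-on-pair [] a≢b (move-nbr N) ⟩
          suc (cnt Ss (b ∷ av) hi)                 ≤⟨ s≤s (cnt-mono Ss (λ { _ (between l h) → between (l ∘ there) h })) ⟩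
          suc (cnt Ss av hi) ∎
          where
          open Nbrs (drop-nbr N)
          none : ∀ {S} → S ∈ Cs → ¬ Between av (hi ∖ b) S
          none {S} S∈ (between l h) = CycleAt.a≢b k (trans (is-a (CycleAt.v~a k) (covers⁻ (there (first∈ rim))))
                                                       (sym (is-a (CycleAt.v~b k) (covers⁻ (there (last∈ rim))))))
            where
            k : CycleAt G S v
            k = cycleAt G (cyc S∈) (l (here₁ refl))
            open CycleAt k using (covers⁻; rim)
            is-a : ∀ {z} → v ~ z → z ∈ˢ S → z ≡ a
            is-a v~z z∈ with complete (h z∈) v~z
            ... | inj₁ (here e) = e
        go (b′ ∷ xs) N = begin
          cnt Cs av hi + suc (length xs) choose 2
            ≡⟨ cong₂ _+_ (cnt-split Cs av hi b) (trans (pascal (length xs) 1) (cong (_+ length xs choose 2) (choose-1 (length xs)))) ⟩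
          (cnt Cs (b ∷ av) hi + cnt Cs av (hi ∖ b)) + (length xs + length xs choose 2)
            ≡⟨ shuffle (cnt Cs (b ∷ av) hi) _ _ _ ⟩
          (cnt Cs (b ∷ av) hi + length xs) + (cnt Cs av (hi ∖ b) + length xs choose 2)
            ≤⟨ ℕ.+-mono-≤ pair (solids-through-nbr b′ xs (drop-nbr N)) ⟩
          cnt Ss (b ∷ av) hi + suc (cnt Ss av (hi ∖ b)) ≡⟨ ℕ.+-suc _ _ ⟩
          suc (cnt Ss (b ∷ av) hi + cnt Ss av (hi ∖ b)) ≡⟨ cong suc (sym (cnt-split Ss av hi b)) ⟩
          suc (cnt Ss av hi) ∎
          where
          pair : cnt Cs (b ∷ av) hi + length xs ≤ cnt Ss (b ∷ av) hi
          pair = ℕ.≤-pred (ℕ.≤-trans (ℕ.≤-reflexive (sym (ℕ.+-suc _ _))) (solids-on-pair (b′ ∷ xs) a≢b (move-nbr N)))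

      -- With d the degree of `v`, this says that solids minus cycles through `v`, plus d - 1, is at
      -- least C(d-1, 3), which is the loss of ℶ³ when `v` is deleted.
      solids-through : ∀ a xs {hi} → Nbrs v U (a ∷ xs) [] hi →
                       suc (cnt Cs (v ∷ []) hi) + length xs choose 3 ≤ cnt Ss (v ∷ []) hi + suc (length xs)
      solids-through a [] {hi} N = begin
        suc (cnt Cs (v ∷ []) hi) + 0 choose 3 ≡⟨ trans (cong (suc (cnt Cs (v ∷ []) hi) +_) (0-choose 2)) (ℕ.+-identityʳ _) ⟩
        suc (cnt Cs (v ∷ []) hi)     ≡⟨ cong suc (cnt≡0 Cs none) ⟩
        1                            ≤⟨ ℕ.m≤n+m 1 _ ⟩
        cnt Ss (v ∷ []) hi + 1 ∎
        where
        open Nbrs N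
        none : ∀ {S} → S ∈ Cs → ¬ Between (v ∷ []) hi S
        none {S} S∈ (between l h) = CycleAt.a≢b k (trans (is-a (CycleAt.v~a k) (covers⁻ (there (first∈ rim))))
                                                     (sym (is-a (CycleAt.v~b k) (covers⁻ (there (last∈ rim))))))
          where
          k : CycleAt G S v
          k = cycleAt G (cyc S∈) (l (here refl))
          open CycleAt k using (covers⁻; rim)
          is-a : ∀ {z} → v ~ z → z ∈ˢ S → z ≡ a
          is-a v~z z∈ with complete (h z∈) v~z
          ... | inj₂ (here e) = e
      solids-through a (b ∷ xs) {hi} N = begin
        suc (cnt Cs vl hi) + suc k choose 3
          ≡⟨ cong₂ _+_ (cong suc (trans (cnt-split Cs vl hi a) (ℕ.+-comm (cnt Cs (a ∷ vl) hi) _))) (trans (pascal k 2) (ℕ.+-comm (k choose 2) _)) ⟩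
        (suc (cnt Cs vl (hi ∖ a)) + cnt Cs (a ∷ vl) hi) + (k choose 3 + k choose 2)
          ≡⟨ shuffle (suc (cnt Cs vl (hi ∖ a))) _ _ _ ⟩
        (suc (cnt Cs vl (hi ∖ a)) + k choose 3) + (cnt Cs (a ∷ vl) hi + k choose 2)
          ≤⟨ ℕ.+-mono-≤ (solids-through b xs (drop-nbr N)) (solids-through-nbr b xs (move-nbr N)) ⟩
        (cnt Ss vl (hi ∖ a) + suc k) + suc (cnt Ss (a ∷ vl) hi)
          ≡⟨ cong (cnt Ss vl (hi ∖ a) + suc k +_) (ℕ.+-comm 1 (cnt Ss (a ∷ vl) hi)) ⟩
        (cnt Ss vl (hi ∖ a) + suc k) + (cnt Ss (a ∷ vl) hi + 1)
          ≡⟨ shuffle (cnt Ss vl (hi ∖ a)) _ _ _ ⟩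
        (cnt Ss vl (hi ∖ a) + cnt Ss (a ∷ vl) hi) + (suc k + 1)
          ≡⟨ cong₂ _+_ (trans (ℕ.+-comm (cnt Ss vl (hi ∖ a)) _) (sym (cnt-split Ss vl hi a))) (ℕ.+-comm (suc k) 1) ⟩
        cnt Ss vl hi + suc (suc k) ∎
        where
        vl : List (Fin n)
        vl = v ∷ []
        k : ℕ
        k = length xs

-- Existence of linked vertices

module _ (G : Graph (Fin n)) where
  open Graph G

  private
    V : Set
    V = Fin n

  edge-link : ∀ {D a b} → a ~ b → LinkedBy G D a b
  edge-link {a = a} {b} a~b = a ∷ b ∷ [] ,
    cons a~b (λ { (here refl) → ~-irrefl refl a~b }) (λ { (here e) _ → e }) (single b) ,
    λ { (here e) → inj₁ e ; (here₁ e) → inj₂ (inj₂ e) }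

  -- U consists of X, of a set N of vertices adjacent to all of X, and of
  -- vertices that are not adjacent to v ∈ X.
  extend-linked : ∀ {v X U} (N : Pred V 0ℓ) → (∀ {z} → z ∈ˢ X → z ∈ˢ U) →
                  (∀ {a} → a ∈ˢ U → v ~ a → N a ⊎ a ∈ˢ X) →
                  (∀ {k x} → N k → x ∈ˢ X → k ~ x) →
                  (∀ {a b} → N a → N b → a ≢ b → LinkedBy G (Beyond G v U) a b) →
                  (∀ {a b c} → N a → N b → N c → a ≢ b → a ≢ c → b ≢ c → SolidThrough G v (Beyond G v U) a b c) →
                  v ∈ˢ X → Linked G v X → Linked G v U
  extend-linked {v} {X} {U} N X⊆U cover N~X linkN solidN v∈ L = record
    { linked = λ a∈ b∈ v~a v~b a≢b → link₂ (cover a∈ v~a) (cover b∈ v~b) v~a v~b a≢b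
    ; linked₃ = λ a∈ b∈ c∈ v~a v~b v~c → link₃ (cover a∈ v~a) (cover b∈ v~b) (cover c∈ v~c) v~a v~b v~c }
    where
    open Linked L
    D : Pred V 0ℓ
    D = Beyond G v U
    hub′ : ∀ {a b c} → v ~ a → v ~ b → v ~ c → a ≢ b → a ≢ c → b ≢ c → a ~ b → a ~ c →
           LinkedBy G D b c → SolidThrough G v D a b c
    hub′ = hub G (proj₂ ∘ proj₂) (λ (_ , v≢v , _) → v≢v refl)
    beyond : ∀ {z} → Beyond G v X z → D z
    beyond (z∈ , e) = X⊆U z∈ , e
    linkX : ∀ {a b} → a ∈ˢ X → b ∈ˢ X → v ~ a → v ~ b → a ≢ b → LinkedBy G D a b
    linkX a∈ b∈ v~a v~b a≢b with linked a∈ b∈ v~a v~b a≢b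
    ... | l , p , l⊆ = l , p , λ z∈ → Data.Sum.map id (Data.Sum.map beyond id) (l⊆ z∈)
    link₂ : ∀ {a b} → N a ⊎ a ∈ˢ X → N b ⊎ b ∈ˢ X → v ~ a → v ~ b → a ≢ b → LinkedBy G D a b
    link₂ (inj₁ na) (inj₁ nb) _ _ a≢b = linkN na nb a≢b
    link₂ (inj₁ na) (inj₂ b∈) _ _ _ = edge-link (N~X na b∈)
    link₂ (inj₂ a∈) (inj₁ nb) _ _ _ = edge-link (~-sym (N~X nb a∈))
    link₂ (inj₂ a∈) (inj₂ b∈) v~a v~b a≢b = linkX a∈ b∈ v~a v~b a≢b
    link₃ : ∀ {a b c} → N a ⊎ a ∈ˢ X → N b ⊎ b ∈ˢ X → N c ⊎ c ∈ˢ X → v ~ a → v ~ b → v ~ c →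
            a ≢ b → a ≢ c → b ≢ c → SolidThrough G v D a b c
    link₃ (inj₁ na) (inj₁ nb) (inj₁ nc) _ _ _ a≢b a≢c b≢c = solidN na nb nc a≢b a≢c b≢c
    -- In a mixed triple the one vertex that is alone on its side is adjacent to the two others and
    -- serves as the hub.
    link₃ (inj₁ na) (inj₁ nb) (inj₂ c∈) v~a v~b v~c a≢b a≢c b≢c = swap-bc G (swap-ab G
      (hub′ v~c v~a v~b (a≢c ∘ sym) (b≢c ∘ sym) a≢b (~-sym (N~X na c∈)) (~-sym (N~X nb c∈)) (linkN na nb a≢b)))
    link₃ (inj₁ na) (inj₂ b∈) (inj₁ nc) v~a v~b v~c a≢b a≢c b≢c = swap-ab G
      (hub′ v~b v~a v~c (a≢b ∘ sym) b≢c a≢c (~-sym (N~X na b∈)) (~-sym (N~X nc b∈)) (linkN na nc a≢c))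
    link₃ (inj₂ a∈) (inj₁ nb) (inj₁ nc) v~a v~b v~c a≢b a≢c b≢c =
      hub′ v~a v~b v~c a≢b a≢c b≢c (~-sym (N~X nb a∈)) (~-sym (N~X nc a∈)) (linkN nb nc b≢c)
    link₃ (inj₁ na) (inj₂ b∈) (inj₂ c∈) v~a v~b v~c a≢b a≢c b≢c =
      hub′ v~a v~b v~c a≢b a≢c b≢c (N~X na b∈) (N~X na c∈) (linkX b∈ c∈ v~b v~c b≢c)
    link₃ (inj₂ a∈) (inj₁ nb) (inj₂ c∈) v~a v~b v~c a≢b a≢c b≢c = swap-ab G
      (hub′ v~b v~a v~c (a≢b ∘ sym) b≢c a≢c (N~X nb a∈) (N~X nb c∈) (linkX a∈ c∈ v~a v~c a≢c))
    link₃ (inj₂ a∈) (inj₂ b∈) (inj₁ nc) v~a v~b v~c a≢b a≢c b≢c = swap-bc G (swap-ab G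
      (hub′ v~c v~a v~b (a≢c ∘ sym) (b≢c ∘ sym) a≢b (N~X nc a∈) (N~X nc b∈) (linkX a∈ b∈ v~a v~b a≢b)))
    link₃ (inj₂ a∈) (inj₂ b∈) (inj₂ c∈) v~a v~b v~c a≢b a≢c b≢c =
      weaken G (linked₃ a∈ b∈ c∈ v~a v~b v~c a≢b a≢c b≢c) (All.tabulate id) (Data.Sum.map id beyond)

  Conn : Subset n → Set
  Conn D = ∀ {y z} → y ∈ˢ D → z ∈ˢ D → Walk G (_∈ˢ D) y z

  touches? : ∀ (D : Subset n) → Decidable (Touches G (_∈ˢ D))
  touches? D z = any? (λ d → d ∈ˢ? D ×-dec z ~? d)

  -- As `v` in `X` does not touch `D`, the set `D` lies outside the closed neighbourhood of `v`.
  -- Hence links and solids for the neighbours of `v` that touch `D` can be found through `D`.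
  linked-by-set : ∀ {v D X U} → Conn D → (∀ {z} → z ∈ˢ D → z ∈ˢ U) →
                  (∀ {z} → z ∈ˢ X → z ∈ˢ U × z ∉ˢ D × ¬ Touches G (_∈ˢ D) z) →
                  (∀ {z} → z ∈ˢ U → z ∉ˢ D → ¬ Touches G (_∈ˢ D) z → z ∈ˢ X) →
                  (∀ {x k} → x ∈ˢ X → k ∈ˢ U → k ∉ˢ D → Touches G (_∈ˢ D) k → k ~ x) →
                  v ∈ˢ X → Linked G v X → Linked G v U
  linked-by-set {v} {D} {X} {U} D-conn D⊆U X⁻ X⁺ N~X v∈ L = extend-linked N (proj₁ ∘ X⁻)
    cover (λ (k∈ , k∉ , t , _) x∈ → N~X x∈ k∈ k∉ t) linkN
    (λ (_ , _ , ta , v~a) (_ , _ , tb , v~b) (_ , _ , tc , v~c) a≢b a≢c b≢c →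
       weaken G (three-neighbours G D≁v v∉D D-conn v~a v~b v~c a≢b a≢c b≢c ta tb tc)
         (All.tabulate id) (Data.Sum.map id beyond)) v∈ L
    where
    N : Pred V 0ℓ
    N z = z ∈ˢ U × z ∉ˢ D × Touches G (_∈ˢ D) z × v ~ z
    v∉D : v ∉ˢ D
    v∉D = proj₁ (proj₂ (X⁻ v∈))
    D≁v : ∀ {z} → z ∈ˢ D → ¬ v ~ z
    D≁v z∈ v~z = proj₂ (proj₂ (X⁻ v∈)) (_ , z∈ , v~z)
    beyond : ∀ {z} → z ∈ˢ D → Beyond G v U z
    beyond z∈ = D⊆U z∈ , (λ { refl → v∉D z∈ }) , D≁v z∈
    cover : ∀ {a} → a ∈ˢ U → v ~ a → N a ⊎ a ∈ˢ X
    cover {a} a∈ v~a with touches? D a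
    ... | yes t = inj₁ (a∈ , (λ a∈D → D≁v a∈D v~a) , t , v~a)
    ... | no ¬t = inj₂ (X⁺ a∈ (λ a∈D → D≁v a∈D v~a) ¬t)
    linkN : ∀ {a b} → N a → N b → a ≢ b → LinkedBy G (Beyond G v U) a b
    linkN (_ , _ , ta , _) (_ , _ , tb , _) _ with linkedBy G D≁v v∉D D-conn ta tb
    ... | l , p , l⊆ = l , p , λ z∈ → Data.Sum.map id (Data.Sum.map beyond id) (l⊆ z∈)

  -- A connected set D is grown from a vertex r as long as some vertex outside
  -- its closed neighbourhood misses a neighbour of D.  In the end the vertices
  -- outside are adjacent to all neighbours of D, and a linked vertex of the
  -- outside is one of the whole.
  linked-vertex : ∀ U → Acc _<_ ∣ U ∣ → ∀ {r} → r ∈ˢ U → ∃[ v ] v ∈ˢ U × Linked G v U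
  linked-vertex U (acc rs) {r} r∈ with any? (λ w → w ∈ˢ? U ×-dec ¬? (w Fin.≟ r) ×-dec ¬? (r ~? w))
  -- Here `r` sees all of `U`, so that nothing lies outside its closed neighbourhood. The recursion
  -- is on `U` without `r`, with `r` as the only vertex joined to all others.
  ... | no ¬w = dominating (any? (λ z → z ∈ˢ? U ×-dec ¬? (z Fin.≟ r)))
    where
    r~ : ∀ {z} → z ∈ˢ U → z ≢ r → r ~ z
    r~ {z} z∈ z≢r = decidable-stable (r ~? z) (λ r≁z → ¬w (z , z∈ , z≢r , r≁z))
    dominating : Dec (∃[ z ] z ∈ˢ U × z ≢ r) → ∃[ v ] v ∈ˢ U × Linked G v U
    dominating (no ¬z) = r , r∈ , record
      { linked = λ a∈ _ r~a → ⊥-elim (¬z (_ , a∈ , ~⇒≢ {G = G} r~a ∘ sym))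
      ; linked₃ = λ a∈ _ _ r~a → ⊥-elim (¬z (_ , a∈ , ~⇒≢ {G = G} r~a ∘ sym)) }
    dominating (yes (z , z∈ , z≢r)) with linked-vertex (U ∖ r) (rs (p⊂q⇒∣p∣<∣q∣ (∖-⊂ r∈))) (∈-∖⁺ z∈ z≢r)
    ... | v , v∈ , L = v , proj₁ (∈-∖⁻ v∈) , extend-linked (_≡ r) (proj₁ ∘ ∈-∖⁻) cover
      (λ { refl x∈ → r~ (proj₁ (∈-∖⁻ x∈)) (proj₂ (∈-∖⁻ x∈)) })
      (λ { refl refl a≢b → ⊥-elim (a≢b refl) }) (λ { refl refl _ a≢b → ⊥-elim (a≢b refl) }) v∈ L
      where
      cover : ∀ {a} → a ∈ˢ U → v ~ a → a ≡ r ⊎ a ∈ˢ U ∖ r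
      cover {a} a∈ _ with a Fin.≟ r
      ... | yes e = inj₁ e
      ... | no a≢r = inj₂ (∈-∖⁺ a∈ a≢r)
  ... | yes (w , w∈ , w≢r , r≁w) = grow (sub (Fin._≟ r)) (<-wellFounded _)
      (λ y∈ z∈ → subst₂ (Walk G _) (sym (∈-sub⁻ (Fin._≟ r) y∈)) (sym (∈-sub⁻ (Fin._≟ r) z∈)) ε)
      (λ z∈ → subst (_∈ˢ U) (sym (∈-sub⁻ (Fin._≟ r) z∈)) r∈) (∈-sub⁺ (Fin._≟ r) refl)
      w∈ (w≢r ∘ ∈-sub⁻ (Fin._≟ r))
      (λ (z , z∈ , w~z) → r≁w (~-sym (subst (w ~_) (∈-sub⁻ (Fin._≟ r) z∈) w~z)))
    where
    grow : ∀ D → Acc _<_ ∣ sub (λ z → z ∈ˢ? U ×-dec ¬? (z ∈ˢ? D)) ∣ → Conn D → (∀ {z} → z ∈ˢ D → z ∈ˢ U) → r ∈ˢ D →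
           ∀ {w} → w ∈ˢ U → w ∉ˢ D → ¬ Touches G (_∈ˢ D) w → ∃[ v ] v ∈ˢ U × Linked G v U
    grow D (acc rs′) D-conn D⊆U r∈D {w} w∈ w∉ w≁D
      with any? (λ b → b ∈ˢ? U ×-dec ¬? (b ∈ˢ? D) ×-dec touches? D b ×-dec
                  any? (λ x → x ∈ˢ? U ×-dec ¬? (x ∈ˢ? D) ×-dec ¬? (touches? D x) ×-dec ¬? (b ~? x)))
    -- The vertex `x` missed by `b` stays outside the closed neighbourhood after `b` has joined `D`,
    -- so the outside never becomes empty.
    ... | yes (b , b∈ , b∉ , tb@(d , d∈ , b~d) , x , x∈ , x∉ , x≁D , b≁x) =
      grow D′ (rs′ (p⊂q⇒∣p∣<∣q∣ smaller)) D′-conn D′⊆U (∈-sub⁺ D′? (inj₁ r∈D)) x∈ x∉D′ x≁D′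
      where
      D′? : Decidable (λ z → z ∈ˢ D ⊎ z ≡ b)
      D′? z = z ∈ˢ? D ⊎-dec z Fin.≟ b
      D′ : Subset n
      D′ = sub D′?
      outside? : ∀ D → Decidable (λ z → z ∈ˢ U × z ∉ˢ D)
      outside? D z = z ∈ˢ? U ×-dec ¬? (z ∈ˢ? D)
      smaller : sub (outside? D′) ⊂ sub (outside? D)
      smaller = (λ z∈ → let z∈U , z∉ = ∈-sub⁻ (outside? D′) z∈ in ∈-sub⁺ (outside? D) (z∈U , z∉ ∘ ∈-sub⁺ D′? ∘ inj₁))
              , b , ∈-sub⁺ (outside? D) (b∈ , b∉)
              , λ b∈′ → proj₂ (∈-sub⁻ (outside? D′) b∈′) (∈-sub⁺ D′? (inj₂ refl))
      from-d : ∀ {z} → z ∈ˢ D′ → Walk G (_∈ˢ D′) d z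
      from-d z∈ with ∈-sub⁻ D′? z∈
      ... | inj₁ z∈D = Star.map (λ (e , y∈) → e , ∈-sub⁺ D′? (inj₁ y∈)) (D-conn d∈ z∈D)
      ... | inj₂ refl = (~-sym b~d , ∈-sub⁺ D′? (inj₂ refl)) ◅ ε
      D′-conn : Conn D′
      D′-conn y∈ z∈ = walk-sym G (∈-sub⁺ D′? (inj₁ d∈)) (from-d y∈) ◅◅ from-d z∈
      D′⊆U : ∀ {z} → z ∈ˢ D′ → z ∈ˢ U
      D′⊆U z∈ with ∈-sub⁻ D′? z∈
      ... | inj₁ z∈D = D⊆U z∈D
      ... | inj₂ refl = b∈
      x∉D′ : x ∉ˢ D′
      x∉D′ x∈′ with ∈-sub⁻ D′? x∈′
      ... | inj₁ x∈D = x∉ x∈D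
      ... | inj₂ refl = x≁D tb
      x≁D′ : ¬ Touches G (_∈ˢ D′) x
      x≁D′ (z , z∈ , x~z) with ∈-sub⁻ D′? z∈
      ... | inj₁ z∈D = x≁D (z , z∈D , x~z)
      ... | inj₂ refl = b≁x (~-sym x~z)
    ... | no ¬b with linked-vertex X (rs (p⊂q⇒∣p∣<∣q∣ smaller)) (∈-sub⁺ X? (w∈ , w∉ , w≁D))
      where
      X? : Decidable (λ z → z ∈ˢ U × z ∉ˢ D × ¬ Touches G (_∈ˢ D) z)
      X? z = z ∈ˢ? U ×-dec ¬? (z ∈ˢ? D) ×-dec ¬? (touches? D z)
      X : Subset n
      X = sub X?
      smaller : X ⊂ U
      smaller = proj₁ ∘ ∈-sub⁻ X? , r , r∈ , λ r∈X → proj₁ (proj₂ (∈-sub⁻ X? r∈X)) r∈D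
    ...   | v , v∈ , L = v , proj₁ (∈-sub⁻ X? v∈) , linked-by-set D-conn D⊆U (∈-sub⁻ X?)
        (λ z∈ z∉ z≁ → ∈-sub⁺ X? (z∈ , z∉ , z≁))
        (λ {x} {k} x∈ k∈ k∉ tk → decidable-stable (k ~? x) (λ k≁x →
           let x∈U , x∉ , x≁ = ∈-sub⁻ X? x∈ in ¬b (k , k∈ , k∉ , tk , x , x∈U , x∉ , x≁ , k≁x)))
        v∈ L
      where
      X? : Decidable (λ z → z ∈ˢ U × z ∉ˢ D × ¬ Touches G (_∈ˢ D) z)
      X? z = z ∈ˢ? U ×-dec ¬? (z ∈ˢ? D) ×-dec ¬? (touches? D z)

-- Elimination of linked vertices

unique-⊆⇒length≤ : {A : Set} {xs ys : List A} → Unique xs → (∀ {z} → z ∈ xs → z ∈ ys) → length xs ≤ length ys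
unique-⊆⇒length≤ [] _ = z≤n
unique-⊆⇒length≤ {xs = x ∷ xs} (x≢ ∷ u) xs⊆ with ∈-∃++ (xs⊆ (here refl))
... | as , bs , refl = ℕ.≤-trans (s≤s (unique-⊆⇒length≤ u remaining))
  (ℕ.≤-reflexive (trans (cong suc (length-++ as)) (trans (sym (ℕ.+-suc (length as) (length bs))) (sym (length-++ as)))))
  where
  remaining : ∀ {z} → z ∈ xs → z ∈ as ++ bs
  remaining z∈ with ∈-++⁻ as (xs⊆ (there z∈))
  ... | inj₁ z∈as = ∈-++⁺ˡ z∈as
  ... | inj₂ (here refl) = ⊥-elim (All.lookup x≢ z∈ refl)
  ... | inj₂ (there z∈bs) = ∈-++⁺ʳ as z∈bs

fresh : ∀ {m} (ys : List (Fin m)) → length ys < m → ∃[ k ] k ∉ ys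
fresh {m} ys ys<m with any? (λ k → ¬? (k ∈? ys))
... | yes q = q
... | no ¬q = ⊥-elim (ℕ.<⇒≱ ys<m (ℕ.≤-trans (ℕ.≤-reflexive (sym (length-tabulate id)))
  (unique-⊆⇒length≤ (allFin⁺ m) (λ {k} _ → decidable-stable (k ∈? ys) (λ k∉ → ¬q (k , k∉))))))

abstract
  size : Subset n → ℕ
  size U = count (_∈ˢ? U) (allFin _)

  size-∖ : ∀ {U : Subset n} {v} → v ∈ˢ U → size U ≡ suc (size (U ∖ v))
  size-∖ {n} {U} {v} v∈ = ℕ.≤-antisym
    (ℕ.≤-trans (count-⊎ (_∈ˢ? U) (Fin._≟ v) (_∈ˢ? (U ∖ v)) (allFin n) λ {z} _ → case z)
       (ℕ.+-monoˡ-≤ _ (count≤1 (Fin._≟ v) (allFin n) (allFin⁺ n) (λ _ _ p q → trans p (sym q)))))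
    (ℕ.≤-trans (ℕ.+-monoˡ-≤ _ (count>0 (Fin._≟ v) (∈-allFin v) refl))
       (count-⊎⁻ (_∈ˢ? U) (Fin._≟ v) (_∈ˢ? (U ∖ v)) (allFin n)
          (λ { _ refl → v∈ }) (λ _ → proj₁ ∘ ∈-∖⁻) (λ { _ refl v∈′ → proj₂ (∈-∖⁻ v∈′) refl })))
    where
    case : ∀ z → z ∈ˢ U → z ≡ v ⊎ z ∈ˢ U ∖ v
    case z z∈ with z Fin.≟ v
    ... | yes e = inj₁ e
    ... | no z≢v = inj₂ (∈-∖⁺ z∈ z≢v)

  size-empty : ∀ {U : Subset n} → (∀ {z} → z ∉ˢ U) → size U ≡ 0
  size-empty {n} {U} none = count≡0 (_∈ˢ? U) (allFin n) (λ _ → none)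

  size-full : size (full {n}) ≡ n
  size-full {n} = trans (cong length (filter-all (_∈ˢ? full) (All.tabulate {xs = allFin n} (λ _ → ∈⊤)))) (length-tabulate id)

choose-mono : ∀ {i j} k → i ≤ j → i choose suc k ≤ j choose suc k
choose-mono {zero} {j} k z≤n = ℕ.≤-trans (ℕ.≤-reflexive (0-choose k)) z≤n
choose-mono {suc i} {suc j} zero (s≤s i≤j) =
  ℕ.≤-trans (ℕ.≤-reflexive (choose-1 (suc i))) (ℕ.≤-trans (s≤s i≤j) (ℕ.≤-reflexive (sym (choose-1 (suc j)))))
choose-mono {suc i} {suc j} (suc k) (s≤s i≤j) = ℕ.≤-trans (ℕ.≤-reflexive (pascal i (suc k)))
  (ℕ.≤-trans (ℕ.+-mono-≤ (choose-mono k i≤j) (choose-mono (suc k) i≤j)) (ℕ.≤-reflexive (sym (pascal j (suc k)))))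

module _ (G : Graph (Fin n)) where
  open Graph G

  ColourableOn : Subset n → ℕ → Set
  ColourableOn U m = Σ (Fin n → Fin m) λ c → ∀ {u v} → u ∈ˢ U → v ∈ˢ U → u ~ v → c u ≢ c v

  nbrs : Subset n → Fin n → List (Fin n)
  nbrs U v = filter (λ z → z ∈ˢ? U ×-dec v ~? z) (allFin n)

  nbrs⁺ : ∀ {U v z} → z ∈ˢ U → v ~ z → z ∈ nbrs U v
  nbrs⁺ {U} {v} {z} z∈ v~z = ∈-filter⁺ (λ z → z ∈ˢ? U ×-dec v ~? z) (∈-allFin z) (z∈ , v~z)

  nbrs⁻ : ∀ {U v z} → z ∈ nbrs U v → z ∈ˢ U × v ~ z
  nbrs⁻ {U} {v} z∈ = proj₂ (∈-filter⁻ (λ z → z ∈ˢ? U ×-dec v ~? z) {xs = allFin n} z∈)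

  nbrs-unique : ∀ U v → Unique (nbrs U v)
  nbrs-unique U v = unique-filter⁺ (λ z → z ∈ˢ? U ×-dec v ~? z) (allFin⁺ n)

  nbrs-Nbrs : ∀ {U v} → v ∈ˢ U → Nbrs G v U (nbrs U v) [] U
  nbrs-Nbrs {U} {v} v∈ = record
    { unique = nbrs-unique U v
    ; sound = λ z∈ → let z∈U , v~z = nbrs⁻ z∈ in z∈U , v~z , λ ()
    ; ex-sound = λ () ; complete = λ z∈ v~z → inj₂ (nbrs⁺ z∈ v~z)
    ; v∈ = v∈ ; hi⊆ = id ; core = λ z∈ _ → z∈ }

  private
    recolour : ∀ {U v m} (c : Fin n → Fin m) (k : Fin m) →
               (∀ {u w} → u ∈ˢ U ∖ v → w ∈ˢ U ∖ v → u ~ w → c u ≢ c w) →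
               (∀ {z} → z ∈ˢ U → v ~ z → c z ≢ k) → ColourableOn U m
    recolour {U} {v} {m} c k proper avoid = c′ , proper′
      where
      c′ : Fin n → Fin m
      c′ z with z Fin.≟ v
      ... | yes _ = k
      ... | no _  = c z
      proper′ : ∀ {u w} → u ∈ˢ U → w ∈ˢ U → u ~ w → c′ u ≢ c′ w
      proper′ {u} {w} u∈ w∈ u~w with u Fin.≟ v | w Fin.≟ v
      ... | yes refl | yes refl = ⊥-elim (~-irrefl refl u~w)
      ... | yes refl | no _ = avoid w∈ u~w ∘ sym
      ... | no _ | yes refl = avoid u∈ (~-sym u~w)
      ... | no u≢v | no w≢v = proper (∈-∖⁺ u∈ u≢v) (∈-∖⁺ w∈ w≢v) u~w

  colour-low-degree : ∀ {U v m} → ColourableOn (U ∖ v) m → length (nbrs U v) < m → ColourableOn U m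
  colour-low-degree {U} {v} {m} (c , proper) d<m =
    recolour c k proper (λ z∈ v~z e → k∉ (subst (_∈ _) e (∈-map⁺ c (nbrs⁺ z∈ v~z))))
    where
    free : ∃[ k ] k ∉ map c (nbrs U v)
    free = fresh (map c (nbrs U v)) (ℕ.≤-trans (s≤s (ℕ.≤-reflexive (length-map c (nbrs U v)))) d<m)
    k = proj₁ free
    k∉ = proj₂ free

  colour-new : ∀ {U v m} → ColourableOn (U ∖ v) m → ColourableOn U (suc m)
  colour-new {m = m} (c , proper) = recolour (inject₁ ∘ c) (fromℕ m)
    (λ u∈ w∈ u~w e → proper u∈ w∈ u~w (inject₁-injective e)) (λ _ _ e → fromℕ≢inject₁ (sym e))

  chordless-walk : ∀ {x y l} → Chordless G x y l → Walk G (_∈ l) x y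
  chordless-walk (single _) = ε
  chordless-walk (cons x~y _ _ p) =
    (x~y , there (first∈ p)) ◅ Star.map (λ (e , z∈) → e , there z∈) (chordless-walk p)

  -- A walk passes `v` between two neighbours of `v`; the link between them is a detour that avoids
  -- `v`. If it returns to the same neighbour, the excursion is dropped.
  conn-∖ : ∀ {U v} → Conn G U → Linked G v U → Conn G (U ∖ v)
  conn-∖ {U} {v} conn L y∈ z∈ = let y∈U , y≢v = ∈-∖⁻ y∈ ; z∈U , z≢v = ∈-∖⁻ z∈ in avoid y∈U y≢v z≢v (conn y∈U z∈U)
    where
    avoid : ∀ {y z} → y ∈ˢ U → y ≢ v → z ≢ v → Walk G (_∈ˢ U) y z → Walk G (_∈ˢ U ∖ v) y z
    avoid y∈ y≢v z≢v ε = ε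
    avoid y∈ y≢v z≢v (_◅_ {j = x} (y~x , x∈) ws) with x Fin.≟ v
    ... | no x≢v = (y~x , ∈-∖⁺ x∈ x≢v) ◅ avoid x∈ x≢v z≢v ws
    avoid y∈ y≢v z≢v ((y~x , x∈) ◅ ε) | yes refl = ⊥-elim (z≢v refl)
    avoid {y} y∈ y≢v z≢v ((y~x , x∈) ◅ (_◅_ {j = x′} (v~x′ , x′∈) ws)) | yes refl with y Fin.≟ x′
    ... | yes refl = avoid y∈ y≢v z≢v ws
    ... | no y≢x′ with Linked.linked L y∈ x′∈ (~-sym y~x) v~x′ y≢x′
    ...   | l , p , l⊆ = Star.map (λ (e , w∈) → e , in-U (l⊆ w∈)) (chordless-walk p) ◅◅ avoid x′∈ x′≢v z≢v ws
      where
      x′≢v : x′ ≢ v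
      x′≢v refl = ~-irrefl refl v~x′
      in-U : ∀ {w} → w ≡ y ⊎ (w ∈ˢ U × w ≢ v × ¬ v ~ w) ⊎ w ≡ x′ → w ∈ˢ U ∖ v
      in-U (inj₁ refl) = ∈-∖⁺ y∈ y≢v
      in-U (inj₂ (inj₁ (w∈ , w≢v , _))) = ∈-∖⁺ w∈ w≢v
      in-U (inj₂ (inj₂ refl)) = ∈-∖⁺ x′∈ x′≢v

  -- P U k stands for a lower bound on a characteristic of U in terms of the number
  -- suc k of colours of the greedy colouring.
  eliminate : (P : Subset n → ℕ → Set) →
              (∀ {U v} → v ∈ˢ U → (∀ {z} → z ∈ˢ U → z ≡ v) → P U 0) →
              (∀ {U v k} → Linked G v U → ∀ a as → Nbrs G v U (a ∷ as) [] U → P (U ∖ v) k → P U k) →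
              (∀ {U v k} → Linked G v U → ∀ a as → Nbrs G v U (a ∷ as) [] U → k ≤ length as → P (U ∖ v) k → P U (suc k)) →
              ∀ U → Acc _<_ ∣ U ∣ → ∀ {r} → r ∈ˢ U → Conn G U → ∃[ k ] ColourableOn U (suc k) × P U k
  eliminate P base same new U (acc rs) r∈ conn with linked-vertex G U (<-wellFounded _) r∈
  ... | v , v∈ , L with any? (λ z → z ∈ˢ? U ×-dec ¬? (z Fin.≟ v))
  ...   | no ¬z = 0 , ((λ _ → zero) , λ u∈ w∈ u~w _ → ~-irrefl (trans (is-v u∈) (sym (is-v w∈))) u~w) , base v∈ is-v
    where
    is-v : ∀ {z} → z ∈ˢ U → z ≡ v
    is-v {z} z∈ = decidable-stable (z Fin.≟ v) (λ z≢v → ¬z (z , z∈ , z≢v))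
  ...   | yes (z , z∈ , z≢v) = by (nbrs U v) refl (nbrs-Nbrs v∈)
      (eliminate P base same new (U ∖ v) (rs (p⊂q⇒∣p∣<∣q∣ (∖-⊂ v∈))) (∈-∖⁺ z∈ z≢v) (conn-∖ conn L))
    where
    some-nbr : ∀ {z} → z ≢ v → Walk G (_∈ˢ U) v z → ∃[ y ] y ∈ˢ U × v ~ y
    some-nbr z≢v ε = ⊥-elim (z≢v refl)
    some-nbr _ ((v~y , y∈) ◅ _) = _ , y∈ , v~y
    by : ∀ xs → nbrs U v ≡ xs → Nbrs G v U xs [] U → ∃[ k ] ColourableOn (U ∖ v) (suc k) × P (U ∖ v) k →
         ∃[ k ] ColourableOn U (suc k) × P U k
    by [] _ N _ with some-nbr z≢v (conn v∈ z∈)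
    ... | y , y∈ , v~y with Nbrs.complete N y∈ v~y
    ...   | inj₁ ()
    ...   | inj₂ ()
    -- The degree of `v` is one more than the length of `as`, so the first case says that it reaches
    -- the number `suc k` of colours; otherwise one of them is free at `v`.
    by (a ∷ as) e N (k , col , p) with k ≤? length as
    ... | yes k≤ = suc k , colour-new col , new L a as N k≤ p
    ... | no k≰ = k , colour-low-degree col (subst (λ xs → length xs < suc k) (sym e) (s≤s (ℕ.≰⇒> k≰))) , same L a as N p

  module _ {Es : List (Subset n)} (Es-unique : Unique Es) (Es-complete : ∀ S → S ∈ Es ⇔ IsEdge G S) where

    private
      e : Subset n → ℕ
      e = cnt Es []

      Single : Subset n → Fin n → Set
      Single U v = v ∈ˢ U × (∀ {z} → z ∈ˢ U → z ≡ v)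

      size-single : ∀ {U v} → Single U v → size U ≡ 1
      size-single (v∈ , is-v) = trans (size-∖ v∈)
        (cong suc (size-empty (λ z∈ → let z∈U , z≢v = ∈-∖⁻ z∈ in z≢v (is-v z∈U))))

      e-single : ∀ {U v} → Single U v → e U ≡ 0
      e-single {U} {v} (v∈ , is-v) = cnt≡0 Es none
        where
        none : ∀ {S} → S ∈ Es → ¬ Between [] U S
        none S∈ (between _ h) with Equivalence.to (Es-complete _) S∈
        ... | u , w , u~w , refl = ~-irrefl (trans (is-v (h (∈-set⁺ (here refl))))
                                      (sym (is-v (h (∈-set⁺ (here₁ refl)))))) u~w

      e-step : ∀ {U v xs} → Nbrs G v U xs [] U → e U ≡ length xs + e (U ∖ v)
      e-step {U} {v} {xs} N = trans (cnt-split Es [] U v) (cong (_+ e (U ∖ v)) (degree-edges G Es-unique Es-complete xs N))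

    -- Without subtraction: ℶ¹ of the graph induced on `U` is at least C(k, 2) - 1, the value for
    -- Kᵏ⁺¹.
    EdgeBound : Subset n → ℕ → Set
    EdgeBound U k = k choose 2 + size U ≤ suc (e U)

    private
      open ℕ.≤-Reasoning

      edge-base : ∀ {U v} → v ∈ˢ U → (∀ {z} → z ∈ˢ U → z ≡ v) → EdgeBound U 0
      edge-base {U} v∈ is-v = begin
        0 choose 2 + size U ≡⟨ cong₂ _+_ (0-choose 1) (size-single (v∈ , is-v)) ⟩
        1                   ≤⟨ s≤s z≤n ⟩
        suc (e U) ∎

      edge-same : ∀ {U v k} → Linked G v U → ∀ a as → Nbrs G v U (a ∷ as) [] U → EdgeBound (U ∖ v) k → EdgeBound U k
      edge-same {U} {v} {k} _ a as N p = begin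
        k choose 2 + size U             ≡⟨ cong (k choose 2 +_) (size-∖ (Nbrs.v∈ N)) ⟩
        k choose 2 + suc (size (U ∖ v)) ≡⟨ ℕ.+-suc _ _ ⟩
        suc (k choose 2 + size (U ∖ v)) ≤⟨ s≤s p ⟩
        suc (suc (e (U ∖ v)))           ≤⟨ s≤s (s≤s (ℕ.m≤n+m _ (length as))) ⟩
        suc (suc (length as + e (U ∖ v))) ≡⟨ cong suc (sym (e-step N)) ⟩
        suc (e U) ∎

      edge-new : ∀ {U v k} → Linked G v U → ∀ a as → Nbrs G v U (a ∷ as) [] U → k ≤ length as →
                 EdgeBound (U ∖ v) k → EdgeBound U (suc k)
      edge-new {U} {v} {k} _ a as N k≤ p = begin
        suc k choose 2 + size U                    ≡⟨ cong₂ _+_ (trans (pascal k 1) (cong (_+ k choose 2) (choose-1 k))) (size-∖ (Nbrs.v∈ N)) ⟩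
        (k + k choose 2) + suc (size (U ∖ v))      ≡⟨ ℕ.+-suc _ _ ⟩
        suc ((k + k choose 2) + size (U ∖ v))      ≡⟨ cong suc (ℕ.+-assoc k _ _) ⟩
        suc (k + (k choose 2 + size (U ∖ v)))      ≤⟨ s≤s (ℕ.+-mono-≤ k≤ p) ⟩
        suc (length as + suc (e (U ∖ v)))          ≡⟨ cong suc (ℕ.+-suc _ _) ⟩
        suc (suc (length as + e (U ∖ v)))          ≡⟨ cong suc (sym (e-step N)) ⟩
        suc (e U) ∎

    edge-bound : ∀ {U r} → r ∈ˢ U → Conn G U → ∃[ k ] ColourableOn U (suc k) × EdgeBound U k
    edge-bound = eliminate EdgeBound edge-base edge-same edge-new _ (<-wellFounded _)

    module _ {Cs : List (Subset n)} (Cs-complete : ∀ S → S ∈ Cs ⇔ InducedCycle G S) where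

      -- Likewise ℶ² ≥ C(k, 3) + 1, the value for Kᵏ⁺¹.
      CycleBound : Subset n → ℕ → Set
      CycleBound U k = k choose 3 + suc (e U) ≤ cnt Cs [] U + size U

      private
        cycle-base : ∀ {U v} → v ∈ˢ U → (∀ {z} → z ∈ˢ U → z ≡ v) → CycleBound U 0
        cycle-base {U} v∈ is-v = begin
          0 choose 3 + suc (e U) ≡⟨ cong₂ (λ i j → i + suc j) (0-choose 2) (e-single (v∈ , is-v)) ⟩
          1                      ≡⟨ sym (size-single (v∈ , is-v)) ⟩
          size U                 ≤⟨ ℕ.m≤n+m _ _ ⟩
          cnt Cs [] U + size U ∎

        -- Shared by both cases: the gain `j` is 0 without and C(k, 2) with a new colour. With
        -- `suc d` neighbours, d of the C(d+1, 2) cycles through `v` pay for the lost edges less the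
        -- lost vertex, and C(d, 2) cycles remain.
        step : ∀ {U v} → Linked G v U → ∀ a as → Nbrs G v U (a ∷ as) [] U → ∀ i j → j ≤ length as choose 2 →
               i + suc (e (U ∖ v)) ≤ cnt Cs [] (U ∖ v) + size (U ∖ v) →
               (j + i) + suc (e U) ≤ cnt Cs [] U + size U
        step {U} {v} L a as N i j j≤ p = begin
          (j + i) + suc (e U)                                    ≡⟨ cong (λ x → (j + i) + suc x) (e-step N) ⟩
          (j + i) + suc (suc d + e (U ∖ v))                      ≡⟨ cong ((j + i) +_) (sym (ℕ.+-suc (suc d) _)) ⟩
          (j + i) + (suc d + suc (e (U ∖ v)))                    ≡⟨ shuffle j i (suc d) _ ⟩
          (j + suc d) + (i + suc (e (U ∖ v)))                    ≤⟨ ℕ.+-mono-≤ through p ⟩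
          (suc (cnt Cs (v ∷ []) U)) + (cnt Cs [] (U ∖ v) + size (U ∖ v)) ≡⟨ cong suc (sym (ℕ.+-assoc (cnt Cs (v ∷ []) U) _ _)) ⟩
          suc ((cnt Cs (v ∷ []) U + cnt Cs [] (U ∖ v)) + size (U ∖ v)) ≡⟨ cong (λ x → suc (x + size (U ∖ v))) (sym (cnt-split Cs [] U v)) ⟩
          suc (cnt Cs [] U + size (U ∖ v))                       ≡⟨ sym (ℕ.+-suc _ _) ⟩
          cnt Cs [] U + suc (size (U ∖ v))                       ≡⟨ cong (cnt Cs [] U +_) (sym (size-∖ (Nbrs.v∈ N))) ⟩
          cnt Cs [] U + size U ∎
          where
          d : ℕ
          d = length as
          through : j + suc d ≤ suc (cnt Cs (v ∷ []) U)
          through = begin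
            j + suc d                 ≡⟨ trans (ℕ.+-suc j d) (cong suc (ℕ.+-comm j d)) ⟩
            suc (d + j)               ≤⟨ s≤s (ℕ.+-monoʳ-≤ d j≤) ⟩
            suc (d + d choose 2)      ≡⟨ cong suc (sym (trans (pascal d 1) (cong (_+ d choose 2) (choose-1 d)))) ⟩
            suc (suc d choose 2)      ≤⟨ s≤s (cycles-through G L Cs-complete (a ∷ as) N) ⟩
            suc (cnt Cs (v ∷ []) U) ∎

        cycle-same : ∀ {U v k} → Linked G v U → ∀ a as → Nbrs G v U (a ∷ as) [] U → CycleBound (U ∖ v) k → CycleBound U k
        cycle-same {k = k} L a as N p = step L a as N (k choose 3) 0 z≤n p

        cycle-new : ∀ {U v k} → Linked G v U → ∀ a as → Nbrs G v U (a ∷ as) [] U → k ≤ length as →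
                    CycleBound (U ∖ v) k → CycleBound U (suc k)
        cycle-new {U} {k = k} L a as N k≤ p = begin
          suc k choose 3 + suc (e U)               ≡⟨ cong (_+ suc (e U)) (pascal k 2) ⟩
          (k choose 2 + k choose 3) + suc (e U)    ≤⟨ step L a as N (k choose 3) (k choose 2) (choose-mono 1 k≤) p ⟩
          cnt Cs [] U + size U ∎

      cycle-bound : ∀ {U r} → r ∈ˢ U → Conn G U → ∃[ k ] ColourableOn U (suc k) × CycleBound U k
      cycle-bound = eliminate CycleBound cycle-base cycle-same cycle-new _ (<-wellFounded _)

      module _ {Ss : List (Subset n)} (Cs-unique : Unique Cs) (Ss-complete : ∀ S → S ∈ Ss ⇔ Solid G S) where

        -- Likewise ℶ³ ≥ C(k, 4) - 1, the value for Kᵏ⁺¹.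
        SolidBound : Subset n → ℕ → Set
        SolidBound U k = k choose 4 + (cnt Cs [] U + size U) ≤ cnt Ss [] U + suc (e U)

        private
          solid-base : ∀ {U v} → v ∈ˢ U → (∀ {z} → z ∈ˢ U → z ≡ v) → SolidBound U 0
          solid-base {U} {v} v∈ is-v = begin
            0 choose 4 + (cnt Cs [] U + size U) ≡⟨ cong₂ _+_ (0-choose 3) (cong₂ _+_ (cnt≡0 Cs none) (size-single (v∈ , is-v))) ⟩
            1                                   ≤⟨ s≤s z≤n ⟩
            suc (e U)                           ≤⟨ ℕ.m≤n+m _ _ ⟩
            cnt Ss [] U + suc (e U) ∎
            where
            none : ∀ {S} → S ∈ Cs → ¬ Between [] U S
            none S∈ (between _ h) with Equivalence.to (Cs-complete _) S∈
            ... | cyc with cycle⇒hole cyc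
            ...   | u , _ = CycleAt.a≢b c (trans (is-v (h (covers⁻ (there (first∈ rim))))) (sym (is-v (h (covers⁻ (there (last∈ rim)))))))
              where
              c = cycleAt G cyc (proj₂ u)
              open CycleAt c using (covers⁻; rim)

          solid-step : ∀ {U v} → Linked G v U → ∀ a as → Nbrs G v U (a ∷ as) [] U → ∀ i j → j ≤ length as choose 3 →
                 i + (cnt Cs [] (U ∖ v) + size (U ∖ v)) ≤ cnt Ss [] (U ∖ v) + suc (e (U ∖ v)) →
                 (j + i) + (cnt Cs [] U + size U) ≤ cnt Ss [] U + suc (e U)
          solid-step {U} {v} L a as N i j j≤ p = begin
            (j + i) + (cnt Cs [] U + size U)
              ≡⟨ cong ((j + i) +_) (cong₂ _+_ (cnt-split Cs [] U v) (size-∖ (Nbrs.v∈ N))) ⟩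
            (j + i) + ((c + c′) + suc s′)
              ≡⟨ cong ((j + i) +_) (trans (ℕ.+-suc (c + c′) s′) (cong suc (ℕ.+-assoc c c′ s′))) ⟩
            (j + i) + (suc c + (c′ + s′))
              ≡⟨ shuffle j i (suc c) _ ⟩
            (j + suc c) + (i + (c′ + s′))
              ≤⟨ ℕ.+-mono-≤ through p ⟩
            (cnt Ss (v ∷ []) U + suc (length as)) + (cnt Ss [] (U ∖ v) + suc (e (U ∖ v)))
              ≡⟨ shuffle (cnt Ss (v ∷ []) U) _ _ _ ⟩
            (cnt Ss (v ∷ []) U + cnt Ss [] (U ∖ v)) + (suc (length as) + suc (e (U ∖ v)))
              ≡⟨ cong₂ _+_ (sym (cnt-split Ss [] U v)) (trans (ℕ.+-suc (suc (length as)) (e (U ∖ v))) (cong suc (sym (e-step N)))) ⟩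
            cnt Ss [] U + suc (e U) ∎
            where
            c c′ s′ : ℕ
            c = cnt Cs (v ∷ []) U
            c′ = cnt Cs [] (U ∖ v)
            s′ = size (U ∖ v)
            through : j + suc c ≤ cnt Ss (v ∷ []) U + suc (length as)
            through = begin
              j + suc c                    ≡⟨ ℕ.+-comm j _ ⟩
              suc c + j                    ≤⟨ ℕ.+-monoʳ-≤ (suc c) j≤ ⟩
              suc c + length as choose 3   ≤⟨ solids-through G L Cs-unique Cs-complete Ss-complete a as N ⟩
              cnt Ss (v ∷ []) U + suc (length as) ∎

          solid-same : ∀ {U v k} → Linked G v U → ∀ a as → Nbrs G v U (a ∷ as) [] U → SolidBound (U ∖ v) k → SolidBound U k
          solid-same {k = k} L a as N p = solid-step L a as N (k choose 4) 0 z≤n p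

          solid-new : ∀ {U v k} → Linked G v U → ∀ a as → Nbrs G v U (a ∷ as) [] U → k ≤ length as →
                      SolidBound (U ∖ v) k → SolidBound U (suc k)
          solid-new {U} {k = k} L a as N k≤ p = begin
            suc k choose 4 + (cnt Cs [] U + size U)                  ≡⟨ cong (_+ (cnt Cs [] U + size U)) (pascal k 3) ⟩
            (k choose 3 + k choose 4) + (cnt Cs [] U + size U)       ≤⟨ solid-step L a as N (k choose 4) (k choose 3) (choose-mono 2 k≤) p ⟩
            cnt Ss [] U + suc (e U) ∎

        solid-bound : ∀ {U r} → r ∈ˢ U → Conn G U → ∃[ k ] ColourableOn U (suc k) × SolidBound U k
        solid-bound = eliminate SolidBound solid-base solid-same solid-new _ (<-wellFounded _)

-- Minors of graphs of minimum degree at most three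

module _ (G : Graph (Fin n)) where
  open Graph G

  private
    V : Set
    V = Fin n

  -- Paths that need not be induced.
  data Trail : V → V → List V → Set where
    single : ∀ x → Trail x x (x ∷ [])
    cons   : ∀ {x y z l} → x ~ y → x ∉ l → Trail y z l → Trail x z (x ∷ l)

  start∈ : ∀ {x y l} → Trail x y l → x ∈ l
  start∈ (single _) = here refl
  start∈ (cons _ _ _) = here refl

  end∈ : ∀ {x y l} → Trail x y l → y ∈ l
  end∈ (single _) = here refl
  end∈ (cons _ _ t) = there (end∈ t)

  trail-++ : ∀ {x y z w k l} → Trail x y k → Trail z w l → y ~ z → (∀ {u} → u ∈ k → u ∉ l) → Trail x w (k ++ l)
  trail-++ (single x) t y~z k∩l = cons y~z (k∩l (here refl)) t
  trail-++ {l = l} (cons {x} {l = k} x~y x∉ s) t y~z k∩l =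
    cons x~y (λ x∈ → [ x∉ , k∩l (here refl) ]′ (∈-++⁻ k x∈)) (trail-++ s t y~z (k∩l ∘ there))

  trail-reverse : ∀ {x y l} → Trail x y l → Trail y x (reverse l)
  trail-reverse (single x) = single x
  trail-reverse {y = y} (cons {x} {l = l} x~y x∉ t) = subst (Trail y x) (sym (unfold-reverse x l))
    (trail-++ (trail-reverse t) (single x) (~-sym x~y) (λ { u∈ (here refl) → x∉ (Any.reverse⁻ u∈) }))

  trail-split : ∀ {x y z l} → Trail x z l → y ∈ l → y ≢ x →
                ∃[ p ] ∃[ k ] ∃[ m ] Trail x p k × p ~ y × Trail y z m × (∀ {u} → u ∈ k → u ∈ l) ×
                (∀ {u} → u ∈ m → u ∈ l) × (∀ {u} → u ∈ k → u ∉ m) × length k + length m ≡ length l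
  trail-split (single _) (here e) y≢x = ⊥-elim (y≢x e)
  trail-split (cons _ _ _) (here e) y≢x = ⊥-elim (y≢x e)
  trail-split {y = y} (cons {y = y₀} x~y₀ x∉ t) (there y∈) _ with y Fin.≟ y₀
  ... | yes refl = _ , _ , _ , single _ , x~y₀ , t , (λ { (here e) → here e }) , there
                 , (λ { (here refl) → x∉ }) , refl
  ... | no y≢ with trail-split t y∈ y≢
  ...   | p , k , m , K , p~y , M , k⊆ , m⊆ , k∩m , e = p , _ , m , cons x~y₀ (x∉ ∘ k⊆) K , p~y , M
          , (λ { (here e) → here e ; (there u∈) → there (k⊆ u∈) }) , there ∘ m⊆
          , (λ { (here refl) → x∉ ∘ m⊆ ; (there u∈) → k∩m u∈ }) , cong suc e

  trail-unique : ∀ {x y l} → Trail x y l → Unique l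
  trail-unique (single _) = [] ∷ []
  trail-unique (cons _ x∉ t) = All.tabulate (λ { z∈ refl → x∉ z∈ }) ∷ trail-unique t

  trail-length : ∀ {x y l} → Trail x y l → length l ≤ n
  trail-length {l = l} t = ℕ.≤-trans (unique-⊆⇒length≤ (trail-unique t) (λ {z} _ → ∈-allFin z))
                             (ℕ.≤-reflexive (length-tabulate id))

  ConnectedList : List V → Set
  ConnectedList l = ∃[ r ] r ∈ l × (∀ {z} → z ∈ l → Walk G (_∈ l) r z)

  Joined : List V → List V → Set
  Joined k l = (∀ {z} → z ∈ k → z ∉ l) × ∃[ x ] ∃[ y ] x ∈ k × y ∈ l × x ~ y

  trail-connected : ∀ {x y l} → Trail x y l → ConnectedList l
  trail-connected {x} t = x , start∈ t , walk t
    where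
    walk : ∀ {x y l} → Trail x y l → ∀ {z} → z ∈ l → Walk G (_∈ l) x z
    walk (single _) (here refl) = ε
    walk (cons _ _ _) (here refl) = ε
    walk (cons x~y _ t) (there z∈) =
      (x~y , there (start∈ t)) ◅ Star.map (λ (e , w∈) → e , there w∈) (walk t z∈)

  single-connected : ∀ x → ConnectedList (x ∷ [])
  single-connected x = trail-connected (single x)

  private
    walk-in : ∀ {l} (S : Subset n) → (∀ {z} → z ∈ l → z ∈ˢ S) → ∀ {y z} {p : y ∈ˢ S} {q : z ∈ˢ S} →
              Walk G (_∈ l) y z → Star (Graph._~_ (G [ S ])) (y , p) (z , q)
    walk-in S l⊆ {p = p} {q} ε = subst (Star _ _) (vertex-≡ G refl) ε
    walk-in S l⊆ ((y~x , x∈) ◅ ws) = _◅_ {j = _ , l⊆ x∈} y~x (walk-in S l⊆ ws)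

  connectedList : ∀ {l} → ConnectedList l → Connected (G [ set l ])
  connectedList {l} (r , r∈ , walk) = (r , ∈-set⁺ r∈) , λ (y , y∈) (z , z∈) →
    walk-in (set l) ∈-set⁺ (walk-sym G r∈ (walk (∈-set⁻ y∈)) ◅◅ walk (∈-set⁻ z∈))

  clique-minor : ∀ Bs → All ConnectedList Bs → AllPairs Joined Bs → K (length Bs) ≼ G
  clique-minor Bs conn joined = record
    { B = λ i → set (lookup Bs i)
    ; connected = λ i → connectedList (All.lookup conn (∈-lookup i))
    ; disjoint = λ {i} {j} i≢j (z , z∈) →
        let z∈i , z∈j = x∈p∩q⁻ _ _ z∈ in proj₁ (pair joined i≢j) (∈-set⁻ z∈i) (∈-set⁻ z∈j)
    ; joined = λ {i} {j} i≢j → let x , y , x∈ , y∈ , x~y = proj₂ (pair joined i≢j) in x , y , ∈-set⁺ x∈ , ∈-set⁺ y∈ , x~y }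
    where
    swap : ∀ {k l} → Joined k l → Joined l k
    swap (d , x , y , x∈ , y∈ , x~y) = (λ z∈l z∈k → d z∈k z∈l) , y , x , y∈ , x∈ , ~-sym x~y
    pair : ∀ {Bs} → AllPairs Joined Bs → ∀ {i j} → i ≢ j → Joined (lookup Bs i) (lookup Bs j)
    pair (j ∷ js) {zero} {zero} i≢j = ⊥-elim (i≢j refl)
    pair (j ∷ js) {zero} {suc _} _ = All.lookup j (∈-lookup _)
    pair (j ∷ js) {suc _} {zero} _ = swap (All.lookup j (∈-lookup _))
    pair (j ∷ js) {suc _} {suc _} i≢j = pair js (i≢j ∘ cong suc)

  another-nbr : ∀ {U x} ys → length ys < length (nbrs G U x) → ∃[ y ] y ∈ˢ U × x ~ y × y ∉ ys
  another-nbr {U} {x} ys lt with Any.any? (λ y → ¬? (y ∈? ys)) (nbrs G U x)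
  ... | yes q = let y , y∈ , y∉ = find q ; y∈U , x~y = nbrs⁻ G {U} y∈ in y , y∈U , x~y , y∉
  ... | no ¬q = ⊥-elim (ℕ.<⇒≱ lt (unique-⊆⇒length≤ (nbrs-unique G U x)
                  (λ {z} z∈ → decidable-stable (z ∈? ys) (λ z∉ → ¬q (lose z∈ z∉)))))

  module _ (U : Subset n) where

    -- A cycle formed by the path c from x to q and a vertex z, with a path t attached at z.
    record Lasso (m : ℕ) : Set where
      field
        {x q z e} : V
        {c t}     : List V
        arc       : Trail x q c
        tail      : Trail z e t
        x≢q       : x ≢ q
        x~z       : x ~ z
        q~z       : q ~ z
        c∩t       : ∀ {u} → u ∈ c → u ∉ t
        c⊆U       : ∀ {u} → u ∈ c → u ∈ˢ U
        t⊆U       : ∀ {u} → u ∈ t → u ∈ˢ U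
        total     : length c + length t ≡ m

    Path≥ : ℕ → Set
    Path≥ m = ∃[ x ] ∃[ y ] ∃[ l ] Trail x y l × (∀ {u} → u ∈ l → u ∈ˢ U) × length l ≡ m

    flip-lasso : ∀ {m} → Lasso m → Lasso m
    flip-lasso L = record
      { arc = trail-reverse arc ; tail = tail ; x≢q = x≢q ∘ sym ; x~z = q~z ; q~z = x~z
      ; c∩t = c∩t ∘ Any.reverse⁻ ; c⊆U = c⊆U ∘ Any.reverse⁻ ; t⊆U = t⊆U
      ; total = trans (cong (_+ length t) (length-reverse c)) total }
      where open Lasso L

    -- A second neighbour `y` of the first vertex either lies on the path and closes a cycle, with
    -- the path from `y` on as tail, or it prolongs the path.
    close-up : ∀ {x w y e l} → x ~ w → x ∉ l → Trail w e l → (∀ {u} → u ∈ x ∷ l → u ∈ˢ U) →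
               x ~ y → y ∈ˢ U → y ≢ w → Lasso (suc (length l)) ⊎ Path≥ (suc (suc (length l)))
    close-up {x} {w} {y} {l = l} x~w x∉ t l⊆U x~y y∈U y≢w with y ∈? l
    ... | no y∉ = inj₂ (y , _ , _ , cons (~-sym x~y) (λ { (here refl) → ~-irrefl refl x~y ; (there y∈) → y∉ y∈ })
                         (cons x~w x∉ t) , (λ { (here refl) → y∈U ; (there u∈) → l⊆U u∈ }) , refl)
    ... | yes y∈ with trail-split t y∈ y≢w
    ...   | p , k , m , K , p~y , M , k⊆ , m⊆ , k∩m , e = inj₁ record
            { arc = cons x~w (x∉ ∘ k⊆) K ; tail = M ; x≢q = λ { refl → x∉ (k⊆ (end∈ K)) }
            ; x~z = x~y ; q~z = p~y
            ; c∩t = λ { (here refl) → x∉ ∘ m⊆ ; (there u∈) → k∩m u∈ }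
            ; c⊆U = λ { (here refl) → l⊆U (here refl) ; (there u∈) → l⊆U (there (k⊆ u∈)) }
            ; t⊆U = l⊆U ∘ there ∘ m⊆ ; total = cong suc e }

    lasso-or-longer : (∀ {x} → x ∈ˢ U → 2 ≤ length (nbrs G U x)) → ∀ {m} → Path≥ m → Lasso m ⊎ Path≥ (suc m)
    lasso-or-longer deg (x , _ , _ , single _ , l⊆U , refl) with another-nbr [] (ℕ.≤-trans (s≤s z≤n) (deg (l⊆U (here refl))))
    ... | y , y∈ , x~y , _ = inj₂ (y , x , _ , cons (~-sym x~y) (λ { (here refl) → ~-irrefl refl x~y }) (single x)
                                  , (λ { (here refl) → y∈ ; (there u∈) → l⊆U u∈ }) , refl)
    lasso-or-longer deg (x , _ , _ , cons {y = w} x~w x∉ t , l⊆U , refl) with another-nbr (w ∷ []) (deg (l⊆U (here refl)))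
    ... | y , y∈ , x~y , y∉ = close-up x~w x∉ t l⊆U x~y y∈ (λ { refl → y∉ (here refl) })

    -- The branch sets are `x`, the rest of the arc and the tail.
    lasso-minor : ∀ {m} → Lasso m → K 3 ≼ G
    lasso-minor record { arc = single _ ; x≢q = x≢q } = ⊥-elim (x≢q refl)
    lasso-minor record { x = x ; arc = cons x~w x∉ c ; tail = t ; x~z = x~z ; q~z = q~z ; c∩t = c∩t } =
      clique-minor ((x ∷ []) ∷ _ ∷ _ ∷ [])
        (single-connected x ∷ trail-connected c ∷ trail-connected t ∷ [])
        ((((λ { (here refl) → x∉ }) , _ , _ , here refl , start∈ c , x~w)
          ∷ ((λ { (here refl) → c∩t (here refl) }) , _ , _ , here refl , start∈ t , x~z) ∷ [])
        ∷ ((c∩t ∘ there , _ , _ , end∈ c , start∈ t , q~z) ∷ [])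
        ∷ [] ∷ [])

    private
      too-long : ∀ {m} → n < m → ¬ Path≥ m
      too-long n<m (_ , _ , _ , t , _ , refl) = ℕ.<⇒≱ n<m (trail-length t)

    -- The number `k` bounds how often the path can still be lengthened: no path has more than `n`
    -- vertices, so a lasso appears in time.
    triangle-minor : (∀ {x} → x ∈ˢ U → 2 ≤ length (nbrs G U x)) → ∀ k {m} → n < k + m → Path≥ m → K 3 ≼ G
    triangle-minor deg zero n<m P = ⊥-elim (too-long n<m P)
    triangle-minor deg (suc k) {m} n<m P with lasso-or-longer deg P
    ... | inj₁ L = lasso-minor L
    ... | inj₂ P′ = triangle-minor deg k (subst (n <_) (sym (ℕ.+-suc k m)) n<m) P′

    module _ (deg : ∀ {x} → x ∈ˢ U → 3 ≤ length (nbrs G U x)) where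

      -- A third neighbour of `x`, besides its successor on the arc and `z`, is sought. Off the
      -- lasso it prolongs the path through arc and tail; on the arc it is a chord that shortens the
      -- cycle, and the part cut off goes to the tail with the total unchanged; on the tail it is
      -- what `both-ends` wants.
      probe : ∀ {m} (L : Lasso m) → (Σ (Lasso m) λ L′ → length (Lasso.c L′) < length (Lasso.c L)) ⊎ Path≥ (suc m) ⊎
              (∃[ y ] y ∈ Lasso.t L × y ≢ Lasso.z L × Lasso.x L ~ y)
      probe record { arc = single _ ; x≢q = x≢q } = ⊥-elim (x≢q refl)
      probe {m} record { x = x ; z = z ; t = t ; arc = cons {y = w} {l = c} x~w x∉ c′ ; tail = t′ ; x≢q = x≢q ; x~z = x~z ; q~z = q~z
                   ; c∩t = c∩t ; c⊆U = c⊆U ; t⊆U = t⊆U ; total = refl } with another-nbr (w ∷ z ∷ []) (deg (c⊆U (here refl)))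
      ... | y , y∈U , x~y , y∉ with y ∈? t | y ∈? c
      ...   | yes y∈ | _ = inj₂ (inj₂ (y , y∈ , (λ { refl → y∉ (here₁ refl) }) , x~y))
      ...   | no y∉t | no y∉c = inj₂ (inj₁ (y , _ , _
              , cons (~-sym x~y) (λ { (here refl) → ~-irrefl refl x~y ; (there y∈) → [ y∉c , y∉t ]′ (∈-++⁻ c y∈) })
                  (trail-++ (cons x~w x∉ c′) t′ q~z c∩t)
              , (λ { (here refl) → y∈U ; (there u∈) → [ c⊆U , t⊆U ]′ (∈-++⁻ (x ∷ c) u∈) })
              , cong (λ i → suc (suc i)) (length-++ c {t})))
      ...   | no y∉t | yes y∈ with trail-split c′ y∈ (λ { refl → y∉ (here refl) })
      ...     | p , k , l , K , p~y , M , k⊆ , l⊆ , k∩l , e = inj₁ (record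
                { arc = cons x~w (x∉ ∘ k⊆) K ; tail = trail-++ M t′ q~z (c∩t ∘ there ∘ l⊆)
                ; x≢q = λ { refl → x∉ (k⊆ (end∈ K)) } ; x~z = x~y ; q~z = p~y
                ; c∩t = λ { (here refl) u∈ → [ x∉ ∘ l⊆ , c∩t (here refl) ]′ (∈-++⁻ l u∈)
                          ; (there u∈k) u∈ → [ k∩l u∈k , c∩t (there (k⊆ u∈k)) ]′ (∈-++⁻ l u∈) }
                ; c⊆U = λ { (here refl) → c⊆U (here refl) ; (there u∈) → c⊆U (there (k⊆ u∈)) }
                ; t⊆U = λ u∈ → [ c⊆U ∘ there ∘ l⊆ , t⊆U ]′ (∈-++⁻ l u∈)
                ; total = cong suc (trans (cong (length k +_) (length-++ l))
                            (trans (sym (ℕ.+-assoc (length k) _ _)) (cong (_+ length t) e))) }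
                , s≤s (ℕ.<-≤-trans (ℕ.m<m+n (length k) (nonempty M)) (ℕ.≤-reflexive e)))
        where
        nonempty : ∀ {x y l} → Trail x y l → 0 < length l
        nonempty (single _) = s≤s z≤n
        nonempty (cons _ _ _) = s≤s z≤n

      -- Besides `x` and `z`, the branch sets are the rest of the arc, which contains `q`, and the
      -- rest of the tail, in which both `x` and `q` have neighbours.
      both-ends : ∀ {m} (L : Lasso m) → let open Lasso L in
                  ∃[ y ] y ∈ t × y ≢ z × x ~ y → ∃[ y ] y ∈ t × y ≢ z × q ~ y → K 4 ≼ G
      both-ends record { arc = single _ ; x≢q = x≢q } = ⊥-elim (x≢q refl)
      both-ends record { tail = single _ } (_ , here e , y≢z , _) = ⊥-elim (y≢z e)
      both-ends record { tail = cons _ _ _ } (_ , here e , y≢z , _) = ⊥-elim (y≢z e)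
      both-ends record { tail = cons _ _ _ } _ (_ , here e , y≢z , _) = ⊥-elim (y≢z e)
      both-ends record { x = x ; z = z ; arc = cons x~w x∉ c ; tail = cons z~s z∉ t ; x~z = x~z ; q~z = q~z ; c∩t = c∩t }
                (y , there y∈ , _ , x~y) (y′ , there y′∈ , _ , q~y′) =
        clique-minor ((x ∷ []) ∷ (z ∷ []) ∷ _ ∷ _ ∷ [])
          (single-connected x ∷ single-connected z ∷ trail-connected c ∷ trail-connected t ∷ [])
          ((((λ { (here refl) (here refl) → ~-irrefl refl x~z }) , _ , _ , here refl , here refl , x~z)
            ∷ ((λ { (here refl) → x∉ }) , _ , _ , here refl , start∈ c , x~w)
            ∷ ((λ { (here refl) → c∩t (here refl) ∘ there }) , _ , _ , here refl , y∈ , x~y) ∷ [])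
          ∷ (((λ { (here refl) z∈ → c∩t (there z∈) (here refl) }) , _ , _ , here refl , end∈ c , ~-sym q~z)
            ∷ ((λ { (here refl) → z∉ }) , _ , _ , here refl , start∈ t , z~s) ∷ [])
          ∷ (((λ u∈ → c∩t (there u∈) ∘ there) , _ , _ , end∈ c , y′∈ , q~y′) ∷ [])
          ∷ [] ∷ [])

      -- Lengthening the path and, for a given length, shortening the cycle must end.
      tetrahedron-minor : ∀ k {m} → n < k + m → Path≥ m → K 4 ≼ G
      tetrahedron-minor zero n<m P = ⊥-elim (too-long n<m P)
      tetrahedron-minor (suc k) {m} n<m P with lasso-or-longer (ℕ.≤-trans (ℕ.n≤1+n 2) ∘ deg) P
      ... | inj₂ P′ = tetrahedron-minor k (subst (n <_) (sym (ℕ.+-suc k m)) n<m) P′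
      ... | inj₁ L = improve L (<-wellFounded _)
        where
        longer : Path≥ (suc m) → K 4 ≼ G
        longer = tetrahedron-minor k (subst (n <_) (sym (ℕ.+-suc k m)) n<m)
        improve : (L : Lasso m) → Acc _<_ (length (Lasso.c L)) → K 4 ≼ G
        improve L (acc rs) with probe L | probe (flip-lasso L)
        ... | inj₁ (L′ , lt) | _ = improve L′ (rs lt)
        ... | inj₂ (inj₁ P) | _ = longer P
        ... | _ | inj₁ (L′ , lt) = improve L′ (rs (ℕ.<-≤-trans lt (ℕ.≤-reflexive (length-reverse (Lasso.c L)))))
        ... | _ | inj₂ (inj₁ P) = longer P
        ... | inj₂ (inj₂ y) | inj₂ (inj₂ y′) = both-ends L y y′

    min-degree-minor : ∀ h → h ≤ 3 → (∀ {x} → x ∈ˢ U → h ≤ length (nbrs G U x)) → ∀ {r} → r ∈ˢ U → K (suc h) ≼ G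
    min-degree-minor 0 _ _ {r} _ = clique-minor ((r ∷ []) ∷ []) (single-connected r ∷ []) ([] ∷ [])
    min-degree-minor 1 _ deg {r} r∈ with another-nbr [] (deg r∈)
    ... | y , _ , r~y , _ = clique-minor ((r ∷ []) ∷ (y ∷ []) ∷ []) (single-connected r ∷ single-connected y ∷ [])
      ((((λ { (here refl) (here refl) → ~-irrefl refl r~y }) , r , y , here refl , here refl , r~y) ∷ []) ∷ [] ∷ [])
    min-degree-minor 2 _ deg {r} r∈ = triangle-minor deg n (ℕ.m<m+n n (s≤s z≤n))
      (r , r , r ∷ [] , single r , (λ { (here refl) → r∈ }) , refl)
    min-degree-minor 3 _ deg {r} r∈ = tetrahedron-minor deg n (ℕ.m<m+n n (s≤s z≤n))
      (r , r , r ∷ [] , single r , (λ { (here refl) → r∈ }) , refl)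
    min-degree-minor (suc (suc (suc (suc _)))) (s≤s (s≤s (s≤s ())))

  -- A vertex with fewer than `suc h` neighbours in `U` can be coloured last. If there is none, `U`
  -- is empty or has minimum degree at least `suc h`, and then the excluded minor appears.
  colour-small : ∀ {h} → suc h ≤ 3 → ¬ K (suc (suc h)) ≼ G → ∀ U → Acc _<_ ∣ U ∣ → ColourableOn G U (suc h)
  colour-small {h} h<3 no-minor U (acc rs) with any? (λ x → x ∈ˢ? U ×-dec length (nbrs G U x) <? suc h)
  ... | yes (x , x∈ , low) = colour-low-degree G (colour-small h<3 no-minor (U ∖ x) (rs (p⊂q⇒∣p∣<∣q∣ (∖-⊂ x∈)))) low
  ... | no ¬x with any? (_∈ˢ? U)
  ...   | yes (r , r∈) = ⊥-elim (no-minor (min-degree-minor U (suc h) h<3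
            (λ {x} x∈ → ℕ.≮⇒≥ (λ low → ¬x (x , x∈ , low))) r∈))
  ...   | no ¬r = (λ _ → zero) , λ u∈ _ _ _ → ¬r (_ , u∈)

-- Cycles and solids of complete graphs

-- In a complete graph all other vertices are neighbours of `z`, so these data leave room for
-- exactly four vertices.
record Small (H : Graph A) : Set where
  open Graph H
  field
    verts    : List A
    distinct : Unique verts
    four     : length verts ≡ 4
    z a b c  : A
    degree≤3 : ∀ {w} → z ~ w → w ∈ a ∷ b ∷ c ∷ []

module _ {H : Graph A} where
  open Graph H

  edge-vertex : ∀ {x y} (P : Path H x y) {u v} → edge ⟦ P ⟧ᵖ u v → vertex ⟦ P ⟧ᵖ u
  edge-vertex P (i , inj₁ (e , _)) = inject₁ i , e
  edge-vertex P (i , inj₂ (_ , e)) = suc i , e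

  path-second : ∀ {x y} (P : Path H x y) → 1 ≤ len P →
                ∃[ s ] vertex ⟦ P ⟧ᵖ s × s ≢ x × (2 ≤ len P → s ≢ y) × (∀ {v} → edge ⟦ P ⟧ᵖ x v → v ≡ s)
  path-second record { len = suc k ; at = at ; injective = inj ; start = refl ; end = refl } _ =
    at 1F , (1F , refl) , (λ e → 1≢0 (inj e)) , (λ { (s≤s (s≤s z≤n)) e → 1≢last (inj e) }) , only
    where
    1≢0 : ∀ {m} → Fin.suc {suc m} zero ≢ zero
    1≢0 ()
    1≢last : ∀ {m} → Fin.suc {suc (suc m)} zero ≢ suc (suc (fromℕ m))
    1≢last ()
    only : ∀ {v} → _ → v ≡ at 1F
    only (zero , inj₁ (_ , e)) = sym e
    only (suc i , inj₁ (e , _)) with inj e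
    ... | ()
    only (i , inj₂ (_ , e)) with inj e
    ... | ()

  corner-inj : (T : Triangle H) → ∀ {i j} → corner T i ≡ corner T j → i ≡ j
  corner-inj T {i} {j} e = decidable-stable (i Fin.≟ j) (λ i≢j → ~-irrefl e (Triangle.adjacent T i≢j))

  corners-unique : (T : Triangle H) → Unique (corner T 0F ∷ corner T 1F ∷ corner T 2F ∷ [])
  corners-unique T = (ne (λ ()) ∷ ne (λ ()) ∷ []) ∷ (ne (λ ()) ∷ []) ∷ [] ∷ []
    where
    ne : ∀ {i j} → i ≢ j → corner T i ≢ corner T j
    ne i≢j = i≢j ∘ corner-inj T

  triangle-nbrs : (T : Triangle H) → ∀ {v s} → edge ⟦ T ⟧ᵗ (corner T 0F) v → v ∈ corner T 1F ∷ corner T 2F ∷ s ∷ []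
  triangle-nbrs T (i , j , i≢j , e , refl) with corner-inj T e
  triangle-nbrs T (i , 0F , i≢j , e , refl) | refl = ⊥-elim (i≢j refl)
  triangle-nbrs T (i , 1F , i≢j , e , refl) | refl = here refl
  triangle-nbrs T (i , 2F , i≢j , e , refl) | refl = here₁ refl

  -- The vertex of degree at most three is a rim vertex of a pyramid, an end of a trihedron, or a
  -- triangle corner of a stamp or prism. Four vertices are the hub with three feet, the ends with
  -- two inner vertices, or a triangle with one vertex off it.
  solid-small : IsSolid H → Small H
  solid-small (inj₁ record { C = record { path = P@(record { len = suc (suc k) ; at = at ; injective = inj ; start = refl ; end = refl })
                                        ; 2≤len = s≤s (s≤s _) ; close = close }
                           ; w = w ; w∉C = w∉C ; foot = foot ; foot-inj = foot-inj ; foot∈C = foot∈C ; union = _ , edges }) = record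
    { verts = w ∷ foot 0F ∷ foot 1F ∷ foot 2F ∷ []
    ; distinct = (off 0F ∷ off 1F ∷ off 2F ∷ [])
               ∷ ((λ e → 0≢1 (foot-inj e)) ∷ (λ e → 0≢2 (foot-inj e)) ∷ []) ∷ ((λ e → 1≢2 (foot-inj e)) ∷ []) ∷ [] ∷ []
    ; four = refl ; z = at zero ; a = at 1F ; b = at (fromℕ _) ; c = w
    ; degree≤3 = λ z~v → nbr (Equivalence.to (edges _ _) z~v) }
    where
    0≢1 : 0F ≢ Fin.suc {2} 0F
    0≢1 ()
    0≢2 : 0F ≢ Fin.suc {2} 1F
    0≢2 ()
    1≢2 : Fin.suc {2} 0F ≢ 2F
    1≢2 ()
    off : ∀ i → w ≢ foot i
    off i e = w∉C (subst (vertex ⟦ P ⟧ᵖ) (sym e) (foot∈C i))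
    nbr : ∀ {v} → _ → v ∈ at 1F ∷ at (fromℕ _) ∷ w ∷ []
    nbr (inj₁ (inj₁ e)) = here (proj₂ (proj₂ (proj₂ (proj₂ (path-second P (s≤s z≤n))))) e)
    nbr (inj₁ (inj₂ (inj₁ (_ , e)))) = here₁ e
    nbr (inj₁ (inj₂ (inj₂ (e , _)))) = ⊥-elim (0≢last (inj e))
      where
      0≢last : ∀ {m} → Fin.zero {suc m} ≢ suc (fromℕ m)
      0≢last ()
    nbr (inj₂ (_ , inj₁ (e , _))) = ⊥-elim (w∉C (zero , e))
    nbr (inj₂ (_ , inj₂ (e , _))) = here₂ e
  solid-small (inj₂ (inj₁ record { x = x ; y = y ; x≢y = x≢y ; P = P ; 2≤len = 2≤len ; interior = interior ; union = _ , edges })) =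
    record
      { verts = x ∷ y ∷ s 0F ∷ s 1F ∷ []
      ; distinct = (x≢y ∷ (s≢x 0F ∘ sym) ∷ (s≢x 1F ∘ sym) ∷ []) ∷ ((s≢y 0F ∘ sym) ∷ (s≢y 1F ∘ sym) ∷ []) ∷ (s₀≢s₁ ∷ []) ∷ [] ∷ []
      ; four = refl ; z = x ; a = s 0F ; b = s 1F ; c = s 2F
      ; degree≤3 = λ z~v → nbr (Equivalence.to (edges _ _) z~v) }
    where
    sec : ∀ i → _
    sec i = path-second (P i) (ℕ.≤-trans (s≤s z≤n) (2≤len i))
    s : Fin 3 → A
    s i = proj₁ (sec i)
    s≢x : ∀ i → s i ≢ x
    s≢x i = proj₁ (proj₂ (proj₂ (sec i)))
    s≢y : ∀ i → s i ≢ y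
    s≢y i = proj₁ (proj₂ (proj₂ (proj₂ (sec i)))) (2≤len i)
    s₀≢s₁ : s 0F ≢ s 1F
    s₀≢s₁ e = interior {0F} {1F} (λ ()) (proj₁ (proj₂ (sec 0F))) (s≢x 0F) (s≢y 0F)
                (subst (vertex ⟦ P 1F ⟧ᵖ) (sym e) (proj₁ (proj₂ (sec 1F))))
    only : ∀ i {v} → edge ⟦ P i ⟧ᵖ x v → v ≡ s i
    only i = proj₂ (proj₂ (proj₂ (proj₂ (sec i))))
    nbr : ∀ {v} → ∃[ i ] edge ⟦ P i ⟧ᵖ x v → v ∈ s 0F ∷ s 1F ∷ s 2F ∷ []
    nbr (0F , e) = here (only 0F e)
    nbr (1F , e) = here₁ (only 1F e)
    nbr (2F , e) = here₂ (only 2F e)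
  solid-small (inj₂ (inj₂ (inj₁ record { T = T ; x = x ; x∉T = x∉T ; P = P ; 1≤len = 1≤len ; P∩T = P∩T ; union = _ , edges }))) =
    record
      { verts = x ∷ corner T 0F ∷ corner T 1F ∷ corner T 2F ∷ []
      ; distinct = ((λ e → x∉T (_ , sym e)) ∷ (λ e → x∉T (_ , sym e)) ∷ (λ e → x∉T (_ , sym e)) ∷ []) ∷ corners-unique T
      ; four = refl ; z = corner T 0F ; a = corner T 1F ; b = corner T 2F ; c = proj₁ sec
      ; degree≤3 = λ z~v → nbr (Equivalence.to (edges _ _) z~v) }
    where
    sec = path-second (P 0F) (1≤len 0F)
    nbr : ∀ {v} → edge (⟦ T ⟧ᵗ ∪ ⋃ (λ i → ⟦ P i ⟧ᵖ)) (corner T 0F) v → v ∈ corner T 1F ∷ corner T 2F ∷ proj₁ sec ∷ []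
    nbr (inj₁ e) = triangle-nbrs T e
    nbr (inj₂ (i , e)) with corner-inj T (P∩T i (edge-vertex (P i) e) (0F , refl))
    ... | refl = here₂ (proj₂ (proj₂ (proj₂ (proj₂ sec))) e)
  solid-small (inj₂ (inj₂ (inj₂ record { T = T ; T′ = T′ ; T∩T′ = T∩T′ ; P = P ; disjoint = disjoint ; union = _ , edges }))) =
    record
      { verts = corner T′ 0F ∷ corner T 0F ∷ corner T 1F ∷ corner T 2F ∷ []
      ; distinct = (off ∷ off ∷ off ∷ []) ∷ corners-unique T
      ; four = refl ; z = corner T 0F ; a = corner T 1F ; b = corner T 2F ; c = proj₁ sec
      ; degree≤3 = λ z~v → nbr (Equivalence.to (edges _ _) z~v) }
    where
    off : ∀ {i} → corner T′ 0F ≢ corner T i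
    off e = T∩T′ (_ , refl) (0F , e)
    sec = path-second (P 0F) (1≤len (P 0F) (off ∘ sym))
    on-start : ∀ {i} → vertex ⟦ P i ⟧ᵖ (corner T 0F) → i ≡ 0F
    on-start {i} on = decidable-stable (i Fin.≟ 0F) (λ i≢0 → disjoint i≢0 on (zero , Path.start (P 0F)))
    nbr : ∀ {v} → edge (⟦ T ⟧ᵗ ∪ ⟦ T′ ⟧ᵗ ∪ ⋃ (λ i → ⟦ P i ⟧ᵖ)) (corner T 0F) v → v ∈ corner T 1F ∷ corner T 2F ∷ proj₁ sec ∷ []
    nbr (inj₁ e) = triangle-nbrs T e
    nbr (inj₂ (inj₁ (i , _ , _ , e , _))) = ⊥-elim (T∩T′ (_ , refl) (i , e))
    nbr (inj₂ (inj₂ (i , e))) with on-start (edge-vertex (P i) e)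
    ... | refl = here₂ (proj₂ (proj₂ (proj₂ (proj₂ sec))) e)

HasElements : ℕ → Subset n → Set
HasElements r S = ∃[ l ] Unique l × length l ≡ r × (∀ {z} → z ∈ l → z ∈ˢ S) × (∀ {z} → z ∈ˢ S → z ∈ l)

module _ {L : List (Subset n)} {r} (L-unique : Unique L) (sized : ∀ {S} → S ∈ L → HasElements r S) where

  private
    exhausted : ∀ {S ys hi} → S ∈ L → Unique ys → length ys ≡ r → Between ys hi S → ∀ {z} → z ∈ˢ S → z ∈ ys
    exhausted {ys = ys} S∈ u e (between l _) {z} z∈ with sized S∈
    ... | zs , _ , e′ , _ , S⊆zs = decidable-stable (z ∈? ys) λ z∉ →
      ℕ.<⇒≱ (s≤s (ℕ.≤-reflexive (trans e′ (sym e))))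
        (unique-⊆⇒length≤ {xs = z ∷ ys} {ys = zs} (All.tabulate (λ { w∈ refl → z∉ w∈ }) ∷ u) λ { (here refl) → S⊆zs z∈ ; (there w∈) → S⊆zs (l w∈) })

    -- The vertices `ys` are decided to belong to the set, those of `xs` are undecided, and `j`
    -- elements are still missing; `cnt-split` at the next undecided vertex becomes Pascal's rule.
    bound : ∀ xs ys {hi} j → length ys + j ≡ r → Unique xs → Unique ys → (∀ {z} → z ∈ xs → z ∉ ys) →
            (∀ {z} → z ∈ˢ hi → z ∈ ys ⊎ z ∈ xs) → cnt L ys hi ≤ length xs choose j
    bound xs ys zero e _ u _ _ = ℕ.≤-trans
      (cnt≤1 L L-unique λ S∈ T∈ s t →
        ⊆-antisym (Between.lo⊆ t ∘ exhausted S∈ u e′ s) (Between.lo⊆ s ∘ exhausted T∈ u e′ t))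
      (ℕ.≤-reflexive (sym (choose-0 (length xs))))
      where
      e′ : length ys ≡ r
      e′ = trans (sym (ℕ.+-identityʳ _)) e
    bound [] ys (suc j) e _ u _ hi⊆ = ℕ.≤-trans (ℕ.≤-reflexive (cnt≡0 L none)) z≤n
      where
      none : ∀ {S} → S ∈ L → ¬ Between ys _ S
      none S∈ (between _ h) with sized S∈
      ... | zs , uz , e′ , zs⊆ , _ = ℕ.<⇒≱ (ℕ.<-≤-trans (ℕ.m<m+n (length ys) (s≤s z≤n)) (ℕ.≤-reflexive (trans e (sym e′))))
        (unique-⊆⇒length≤ uz (λ z∈ → [ id , (λ ()) ]′ (hi⊆ (h (zs⊆ z∈)))))
    bound (x ∷ xs) ys {hi} (suc j) e (x≢ ∷ uxs) u dis hi⊆ = begin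
      cnt L ys hi                              ≡⟨ cnt-split L ys hi x ⟩
      cnt L (x ∷ ys) hi + cnt L ys (hi ∖ x)    ≤⟨ ℕ.+-mono-≤
        (bound xs (x ∷ ys) j (trans (sym (ℕ.+-suc _ j)) e) uxs (All.tabulate (λ { z∈ refl → dis (here refl) z∈ }) ∷ u)
          (λ { z∈ (here refl) → All.lookup x≢ z∈ refl ; z∈ (there z∈ys) → dis (there z∈) z∈ys })
          (λ z∈ → [ inj₁ ∘ there , (λ { (here e) → inj₁ (here e) ; (there z∈) → inj₂ z∈ }) ]′ (hi⊆ z∈)))
        (bound xs ys (suc j) e uxs u (dis ∘ there)
          (λ z∈ → let z∈hi , z≢x = ∈-∖⁻ z∈ in
             [ inj₁ , (λ { (here e) → ⊥-elim (z≢x e) ; (there z∈) → inj₂ z∈ }) ]′ (hi⊆ z∈hi))) ⟩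
      length xs choose j + length xs choose suc j ≡⟨ sym (pascal (length xs) j) ⟩
      suc (length xs) choose suc j ∎
      where open ℕ.≤-Reasoning

  few-sets : length L ≤ n choose r
  few-sets = ℕ.≤-trans (ℕ.≤-reflexive (sym (cnt-full L)))
    (ℕ.≤-trans (bound (allFin n) [] r refl (allFin⁺ n) [] (λ _ ()) (λ {z} _ → inj₂ (∈-allFin z)))
      (ℕ.≤-reflexive (cong (_choose r) (length-tabulate {n = n} id))))

module _ {h : ℕ} where

  private
    module G = Graph (K h)

  complete-cycle : ∀ {S} → InducedCycle (K h) S → HasElements 3 S
  complete-cycle {S} cyc with cycle⇒hole cyc
  ... | (v , v∈) , _ with cycleAt (K h) cyc v∈
  ...   | record { hole = record { rim = single _ ; a≢b = a≢b } } = ⊥-elim (a≢b refl)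
  ...   | record { a = a ; b = b ; covers = covers ; covers⁻ = covers⁻ ; hole = record
            { rim = cons {l = l} a~y a∉ only p ; v∉ = v∉ ; v~a = v~a ; v~b = v~b ; a≢b = a≢b } } =
    v ∷ a ∷ b ∷ [] , (v~a ∷ v~b ∷ []) ∷ (a≢b ∷ []) ∷ [] ∷ [] , refl
    , (λ { (here refl) → covers⁻ (here refl) ; (here₁ refl) → covers⁻ (here₁ refl)
         ; (here₂ refl) → covers⁻ (there (there (last∈ p))) })
    , λ z∈ → shrink (covers z∈)
    where
    shrink : ∀ {z} → z ∈ v ∷ a ∷ l → z ∈ v ∷ a ∷ b ∷ []
    shrink (here e) = here e
    shrink (here₁ e) = here₁ e
    -- In a complete graph `a` sees every later vertex of the rim, but on an induced path it sees
    -- only its successor. So there is one later vertex, and it is `b`.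
    shrink (there (there z∈)) = here₂ (trans (only z∈ (λ { refl → a∉ z∈ })) (sym (only (last∈ p) a≢b)))

  complete-solid : ∀ {S} → Solid (K h) S → HasElements 4 S
  complete-solid {S} sol = map proj₁ verts , unique-map⁺ (vertex-≡ (K h) {S}) distinct , trans (length-map proj₁ verts) four
    , (λ z∈ → in-S (∈-map⁻ proj₁ z∈))
    , λ {u} u∈ → decidable-stable (u ∈? map proj₁ verts) λ u∉ →
        ℕ.<⇒≱ (s≤s (ℕ.≤-reflexive (sym (trans (length-map proj₁ verts) four))))
          (unique-⊆⇒length≤ {xs = u ∷ map proj₁ verts} {ys = map proj₁ (z ∷ a ∷ b ∷ c ∷ [])}
            (All.tabulate (λ { w∈ refl → u∉ w∈ }) ∷ unique-map⁺ (vertex-≡ (K h) {S}) distinct)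
            λ { (here refl) → near (u , u∈) ; (there w∈) → near′ (∈-map⁻ proj₁ w∈) })
    where
    open Small (solid-small sol)
    in-S : ∀ {u} → ∃[ w ] w ∈ verts × u ≡ proj₁ w → u ∈ˢ S
    in-S ((_ , w∈) , _ , refl) = w∈
    near : ∀ w → proj₁ w ∈ map proj₁ (z ∷ a ∷ b ∷ c ∷ [])
    near w with proj₁ z Fin.≟ proj₁ w
    ... | yes e = here (sym e)
    ... | no z≢w = there (∈-map⁺ proj₁ (degree≤3 {w} z≢w))
    near′ : ∀ {u} → ∃[ w ] w ∈ verts × u ≡ proj₁ w → u ∈ map proj₁ (z ∷ a ∷ b ∷ c ∷ [])
    near′ (w , _ , refl) = near w

  -- Adjacency links any two vertices and makes every vertex a hub, so the lower bounds for linked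
  -- vertices also serve to count in Kʰ.
  complete-linked : ∀ {v U} → Linked (K h) v U
  complete-linked = record
    { linked = λ _ _ _ _ a≢b → edge-link (K h) a≢b
    ; linked₃ = λ _ _ _ v~a v~b v~c a≢b a≢c b≢c → hub (K h) (proj₂ ∘ proj₂) (λ (_ , v≢v , _) → v≢v refl)
        v~a v~b v~c a≢b a≢c b≢c a≢b a≢c (edge-link (K h) b≢c) }

  private
    Lists : List (Fin h) → Subset h → Set
    Lists xs U = Unique xs × (∀ {z} → z ∈ xs → z ∈ˢ U) × (∀ {z} → z ∈ˢ U → z ∈ xs)

    lists-nbrs : ∀ {v xs U} → Lists (v ∷ xs) U → Nbrs (K h) v U xs [] U
    lists-nbrs (v≢ ∷ u , xs⊆ , ⊆xs) = record
      { unique = u ; sound = λ z∈ → xs⊆ (there z∈) , All.lookup v≢ z∈ , λ () ; ex-sound = λ ()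
      ; complete = λ z∈ v≢z → inj₂ (tail v≢z (⊆xs z∈)) ; v∈ = xs⊆ (here refl) ; hi⊆ = id ; core = λ z∈ _ → z∈ }
      where
      tail : ∀ {v z : Fin h} {xs} → v ≢ z → z ∈ v ∷ xs → z ∈ xs
      tail v≢z (here e) = ⊥-elim (v≢z (sym e))
      tail _ (there z∈) = z∈

    lists-∖ : ∀ {v xs U} → Lists (v ∷ xs) U → Lists xs (U ∖ v)
    lists-∖ (v≢ ∷ u , xs⊆ , ⊆xs) = u , (λ z∈ → ∈-∖⁺ (xs⊆ (there z∈)) (λ { refl → All.lookup v≢ z∈ refl }))
      , λ z∈ → let z∈U , z≢v = ∈-∖⁻ z∈ in tail z≢v (⊆xs z∈U)
      where
      tail : ∀ {v z : Fin h} {xs} → z ≢ v → z ∈ v ∷ xs → z ∈ xs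
      tail z≢v (here e) = ⊥-elim (z≢v e)
      tail _ (there z∈) = z∈

    all-lists : Lists (allFin h) full
    all-lists = allFin⁺ h , (λ _ → ∈⊤) , λ {z} _ → ∈-allFin z

    length-allFin : length (allFin h) ≡ h
    length-allFin = length-tabulate {n = h} id

  module _ {Es : List (Subset h)} (Es-unique : Unique Es) (Es-complete : ∀ S → S ∈ Es ⇔ IsEdge (K h) S) where

    complete-edges : cnt Es [] full ≡ h choose 2
    complete-edges = trans (go (allFin h) all-lists) (cong (_choose 2) length-allFin)
      where
      go : ∀ xs {U} → Lists xs U → cnt Es [] U ≡ length xs choose 2
      go [] (_ , _ , none) = trans (cnt≡0 Es λ { S∈ (between _ h) → empty (Equivalence.to (Es-complete _) S∈) h }) (sym (0-choose 1))
        where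
        empty : ∀ {S} → IsEdge (K h) S → ¬ (∀ {z} → z ∈ˢ S → z ∈ˢ _)
        empty (u , w , _ , refl) h with none (h (∈-set⁺ (here refl)))
        ... | ()
      go (v ∷ xs) {U} l = trans (cnt-split Es [] U v)
        (trans (cong₂ _+_ (trans (degree-edges (K h) Es-unique Es-complete xs (lists-nbrs l)) (sym (choose-1 (length xs)))) (go xs (lists-∖ l)))
          (sym (pascal (length xs) 1)))

  module _ {Cs : List (Subset h)} (Cs-complete : ∀ S → S ∈ Cs ⇔ InducedCycle (K h) S) where

    -- Cycles enter ℶ³ negatively, so an upper estimate of ℶ³ for the complete graph needs a lower
    -- bound on their number.
    complete-cycles : h choose 3 ≤ length Cs
    complete-cycles = ℕ.≤-trans (ℕ.≤-reflexive (cong (_choose 3) (sym length-allFin)))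
      (ℕ.≤-trans (go (allFin h) all-lists) (ℕ.≤-reflexive (cnt-full Cs)))
      where
      open ℕ.≤-Reasoning
      go : ∀ xs {U} → Lists xs U → length xs choose 3 ≤ cnt Cs [] U
      go [] _ = ℕ.≤-trans (ℕ.≤-reflexive (0-choose 2)) z≤n
      go (v ∷ xs) {U} l = begin
        suc (length xs) choose 3                    ≡⟨ pascal (length xs) 2 ⟩
        length xs choose 2 + length xs choose 3     ≤⟨ ℕ.+-mono-≤ (cycles-through (K h) complete-linked Cs-complete xs (lists-nbrs l)) (go xs (lists-∖ l)) ⟩
        cnt Cs (v ∷ []) U + cnt Cs [] (U ∖ v)       ≡⟨ sym (cnt-split Cs [] U v) ⟩
        cnt Cs [] U ∎

-- Edges as two-element vertex sets

unique-map : {A B : Set} (f : A → B) → ∀ {xs} → Unique xs →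
             (∀ {x y} → x ∈ xs → y ∈ xs → f x ≡ f y → x ≡ y) → Unique (map f xs)
unique-map f [] inj = []
unique-map f {x ∷ xs} (x≢ ∷ u) inj = All.tabulate (λ z∈ → differ (∈-map⁻ f z∈))
  ∷ unique-map f u (λ y∈ z∈ → inj (there y∈) (there z∈))
  where
  differ : ∀ {z} → ∃[ y ] y ∈ xs × z ≡ f y → f x ≢ z
  differ (y , y∈ , refl) e = All.lookup x≢ y∈ (inj (here refl) (there y∈) e)

module _ (G : Graph (Fin n)) where
  open Graph G

  private
    isEdge? : (p : Fin n × Fin n) → Dec (proj₁ p Fin.< proj₂ p × proj₁ p ~ proj₂ p)
    isEdge? (u , v) = (u Fin.<? v) ×-dec (u ~? v)

    edge-pairs : List (Fin n × Fin n)
    edge-pairs = filter isEdge? (cartesianProduct (allFin n) (allFin n))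

    ends : Fin n × Fin n → Subset n
    ends (u , v) = set (u ∷ v ∷ [])

    set-swap : ∀ {u v : Fin n} → set (u ∷ v ∷ []) ≡ set (v ∷ u ∷ [])
    set-swap = ⊆-antisym (∈-set⁺ ∘ swap ∘ ∈-set⁻) (∈-set⁺ ∘ swap ∘ ∈-set⁻)
      where
      swap : ∀ {a b z : Fin n} → z ∈ a ∷ b ∷ [] → z ∈ b ∷ a ∷ []
      swap (here e) = here₁ e
      swap (here₁ e) = here e

  -- The bridge between `∣E∣`, which counts ordered pairs, and the counts by intervals of vertex
  -- sets.
  edge-sets : List (Subset n)
  edge-sets = map ends edge-pairs

  edge-sets-length : length edge-sets ≡ ∣E∣ G
  edge-sets-length = length-map ends edge-pairs

  edge-sets-unique : Unique edge-sets
  edge-sets-unique = unique-map ends (unique-filter⁺ isEdge? (cartesianProduct⁺ (allFin⁺ n) (allFin⁺ n)))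
    (λ {p} {q} p∈ q∈ e → same (ordered p p∈) (ordered q q∈) (λ z∈ → ∈-set⁻ (subst (_ ∈ˢ_) e (∈-set⁺ z∈)))
                                                         (λ z∈ → ∈-set⁻ (subst (_ ∈ˢ_) (sym e) (∈-set⁺ z∈))))
    where
    ordered : ∀ p → p ∈ edge-pairs → proj₁ p Fin.< proj₂ p
    ordered p p∈ = proj₁ (proj₂ (∈-filter⁻ isEdge? {xs = cartesianProduct (allFin n) (allFin n)} p∈))
    same : ∀ {p q} → proj₁ p Fin.< proj₂ p → proj₁ q Fin.< proj₂ q →
           (∀ {z} → z ∈ proj₁ p ∷ proj₂ p ∷ [] → z ∈ proj₁ q ∷ proj₂ q ∷ []) →
           (∀ {z} → z ∈ proj₁ q ∷ proj₂ q ∷ [] → z ∈ proj₁ p ∷ proj₂ p ∷ []) → p ≡ q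
    same {u , v} {u′ , v′} u<v u′<v′ f g with f (here refl) | f (here₁ refl)
    ... | here refl | here₁ refl = refl
    ... | here₁ refl | here refl = ⊥-elim (<-asym u<v u′<v′)
    ... | here refl | here refl = ⊥-elim (ℕ.<-irrefl refl u<v)
    ... | here₁ refl | here₁ refl = ⊥-elim (ℕ.<-irrefl refl u<v)

  edge-sets-complete : ∀ S → S ∈ edge-sets ⇔ IsEdge G S
  edge-sets-complete S = mk⇔ to from
    where
    to : S ∈ edge-sets → IsEdge G S
    to S∈ with ∈-map⁻ ends S∈
    ... | (u , v) , p∈ , e = u , v , proj₂ (proj₂ (∈-filter⁻ isEdge? {xs = cartesianProduct (allFin n) (allFin n)} p∈)) , e
    pair∈ : ∀ {u v} → u Fin.< v → u ~ v → ends (u , v) ∈ edge-sets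
    pair∈ {u} {v} u<v u~v = ∈-map⁺ ends (∈-filter⁺ isEdge? (∈-cartesianProduct⁺ (∈-allFin u) (∈-allFin v)) (u<v , u~v))
    from : IsEdge G S → S ∈ edge-sets
    from (u , v , u~v , refl) with <-cmp u v
    ... | tri< u<v _ _ = pair∈ u<v u~v
    ... | tri≈ _ refl _ = ⊥-elim (~-irrefl refl u~v)
    ... | tri> _ _ v<u = subst (_∈ edge-sets) set-swap (pair∈ v<u (~-sym u~v))

  cnt-edges : cnt edge-sets [] full ≡ ∣E∣ G
  cnt-edges = trans (cnt-full edge-sets) edge-sets-length

  connected⇒conn : Connected G → Conn G full
  connected⇒conn (_ , walk) {y} {z} _ _ = Star.map (λ e → e , ∈⊤) (walk y z)

complete-edge-count : ∀ h → ∣E∣ (K h) ≡ h choose 2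
complete-edge-count h = trans (sym (cnt-edges (K h)))
  (complete-edges (edge-sets-unique (K h)) (edge-sets-complete (K h)))

-- Comparison with the complete graph

choose-pos : ∀ {j m} → j ≤ m → 1 ≤ m choose j
choose-pos {zero} {m} _ = ℕ.≤-reflexive (sym (choose-0 m))
choose-pos {suc j} {suc m} (s≤s j≤m) = ℕ.≤-trans (choose-pos j≤m)
  (ℕ.≤-trans (ℕ.m≤m+n _ _) (ℕ.≤-reflexive (sym (pascal m j))))

-- From m = j on, C(m, j+1) grows strictly, because the increment C(m, j) is positive. Below that
-- all values are 0 and nothing could be cancelled.
choose-cancel : ∀ {k m} j → j ≤ m → k choose suc j ≤ m choose suc j → k ≤ m
choose-cancel {k} {m} j j≤m le with k ≤? m
... | yes k≤m = k≤m
... | no k≰m = ⊥-elim (ℕ.<⇒≱ (ℕ.<-≤-trans grows (choose-mono j (ℕ.≰⇒> k≰m))) le)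
  where
  grows : m choose suc j < suc m choose suc j
  grows = ℕ.≤-trans (ℕ.+-monoˡ-≤ _ (choose-pos j≤m)) (ℕ.≤-reflexive (sym (pascal m j)))

-- Equalities between differences of naturals, with all terms moved to the positive side.
cross : ∀ a b c d → ℤ.+ a ℤ.- ℤ.+ b ≡ ℤ.+ c ℤ.- ℤ.+ d → a + d ≡ c + b
cross a b c d e = ℤ.+-injective (begin
  ℤ.+ (a + d)                                      ≡⟨ ℤ.pos-+ a d ⟩
  ℤ.+ a ℤ.+ ℤ.+ d                                  ≡⟨ left (ℤ.+ a) (ℤ.+ b) (ℤ.+ d) ⟩
  (ℤ.+ a ℤ.- ℤ.+ b) ℤ.+ (ℤ.+ b ℤ.+ ℤ.+ d)          ≡⟨ cong (ℤ._+ (ℤ.+ b ℤ.+ ℤ.+ d)) e ⟩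
  (ℤ.+ c ℤ.- ℤ.+ d) ℤ.+ (ℤ.+ b ℤ.+ ℤ.+ d)          ≡⟨ right (ℤ.+ c) (ℤ.+ b) (ℤ.+ d) ⟩
  ℤ.+ c ℤ.+ ℤ.+ b                                  ≡⟨ sym (ℤ.pos-+ c b) ⟩
  ℤ.+ (c + b) ∎)
  where
  open Relation.Binary.PropositionalEquality.≡-Reasoning
  open ℤSolver.+-*-Solver
  left : ∀ x y z → x ℤ.+ z ≡ (x ℤ.- y) ℤ.+ (y ℤ.+ z)
  left = solve 3 (λ x y z → x :+ z := (x :- y) :+ (y :+ z)) refl
  right : ∀ x y z → (x ℤ.- z) ℤ.+ (y ℤ.+ z) ≡ x ℤ.+ y
  right = solve 3 (λ x y z → (x :- z) :+ (y :+ z) := x :+ y) refl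

private
  three-terms : ∀ c e v → ℤ.+ c ℤ.- ℤ.+ e ℤ.+ ℤ.+ v ≡ ℤ.+ (c + v) ℤ.- ℤ.+ e
  three-terms c e v = trans (solve 3 (λ x y z → x :- y :+ z := (x :+ z) :- y) refl (ℤ.+ c) (ℤ.+ e) (ℤ.+ v))
    (cong (ℤ._- ℤ.+ e) (sym (ℤ.pos-+ c v)))
    where open ℤSolver.+-*-Solver

  four-terms : ∀ s c e v → ℤ.+ s ℤ.- ℤ.+ c ℤ.+ ℤ.+ e ℤ.- ℤ.+ v ≡ ℤ.+ (s + e) ℤ.- ℤ.+ (c + v)
  four-terms s c e v = trans (solve 4 (λ w x y z → w :- x :+ y :- z := (w :+ y) :- (x :+ z)) refl (ℤ.+ s) (ℤ.+ c) (ℤ.+ e) (ℤ.+ v))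
    (cong₂ ℤ._-_ (sym (ℤ.pos-+ s e)) (sym (ℤ.pos-+ c v)))
    where open ℤSolver.+-*-Solver

open ℕ.≤-Reasoning

module _ {n} (G : Graph (Fin n)) (conn : Connected G) {h : ℕ} (3≤h : 3 ≤ h) where

  private
    E V Eₖ : ℕ
    E = ∣E∣ G
    V = n
    Eₖ = ∣E∣ (K (suc h))

    Eₖ≡ : Eₖ ≡ h + h choose 2
    Eₖ≡ = trans (complete-edge-count (suc h)) (trans (pascal h 1) (cong (_+ h choose 2) (choose-1 h)))

    -- The Hadwiger number is `suc h` and `suc k` colours are used. The bound 3 ≤ h is what
    -- `choose-cancel` asks for in the case of ℶ³.
    Result : Set
    Result = ∃[ k ] ColourableOn G full (suc k) × k ≤ h

    open ℕSolver.+-*-Solver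

  -- As ℶ¹ of Kʰ⁺¹ equals C(h, 2) - 1, the bound for `G` becomes C(k, 2) ≤ C(h, 2).
  characteristic₁ : ∃[ z ] ℶ 0F (K (suc h)) z × ℶ 0F G z → Result
  characteristic₁ (z , eK , eG) with edge-bound G (edge-sets-unique G) (edge-sets-complete G) {U = full} {r = proj₁ conn} ∈⊤ (connected⇒conn G conn)
  ... | k , col , bound = k , col , choose-cancel 1 (ℕ.≤-trans (s≤s z≤n) 3≤h)
    (ℕ.+-cancelʳ-≤ (V + suc h) (k choose 2) (h choose 2) (begin
      k choose 2 + (V + suc h)      ≡⟨ sym (ℕ.+-assoc (k choose 2) V (suc h)) ⟩
      (k choose 2 + V) + suc h      ≡⟨ cong (λ i → (k choose 2 + i) + suc h) (sym size-full) ⟩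
      (k choose 2 + size full) + suc h ≤⟨ ℕ.+-monoˡ-≤ (suc h) bound ⟩
      suc (cnt (edge-sets G) [] full) + suc h ≡⟨ cong (λ i → suc i + suc h) (cnt-edges G) ⟩
      suc (E + suc h)               ≡⟨ cong suc (sym (cross Eₖ (suc h) E V (trans (sym eK) eG))) ⟩
      suc (Eₖ + V)                  ≡⟨ cong (λ i → suc (i + V)) Eₖ≡ ⟩
      suc (h + h choose 2 + V)      ≡⟨ solve 3 (λ h c v → con 1 :+ (h :+ c :+ v) := c :+ (v :+ (con 1 :+ h))) refl h (h choose 2) V ⟩
      h choose 2 + (V + suc h) ∎))

  -- The edges of Kʰ⁺¹ are counted exactly and its cycles estimated from above by C(h+1, 3), which
  -- gives C(k, 3) ≤ C(h, 3).
  characteristic₂ : ∃[ z ] ℶ 1F (K (suc h)) z × ℶ 1F G z → Result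
  characteristic₂ (z , (cₖ , (Csₖ , uₖ , complₖ , refl) , eK) , (c , (Cs , u , compl , refl) , eG))
    with cycle-bound G (edge-sets-unique G) (edge-sets-complete G) {Cs = Cs} compl {U = full} {r = proj₁ conn} ∈⊤ (connected⇒conn G conn)
  ... | k , col , bound = k , col , choose-cancel 2 (ℕ.≤-trans (s≤s (s≤s z≤n)) 3≤h)
    (ℕ.+-cancelʳ-≤ (suc E + Eₖ) (k choose 3) (h choose 3) (begin
      k choose 3 + (suc E + Eₖ)            ≡⟨ sym (ℕ.+-assoc (k choose 3) (suc E) Eₖ) ⟩
      (k choose 3 + suc E) + Eₖ            ≡⟨ cong (λ i → (k choose 3 + suc i) + Eₖ) (sym (cnt-edges G)) ⟩
      (k choose 3 + suc (cnt (edge-sets G) [] full)) + Eₖ ≤⟨ ℕ.+-monoˡ-≤ Eₖ bound ⟩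
      (cnt Cs [] full + size full) + Eₖ    ≡⟨ cong₂ (λ i j → (i + j) + Eₖ) (cnt-full Cs) size-full ⟩
      (c + V) + Eₖ                         ≡⟨ sym (cross (cₖ + suc h) Eₖ (c + V) E
         (trans (sym (three-terms cₖ Eₖ (suc h))) (trans (trans (sym eK) eG) (three-terms c E V)))) ⟩
      (cₖ + suc h) + E                     ≤⟨ ℕ.+-monoˡ-≤ E (ℕ.+-monoˡ-≤ (suc h) (few-sets uₖ (complete-cycle ∘ Equivalence.to (complₖ _)))) ⟩
      (suc h choose 3 + suc h) + E         ≡⟨ cong (λ i → (i + suc h) + E) (pascal h 2) ⟩
      (h choose 2 + h choose 3 + suc h) + E ≡⟨ solve 4 (λ a b h e → (a :+ b :+ (con 1 :+ h)) :+ e := b :+ (con 1 :+ e :+ (h :+ a))) refl (h choose 2) (h choose 3) h E ⟩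
      h choose 3 + (suc E + (h + h choose 2)) ≡⟨ cong (λ i → h choose 3 + (suc E + i)) (sym Eₖ≡) ⟩
      h choose 3 + (suc E + Eₖ) ∎))

  -- According to their signs, the solids of Kʰ⁺¹ are estimated from above and its cycles from
  -- below, which gives C(k, 4) ≤ C(h, 4).
  characteristic₃ : ∃[ z ] ℶ 2F (K (suc h)) z × ℶ 2F G z → Result
  characteristic₃ (z , (cₖ , sₖ , (Csₖ , uₖ , complₖ , refl) , (Ssₖ , u′ₖ , compl′ₖ , refl) , eK)
                     , (c , s , (Cs , u , compl , refl) , (Ss , u′ , compl′ , refl) , eG))
    with solid-bound G (edge-sets-unique G) (edge-sets-complete G) {Cs = Cs} compl {Ss = Ss} u compl′ {U = full} {r = proj₁ conn} ∈⊤ (connected⇒conn G conn)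
  ... | k , col , bound = k , col , choose-cancel 3 3≤h
    (ℕ.+-cancelʳ-≤ (c + V + (suc h choose 3 + suc h)) (k choose 4) (h choose 4) (begin
      k choose 4 + (c + V + (suc h choose 3 + suc h)) ≡⟨ sym (ℕ.+-assoc (k choose 4) (c + V) _) ⟩
      (k choose 4 + (c + V)) + (suc h choose 3 + suc h)
        ≤⟨ ℕ.+-mono-≤ bound′ (ℕ.+-monoˡ-≤ (suc h) (complete-cycles complₖ)) ⟩
      (s + suc E) + (cₖ + suc h)              ≡⟨ cong (_+ (cₖ + suc h)) (ℕ.+-suc s E) ⟩
      suc ((s + E) + (cₖ + suc h))            ≡⟨ cong suc (sym (cross (sₖ + Eₖ) (cₖ + suc h) (s + E) (c + V)
         (trans (sym (four-terms sₖ cₖ Eₖ (suc h))) (trans (trans (sym eK) eG) (four-terms s c E V))))) ⟩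
      suc ((sₖ + Eₖ) + (c + V))               ≤⟨ s≤s (ℕ.+-monoˡ-≤ (c + V) (ℕ.+-mono-≤
         (few-sets u′ₖ (complete-solid ∘ Equivalence.to (compl′ₖ _))) (ℕ.≤-reflexive Eₖ≡))) ⟩
      suc ((suc h choose 4 + (h + h choose 2)) + (c + V))
        ≡⟨ cong (λ i → suc ((i + (h + h choose 2)) + (c + V))) (pascal h 3) ⟩
      suc ((h choose 3 + h choose 4 + (h + h choose 2)) + (c + V))
        ≡⟨ solve 5 (λ a b d h x → con 1 :+ ((b :+ d :+ (h :+ a)) :+ x) := d :+ (x :+ (a :+ b :+ (con 1 :+ h)))) refl
             (h choose 2) (h choose 3) (h choose 4) h (c + V) ⟩
      h choose 4 + (c + V + (h choose 2 + h choose 3 + suc h))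
        ≡⟨ cong (λ i → h choose 4 + (c + V + (i + suc h))) (sym (pascal h 2)) ⟩
      h choose 4 + (c + V + (suc h choose 3 + suc h)) ∎))
    where
    bound′ : k choose 4 + (c + V) ≤ s + suc E
    bound′ = begin
      k choose 4 + (c + V)                        ≡⟨ cong₂ (λ i j → k choose 4 + (i + j)) (sym (cnt-full Cs)) (sym size-full) ⟩
      k choose 4 + (cnt Cs [] full + size full)   ≤⟨ bound ⟩
      cnt Ss [] full + suc (cnt (edge-sets G) [] full) ≡⟨ cong₂ (λ i j → i + suc j) (cnt-full Ss) (cnt-edges G) ⟩
      s + suc E ∎

theorem5p2p1 : ∀ {n : ℕ} (G : Graph (Fin n)) → Connected G →
    ∀ {χ h : ℕ} → IsChromaticNumber G χ → IsHadwigerNumber G h →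
    ∀ (i : Fin 3) → (∃[ z ] ℶ i (K h) z × ℶ i G z) → χ ≤ h
-- The vertex `r` alone is a minor K¹, so the Hadwiger number cannot be 0.
theorem5p2p1 G (r , _) {h = zero} _ (_ , max) _ _
  with max 1 (min-degree-minor G full 0 z≤n (λ _ → z≤n) {r} ∈⊤)
... | ()
theorem5p2p1 {n} G conn {h = suc h} (_ , min) (_ , max) i ℶ≡ with suc h ≤? 3
... | yes h<3 = min (suc h) (colours (colour-small G h<3 (λ minor → ℕ.1+n≰n (max _ minor)) full (<-wellFounded _)))
  where
  colours : ∀ {k} → ColourableOn G full k → Colourable G k
  colours (c , proper) = c , proper ∈⊤ ∈⊤
... | no h≮3 = finish (by i ℶ≡)
  where
  3≤h : 3 ≤ h
  3≤h = ℕ.≤-pred (ℕ.≰⇒> h≮3)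
  by : ∀ i → ∃[ z ] ℶ i (K (suc h)) z × ℶ i G z → ∃[ k ] ColourableOn G full (suc k) × k ≤ h
  by 0F = characteristic₁ G conn 3≤h
  by 1F = characteristic₂ G conn 3≤h
  by 2F = characteristic₃ G conn 3≤h
  finish : ∃[ k ] ColourableOn G full (suc k) × k ≤ h → _ ≤ suc h
  finish (k , (c , proper) , k≤h) = ℕ.≤-trans (min (suc k) (c , proper ∈⊤ ∈⊤)) (s≤s k≤h)
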